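{- Let $\alpha \in (0,1)$, let $\mathcal{H} = (\mathcal{H}_n)_{n \in \mathbb{N}}$ be a sequence of $3$-uniform hypergraphs with $|V(\mathcal{H}_n)| = n$, and let $\mathcal{B} = (\mathcal{B}_n)_{n\in\mathbb{N}}$ where each $\mathcal{B}_n$ is a family of subsets of $V(\mathcal{H}_n)$. Suppose that $\mathcal{H}$ is $(\alpha,\mathcal{B})$-stable, that $e(\mathcal{H}_n) = \Theta(n^2)$ and $\Delta_2(\mathcal{H}_n) = O(1)$, that $|\mathcal{B}_n| = n^{O(1)}$, that $\alpha(\mathcal{H}_n) \geqslant \|\mathcal{B}_n\| \geqslant \alpha n$, and that $\delta(\mathcal{H}_n,\mathcal{B}_n) = \Omega(n)$. Then there exists a constant $C = C(\mathcal{H},\mathcal{B}) > 0$ such that if $m \geqslant C\sqrt{n\log n}$, then almost every independent set in $\mathcal{H}_n$ of size $m$ is a subset of some $B \in \mathcal{B}_n$; that is, the number of independent sets of size $m$ in $\mathcal{H}_n$ not contained in any $B \in \mathcal{B}_n$ is $o(1)$ times the number of independent sets of size $m$ in $\mathcal{H}_n$, as $n \to \infty$.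
   Context: $|\mathcal{B}_n|$ is the number of sets in $\mathcal{B}_n$ and $\|\mathcal{B}_n\| = \max\{|B| : B \in \mathcal{B}_n\}$. The sequence $\mathcal{H}$ is $(\alpha,\mathcal{B})$-stable if for every $\gamma > 0$ there exists $\beta > 0$ such that for all $n$: if $A \subseteq V(\mathcal{H}_n)$ with $|A| \geqslant (\alpha-\beta)n$, then either $e(\mathcal{H}_n[A]) \geqslant \beta e(\mathcal{H}_n)$, or $|A \setminus B| \leqslant \gamma n$ for some $B \in \mathcal{B}_n$. $\Delta_2(\mathcal{H}_n)$ is the maximum, over pairs $T$ of vertices, of the number of edges of $\mathcal{H}_n$ containing $T$. $\delta(\mathcal{H}_n,\mathcal{B}_n) = \min_{B \in \mathcal{B}_n}\min_{v \in V(\mathcal{H}_n)\setminus B} |\{e \in \mathcal{H}_n : |e\cap B| = 2,\ v \in e\}|$. $\alpha(\mathcal{H}_n)$ is the size of a largest independent set of $\mathcal{H}_n$ (a set containing no edge). Asymptotic notation refers to $n \to \infty$. -}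

module Defs where

open import Data.Nat as ℕ using (ℕ; zero; suc; _⊔_; _≥_; _^_)
open import Data.Integer using (+_)
open import Data.Rational as ℚ using (ℚ; _/_)
open import Data.Bool using (Bool; true; false; _∧_; not)
open import Data.List using (List; []; _∷_; map; _++_; filter; length; foldr)
open import Data.Bool.ListAction using (any)
open import Data.Vec using ([]; _∷_)
open import Data.Fin using (Fin; _≟_)
open import Data.Fin.Subset using (Subset; inside; outside; _∩_; ∁; ∣_∣; _∈_; _∉_; _⊆_)
open import Data.Fin.Subset.Properties using (_⊆?_; _∈?_)
open import Data.Product using (Σ; ∃; _×_; _,_)
open import Data.Sum using (_⊎_)
open import Relation.Nullary using (¬_; does)
open import Relation.Binary.PropositionalEquality using (_≡_)

record ℝ : Set₁ where
  field
    L U          : ℚ → Set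
    L-inhabited  : ∃ λ q → L q
    U-inhabited  : ∃ λ q → U q
    L-rounded    : ∀ q → (L q → ∃ λ r → q ℚ.< r × L r) × ((∃ λ r → q ℚ.< r × L r) → L q)
    U-rounded    : ∀ q → (U q → ∃ λ r → r ℚ.< q × U r) × ((∃ λ r → r ℚ.< q × U r) → U q)
    disjoint     : ∀ q → ¬ (L q × U q)
    located      : ∀ q r → q ℚ.< r → L q ⊎ U r

ℕ→ℚ : ℕ → ℚ
ℕ→ℚ n = (+ n) / 1

-- For a real x and rational q: x < q  iff  q ∈ U x ; q < x iff q ∈ L x.
-- "α ∈ (0,1)":
InUnitInterval : ℝ → Set
InUnitInterval α = ℝ.L α ℚ.0ℚ × ℝ.U α ℚ.1ℚ

allSubsets : (n : ℕ) → List (Subset n)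
allSubsets zero    = [] ∷ []
allSubsets (suc n) = map (outside ∷_) (allSubsets n) ++ map (inside ∷_) (allSubsets n)

count : ∀ {n} → (Subset n → Bool) → ℕ
count {n} P = length (filter (λ S → P S Data.Bool.≟ true) (allSubsets n))

-- maximum of f over all subsets satisfying P (0 if none)
maxOver : ∀ {n} → (Subset n → Bool) → (Subset n → ℕ) → ℕ
maxOver {n} P f = foldr (λ S acc → (if P S then f S else 0) ⊔ acc) 0 (allSubsets n)
  where open import Data.Bool using (if_then_else_)

_⊆ᵇ_ : ∀ {n} → Subset n → Subset n → Bool
A ⊆ᵇ B = does (A ⊆? B)

_∈ᵇ_ : ∀ {n} → Fin n → Subset n → Bool
x ∈ᵇ A = does (x ∈? A)

_≡ᵇ_ : ℕ → ℕ → Bool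
a ≡ᵇ b = does (a ℕ.≟ b)

record Hypergraph3 (n : ℕ) : Set where
  field
    edge    : Subset n → Bool
    uniform : ∀ e → edge e ≡ true → ∣ e ∣ ≡ 3

Family : ℕ → Set
Family n = Subset n → Bool

module _ {n : ℕ} (H : Hypergraph3 n) where
  open Hypergraph3 H

  e : ℕ
  e = count edge

  eInduced : Subset n → ℕ
  eInduced A = count (λ f → edge f ∧ (f ⊆ᵇ A))

  isIndependent : Subset n → Bool
  isIndependent A = not (any (λ f → edge f ∧ (f ⊆ᵇ A)) (allSubsets n))

  independenceNumber : ℕ
  independenceNumber = maxOver isIndependent ∣_∣

  codegree : Fin n → Fin n → ℕ
  codegree x y = count (λ f → edge f ∧ (x ∈ᵇ f) ∧ (y ∈ᵇ f))

  Δ₂≤ : ℕ → Set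
  Δ₂≤ K = ∀ x y → ¬ (x ≡ y) → codegree x y ℕ.≤ K

  degB : Subset n → Fin n → ℕ
  degB B v = count (λ f → edge f ∧ (∣ f ∩ B ∣ ≡ᵇ 2) ∧ (v ∈ᵇ f))

  -- K · δ(H,ℬ) ≥ x  (δ is the minimum over B ∈ ℬ and v ∉ B)
  Kδ≥ : Family n → ℕ → ℕ → Set
  Kδ≥ ℬ K x = ∀ B → ℬ B ≡ true → ∀ v → v ∉ B → x ℕ.≤ K ℕ.* degB B v

  numIndep : ℕ → ℕ
  numIndep m = count (λ A → isIndependent A ∧ (∣ A ∣ ≡ᵇ m))

  numIndepBad : Family n → ℕ → ℕ
  numIndepBad ℬ m = count (λ A → isIndependent A ∧ (∣ A ∣ ≡ᵇ m)
                               ∧ not (any (λ B → ℬ B ∧ (A ⊆ᵇ B)) (allSubsets n)))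

familySize : ∀ {n} → Family n → ℕ
familySize ℬ = count ℬ

familyNorm : ∀ {n} → Family n → ℕ
familyNorm ℬ = maxOver ℬ ∣_∣

Pos : ℚ → Set
Pos q = ℚ.0ℚ ℚ.< q

-- |A| ≥ (α - β) n, for real α and rational β
SizeAtLeast : ℝ → ℚ → ℕ → ℕ → Set
SizeAtLeast α β n a = ∀ q → ℝ.L α q → (q ℚ.- β) ℚ.* ℕ→ℚ n ℚ.≤ ℕ→ℚ a

Stable : ℝ → (H : (n : ℕ) → Hypergraph3 n) → ((n : ℕ) → Family n) → Set
Stable α H ℬ =
  ∀ (γ : ℚ) → Pos γ →
  ∃ λ (β : ℚ) → Pos β ×
    (∀ n (A : Subset n) → SizeAtLeast α β n ∣ A ∣ →
       (β ℚ.* ℕ→ℚ (e (H n)) ℚ.≤ ℕ→ℚ (eInduced (H n) A))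
       ⊎ (∃ λ B → ℬ n B ≡ true × ℕ→ℚ ∣ A ∩ ∁ B ∣ ℚ.≤ γ ℚ.* ℕ→ℚ n))

Eventually : (ℕ → Set) → Set
Eventually P = ∃ λ N → ∀ n → n ≥ N → P n

{-# OPTIONS --safe #-}

-- Weight a set I by m^|I| b^(n-|I|) with b = ‖ℬ‖ - m, a multiple of the product measure of
-- density p = m/‖ℬ‖. Up to a factor ‖ℬ‖ + 1, the m-subsets of a largest independent set carry
-- weight at least ‖ℬ‖^‖ℬ‖ b^(n-‖ℬ‖), so it suffices that the bad sets carry much less. Their
-- weight is bounded along decision trees: vertices are queried one at a time, and picking v
-- discards every vertex that forms an edge with v and an already picked vertex.
--
-- Bad sets I with |I \ B| ≥ m/δ̄ for every B in ℬ: the tree queries a vertex with many edges in the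
-- links of the picked vertices if there is one, and otherwise a vertex of large degree. Only a
-- small proportion of m picks fits on a branch before stability applies to the set A of
-- available vertices: either A is smaller than ‖ℬ‖ by a positive proportion of n, or almost all
-- of A lies in some B. Both cases save a factor exponential in m, which pays for the picks.
--
-- Bad sets with S = I \ B small for some B: the links of S span about |S|n pairs in B, so every
-- large part of B has a vertex with about |S| neighbours, and each query saves a factor
-- 1 - Ω(p min(1, p|S|)). The total saving exp(-c min(|S|m²/n, m)) beats the number of choices of
-- S and B as soon as m² ≥ C² n log n.
--
-- This needs n = O(b). For m close to ‖ℬ‖ there are no bad sets at all, since the link of a vertex
-- of I \ B forces I to miss a positive proportion of B.

module Submission where

open import Defs
open import Data.Nat using (ℕ; _≤_; _*_; _^_; _≥_)
open import Data.Nat.Logarithm using (⌊log₂_⌋)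
open import Data.Rational as ℚ using (ℚ)
open import Data.Product using (∃; _×_)

open import Data.Bool using (Bool; true; false; _∧_; _∨_; not; if_then_else_)
import Data.Bool as Bool
open import Data.Bool.ListAction using (any)
open import Data.Bool.Properties using (T-≡; ∧-comm; ∧-zeroʳ; ∧-identityʳ; ∨-identityʳ; ∨-zeroʳ; ¬-not; not-involutive)
open import Data.Empty using (⊥; ⊥-elim)
open import Data.Fin using (Fin; zero; suc; toℕ)
import Data.Fin as Fin
open import Data.Fin.Properties using (all?; any?; toℕ<n)
open import Data.Fin.Subset using (Subset; inside; outside; ∣_∣; _∪_; _∩_; ∁; ⁅_⁆; _∈_; _∉_; _⊆_) renaming (⊥ to ∅)
open import Data.Fin.Subset.Properties using (∪-comm; ∪-assoc; ∪-idem; ∪-identityˡ; ∪-identityʳ; x∈⁅x⁆; x∈⁅y⁆⇒x≡y; x∈p∪q⁻; x∈p∪q⁺; ∣⁅x⁆∣≡1; ∣p∣≤n; _∈?_; _⊆?_; x∈p∩q⁻; anySubset?)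
import Data.Integer as ℤ
import Data.Integer.Properties as ℤₚ
open import Data.List using (List; []; _∷_; map; _++_; filter; length; foldr)
open import Data.List.Membership.Propositional using () renaming (_∈_ to _∈ˡ_)
open import Data.List.Membership.Propositional.Properties using (∈-map⁺; ∈-++⁺ˡ; ∈-++⁺ʳ)
import Data.List.Relation.Unary.Any as Any
open import Data.List.Relation.Unary.Any using (here; there; satisfied)
open import Data.List.Relation.Unary.Any.Properties using (any⁺; any⁻)
open import Data.Nat hiding (_≡ᵇ_)
open import Data.Nat.Combinatorics using (nC1≡n; nCk+nC[k+1]≡[n+1]C[k+1]; k>n⇒nCk≡0) renaming (_C_ to infixl 9 _choose_)
open import Data.Nat.DivMod using (_/_; _%_; m/n*n≤m; m≡m%n+[m/n]*n; m%n<n)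
open import Data.Nat.Logarithm using (⌊log₂⌋-mono-≤; ⌊log₂[2^n]⌋≡n)
open import Data.Nat.Properties
open import Data.Nat.Tactic.RingSolver using (solve-∀)
open import Data.Product using (_,_; proj₁; proj₂)
open import Data.Rational using (mkℚ)
import Data.Rational.Properties as ℚₚ
import Data.Rational.Unnormalised as ℚᵘ
import Data.Rational.Unnormalised.Properties as ℚᵘₚ
open import Data.Sum using (_⊎_; inj₁; inj₂; [_,_]′)
open import Data.Vec using ([]; _∷_; lookup; tabulate)
open import Data.Vec.Properties using (lookup∘tabulate; lookup-map; lookup-zipWith; lookup⇒[]=; []=⇒lookup; ≡-dec)
open import Function using (_∘_)
open import Function.Bundles using (Equivalence)
import Algebra.Properties.CommutativeSemiring.Binomial as Binomial
open import Algebra.Properties.Monoid.Mult +-0-monoid using () renaming (_×_ to _·_)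
open import Algebra.Properties.Semiring.Exp +-*-semiring using () renaming (_^_ to _^′_)
open import Algebra.Properties.Semiring.Sum +-*-semiring using (sum; sum-cong-≗; ∑-distrib-+; ∑-comm; *-distribˡ-sum; *-distribʳ-sum)
open import Relation.Nullary using (¬_; ¬?; Dec; yes; no; does)
open import Relation.Nullary.Decidable using (_×-dec_; _→-dec_)
open import Relation.Binary.PropositionalEquality using (_≡_; _≢_; refl; sym; trans; cong; cong₂; subst; subst₂)
open ≤-Reasoning

-- Exponential inequalities in ℕ

-- The weight is a product over vertices, so at a node of a decision tree it is again a product and
-- each query costs one explicit factor; the uniform measure on `m`-sets lacks this. Logarithms and
-- real densities are avoided: a positive constant is represented by a natural upper bound on its
-- reciprocal (`k` for the degree into `B`, `g` and `β̄` for stability, `δ̄` for the near/far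
-- threshold, `c̄` for `b / n`), and every inequality is cleared of denominators. This is where the
-- many powers of `b` come from; 2 and 4 stand in for e.
--
-- The constants admit only one order. Stability at `g₀` yields `c̄`. The near case then dictates
-- how few exceptional vertices it can afford to enumerate, hence `δ̄`. The far case needs `A ∖ B`
-- so small that `m / 2δ̄` further picks inside it are exponentially unlikely, which fixes `g`, and
-- a second use of stability, at `g`, yields `β̄`. The constant `C₀` of the theorem depends only on
-- the degree bounds and on the exponent of the family size, so it precedes all of these; the
-- required ratio `κ` enters only the threshold for `n`.

cancelˡ : ∀ {o m n} → 1 ≤ o → o * m ≤ o * n → m ≤ n
cancelˡ {o} o≥1 = *-cancelˡ-≤ o {{>-nonZero o≥1}}

cancelʳ : ∀ {o m n} → 1 ≤ o → m * o ≤ n * o → m ≤ n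
cancelʳ {o} {m} {n} o≥1 = *-cancelʳ-≤ m n o {{>-nonZero o≥1}}

1≤^ : ∀ {m} n → 1 ≤ m → 1 ≤ m ^ n
1≤^ {m} n m≥1 = m^n>0 m {{>-nonZero m≥1}} n

1≤* : ∀ {m n} → 1 ≤ m → 1 ≤ n → 1 ≤ m * n
1≤* = *-mono-≤

^-mono-exp : ∀ {m i j} → 1 ≤ m → i ≤ j → m ^ i ≤ m ^ j
^-mono-exp {m} m≥1 = ^-monoʳ-≤ m {{>-nonZero m≥1}}

^-cancel-≤ : ∀ {k u v} → 1 ≤ k → u ^ k ≤ v ^ k → u ≤ v
^-cancel-≤ {k} k≥1 le = ≮⇒≥ λ v<u → <⇒≱ (^-monoˡ-< k {{>-nonZero k≥1}} v<u) le

*-^ : ∀ u v k → (u * v) ^ k ≡ u ^ k * v ^ k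
*-^ u v zero    = refl
*-^ u v (suc k) = trans (cong (u * v *_) (*-^ u v k)) (shuffle u v (u ^ k) (v ^ k))
  where
  shuffle : ∀ a b c d → a * b * (c * d) ≡ a * c * (b * d)
  shuffle = solve-∀

≤⇒+ : ∀ {m n} → m ≤ n → ∃ λ d → n ≡ m + d
≤⇒+ {m} {n} m≤n = n ∸ m , sym (m+[n∸m]≡n m≤n)

<suc-quotient : ∀ m n .{{_ : NonZero n}} → m < suc (m / n) * n
<suc-quotient m n = begin-strict
  m  ≡⟨ m≡m%n+[m/n]*n m n ⟩
  m % n + m / n * n  <⟨ +-monoˡ-< (m / n * n) (m%n<n m n) ⟩
  n + m / n * n  ∎

bernoulli : ∀ v u k → v ^ k * (v + k * u) ≤ (v + u) ^ k * v
bernoulli v u zero    = ≤-reflexive (cong (_+ 0) (+-identityʳ v))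
bernoulli v u (suc k) = begin
  v * v ^ k * (v + (u + k * u))  ≤⟨ m≤m+n _ (v ^ k * (k * u * u)) ⟩
  v * v ^ k * (v + (u + k * u)) + v ^ k * (k * u * u) ≡⟨ id₁ v u k (v ^ k) ⟩
  (v + u) * (v ^ k * (v + k * u))  ≤⟨ *-monoʳ-≤ (v + u) (bernoulli v u k) ⟩
  (v + u) * ((v + u) ^ k * v)  ≡⟨ *-assoc (v + u) _ v ⟨
  (v + u) * (v + u) ^ k * v  ∎
  where
  id₁ : ∀ v u k V → v * V * (v + (u + k * u)) + V * (k * u * u) ≡ (v + u) * (V * (v + k * u))
  id₁ = solve-∀

-- This is `(1 - x)^k ≥ 1 - kx` at `x = u / (v + u)`, with the subtracted term moved to the right to
-- stay in ℕ.
bernoulli⁻ : ∀ v u k → (v + u) ^ k * (v + u) ≤ v ^ k * (v + u) + k * u * (v + u) ^ k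
bernoulli⁻ v u zero    = m≤m+n _ _
bernoulli⁻ v u (suc k) = begin
  (v + u) * S * (v + u)  ≡⟨ id₁ v u S ⟩
  v * (S * (v + u)) + u * (v + u) * S  ≤⟨ +-monoˡ-≤ _ (*-monoʳ-≤ v (bernoulli⁻ v u k)) ⟩
  v * (V * (v + u) + k * u * S) + u * (v + u) * S  ≤⟨ m≤m+n _ (k * u * u * S) ⟩
  v * (V * (v + u) + k * u * S) + u * (v + u) * S + k * u * u * S ≡⟨ id₂ v u k V S ⟩
  v * V * (v + u) + (u + k * u) * ((v + u) * S)  ∎
  where
  S = (v + u) ^ k
  V = v ^ k
  id₁ : ∀ v u S → (v + u) * S * (v + u) ≡ v * (S * (v + u)) + u * (v + u) * S
  id₁ = solve-∀
  id₂ : ∀ v u k V S → v * (V * (v + u) + k * u * S) + u * (v + u) * S + k * u * u * S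
                    ≡ v * V * (v + u) + (u + k * u) * ((v + u) * S)
  id₂ = solve-∀

^-doubling : ∀ v u k → 1 ≤ v + u → 2 * (k * u) ≤ v + u → (v + u) ^ k ≤ 2 * v ^ k
^-doubling v u k s≥1 h = cancelʳ s≥1 (+-cancelʳ-≤ (S * s) (S * s) _ (begin
  S * s + S * s  ≤⟨ +-mono-≤ b b ⟩
  (V * s + k * u * S) + (V * s + k * u * S)  ≡⟨ id₁ V s (k * u) S ⟩
  2 * V * s + S * (2 * (k * u))  ≤⟨ +-monoʳ-≤ (2 * V * s) (*-monoʳ-≤ S h) ⟩
  2 * V * s + S * s  ∎))
  where
  s = v + u
  S = s ^ k
  V = v ^ k
  b = bernoulli⁻ v u k
  id₁ : ∀ V s t S → (V * s + t * S) + (V * s + t * S) ≡ 2 * V * s + S * (2 * t)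
  id₁ = solve-∀

-- As `v / u ≥ 1`, a bound on one of its powers passes to smaller exponents. Exponents can thus be
-- rounded up to convenient multiples.
^-ratio-anti : ∀ {u v} c n e → 1 ≤ u → u ≤ v → v ^ (n + e) ≤ c * u ^ (n + e) → v ^ n ≤ c * u ^ n
^-ratio-anti {u} {v} c n e u≥1 u≤v h = cancelʳ (1≤^ e (≤-trans u≥1 u≤v)) (begin
  v ^ n * v ^ e  ≡⟨ ^-distribˡ-+-* v n e ⟨
  v ^ (n + e)  ≤⟨ h ⟩
  c * u ^ (n + e)  ≡⟨ cong (c *_) (^-distribˡ-+-* u n e) ⟩
  c * (u ^ n * u ^ e)  ≡⟨ *-assoc c _ _ ⟨
  c * u ^ n * u ^ e  ≤⟨ *-monoʳ-≤ (c * u ^ n) (^-monoˡ-≤ e u≤v) ⟩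
  c * u ^ n * v ^ e  ∎)

-- With `k = ⌈q / 2⌉` the condition of `^-doubling` holds, so `(1 + 1/q)^k ≤ 2`; squaring gives 4 at
-- the exponent `2k ≥ q`.
[1+1/q]^q≤4 : ∀ q → (q + 1) ^ q ≤ 4 * q ^ q
[1+1/q]^q≤4 zero      = s≤s z≤n
[1+1/q]^q≤4 q@(suc p) with ≤⇒+ q≤2k
  where
  k = suc (p / 2)
  q≤2k : q ≤ k * 2
  q≤2k = <suc-quotient p 2
... | e , eq = ^-ratio-anti 4 q e (s≤s z≤n) (m≤m+n q 1) (subst (λ t → (q + 1) ^ t ≤ 4 * q ^ t) eq (begin
  (q + 1) ^ (k * 2)  ≡⟨ ^-*-assoc (q + 1) k 2 ⟨
  ((q + 1) ^ k) ^ 2  ≤⟨ ^-monoˡ-≤ 2 (^-doubling q 1 k (s≤s z≤n) 2k≤) ⟩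
  (2 * q ^ k) ^ 2  ≡⟨ *-^ 2 (q ^ k) 2 ⟩
  4 * (q ^ k) ^ 2  ≡⟨ cong (4 *_) (^-*-assoc q k 2) ⟩
  4 * q ^ (k * 2)  ∎))
  where
  k = suc (p / 2)
  id₁ : ∀ j → 2 * (suc j * 1) ≡ 2 + j * 2
  id₁ = solve-∀
  2k≤ : 2 * (k * 1) ≤ q + 1
  2k≤ = begin
    2 * (k * 1)  ≡⟨ id₁ (p / 2) ⟩
    2 + p / 2 * 2  ≤⟨ +-monoʳ-≤ 2 (m/n*n≤m p 2) ⟩
    2 + p  ≡⟨ cong suc (+-comm p 1) ⟨
    q + 1  ∎

-- Bernoulli gives `1 + m/b ≤ (1 + 1/b)^m`, and the `b`-th power of the right side is at most `4^m`.
[1+m/b]^b≤4^m : ∀ b m → 1 ≤ b → (b + m) ^ b ≤ 4 ^ m * b ^ b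
[1+m/b]^b≤4^m b m b≥1 = cancelˡ (1≤^ b (1≤^ m b≥1)) (begin
  (b ^ m) ^ b * (b + m) ^ b  ≡⟨ *-^ (b ^ m) (b + m) b ⟨
  (b ^ m * (b + m)) ^ b  ≡⟨ cong (λ t → (b ^ m * (b + t)) ^ b) (*-identityʳ m) ⟨
  (b ^ m * (b + m * 1)) ^ b  ≤⟨ ^-monoˡ-≤ b (bernoulli b 1 m) ⟩
  ((b + 1) ^ m * b) ^ b  ≡⟨ *-^ ((b + 1) ^ m) b b ⟩
  ((b + 1) ^ m) ^ b * b ^ b  ≡⟨ cong (_* b ^ b) (swap (b + 1) m b) ⟩
  ((b + 1) ^ b) ^ m * b ^ b  ≤⟨ *-monoˡ-≤ (b ^ b) (^-monoˡ-≤ m ([1+1/q]^q≤4 b)) ⟩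
  (4 * b ^ b) ^ m * b ^ b  ≡⟨ cong (_* b ^ b) (*-^ 4 (b ^ b) m) ⟩
  4 ^ m * (b ^ b) ^ m * b ^ b  ≡⟨ cong (λ t → 4 ^ m * t * b ^ b) (swap b b m) ⟩
  4 ^ m * (b ^ m) ^ b * b ^ b  ≡⟨ id₁ (4 ^ m) ((b ^ m) ^ b) (b ^ b) ⟩
  (b ^ m) ^ b * (4 ^ m * b ^ b)  ∎)
  where
  swap : ∀ x i j → (x ^ i) ^ j ≡ (x ^ j) ^ i
  swap x i j = trans (^-*-assoc x i j) (trans (cong (x ^_) (*-comm i j)) (sym (^-*-assoc x j i)))
  id₁ : ∀ x y z → x * y * z ≡ y * (x * z)
  id₁ = solve-∀

[1+m/b]^n≤4^cm : ∀ b m n c → 1 ≤ b → n ≤ c * b → (b + m) ^ n ≤ 4 ^ (c * m) * b ^ n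
[1+m/b]^n≤4^cm b m n c b≥1 n≤cb with ≤⇒+ n≤cb
... | e , eq = ^-ratio-anti (4 ^ (c * m)) n e b≥1 (m≤m+n b m) (subst (λ t → (b + m) ^ t ≤ 4 ^ (c * m) * b ^ t) eq (begin
  (b + m) ^ (c * b)  ≡⟨ cong ((b + m) ^_) (*-comm c b) ⟩
  (b + m) ^ (b * c)  ≡⟨ ^-*-assoc (b + m) b c ⟨
  ((b + m) ^ b) ^ c  ≤⟨ ^-monoˡ-≤ c ([1+m/b]^b≤4^m b m b≥1) ⟩
  (4 ^ m * b ^ b) ^ c  ≡⟨ *-^ (4 ^ m) (b ^ b) c ⟩
  (4 ^ m) ^ c * (b ^ b) ^ c  ≡⟨ cong₂ _*_ (^-*-assoc 4 m c) (^-*-assoc b b c) ⟩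
  4 ^ (m * c) * b ^ (b * c)  ≡⟨ cong₂ (λ s t → 4 ^ s * b ^ t) (*-comm m c) (*-comm b c) ⟩
  4 ^ (c * m) * b ^ (c * b)  ∎))

-- The length `j = ⌊b/m⌋ + 1` is just enough for `(1 + m/b)^j ≥ 1 + jm/b ≥ 2`, and `m` blocks of
-- that length fit into `b + m ≤ n`.
2^m≤[1+m/b]^n : ∀ b m n → 1 ≤ b → 1 ≤ m → b + m ≤ n → 2 ^ m * b ^ n ≤ (b + m) ^ n
2^m≤[1+m/b]^n b m n b≥1 m≥1 N≤n with ≤⇒+ jm≤n
  where
  instance _ = >-nonZero m≥1
  jm≤n : suc (b / m) * m ≤ n
  jm≤n = begin
    m + b / m * m  ≤⟨ +-monoʳ-≤ m (m/n*n≤m b m) ⟩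
    m + b  ≡⟨ +-comm m b ⟩
    b + m  ≤⟨ N≤n ⟩
    n  ∎
... | e , refl = begin
  2 ^ m * b ^ (j * m + e)  ≡⟨ cong (2 ^ m *_) (^-distribˡ-+-* b (j * m) e) ⟩
  2 ^ m * (b ^ (j * m) * b ^ e)  ≡⟨ *-assoc (2 ^ m) _ _ ⟨
  2 ^ m * b ^ (j * m) * b ^ e  ≡⟨ cong (λ t → 2 ^ m * t * b ^ e) (^-*-assoc b j m) ⟨
  2 ^ m * (b ^ j) ^ m * b ^ e  ≡⟨ cong (_* b ^ e) (*-^ 2 (b ^ j) m) ⟨
  (2 * b ^ j) ^ m * b ^ e  ≤⟨ *-mono-≤ (^-monoˡ-≤ m double) (^-monoˡ-≤ e (m≤m+n b m)) ⟩
  ((b + m) ^ j) ^ m * (b + m) ^ e  ≡⟨ cong (_* (b + m) ^ e) (^-*-assoc (b + m) j m) ⟩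
  (b + m) ^ (j * m) * (b + m) ^ e  ≡⟨ ^-distribˡ-+-* (b + m) (j * m) e ⟨
  (b + m) ^ (j * m + e)  ∎
  where
  instance _ = >-nonZero m≥1
  j = suc (b / m)
  id₁ : ∀ x b → 2 * x * b ≡ x * (b + b)
  id₁ = solve-∀
  double : 2 * b ^ j ≤ (b + m) ^ j
  double = cancelʳ b≥1 (begin
    2 * b ^ j * b  ≡⟨ id₁ (b ^ j) b ⟩
    b ^ j * (b + b)  ≤⟨ *-monoʳ-≤ (b ^ j) (+-monoʳ-≤ b (<⇒≤ (<suc-quotient b m))) ⟩
    b ^ j * (b + j * m)  ≤⟨ bernoulli b m j ⟩
    (b + m) ^ j * b  ∎)

halving : ∀ q F E → F * suc q ≤ E → q ^ E * 2 ^ F ≤ suc q ^ E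
halving q F E FQ≤E with ≤⇒+ FQ≤E
... | e , refl = begin
  q ^ (F * Q + e) * 2 ^ F  ≡⟨ cong (_* 2 ^ F) (^-distribˡ-+-* q (F * Q) e) ⟩
  q ^ (F * Q) * q ^ e * 2 ^ F  ≡⟨ cong (λ t → q ^ t * q ^ e * 2 ^ F) (*-comm F Q) ⟩
  q ^ (Q * F) * q ^ e * 2 ^ F  ≡⟨ cong (λ t → t * q ^ e * 2 ^ F) (^-*-assoc q Q F) ⟨
  (q ^ Q) ^ F * q ^ e * 2 ^ F  ≡⟨ id₁ ((q ^ Q) ^ F) (q ^ e) (2 ^ F) ⟩
  2 ^ F * (q ^ Q) ^ F * q ^ e  ≡⟨ cong (_* q ^ e) (*-^ 2 (q ^ Q) F) ⟨
  (2 * q ^ Q) ^ F * q ^ e  ≤⟨ *-mono-≤ (^-monoˡ-≤ F (half q)) (^-monoˡ-≤ e (n≤1+n q)) ⟩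
  (Q ^ Q) ^ F * Q ^ e  ≡⟨ cong (_* Q ^ e) (^-*-assoc Q Q F) ⟩
  Q ^ (Q * F) * Q ^ e  ≡⟨ cong (λ t → Q ^ t * Q ^ e) (*-comm Q F) ⟩
  Q ^ (F * Q) * Q ^ e  ≡⟨ ^-distribˡ-+-* Q (F * Q) e ⟨
  Q ^ (F * Q + e)  ∎
  where
  Q = suc q
  id₁ : ∀ x y z → x * y * z ≡ z * x * y
  id₁ = solve-∀
  half : ∀ q → 2 * q ^ suc q ≤ suc q ^ suc q
  half zero    = z≤n
  half q@(suc _) = cancelʳ {q} (s≤s z≤n) (begin
    2 * q ^ suc q * q  ≡⟨ id₂ (q ^ suc q) q ⟩
    q ^ suc q * (q + q)  ≤⟨ *-monoʳ-≤ (q ^ suc q) (+-monoʳ-≤ q (≤-trans (n≤1+n q) (≤-reflexive (sym (*-identityʳ (suc q)))))) ⟩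
    q ^ suc q * (q + suc q * 1)  ≤⟨ bernoulli q 1 (suc q) ⟩
    (q + 1) ^ suc q * q  ≡⟨ cong (λ t → t ^ suc q * q) (+-comm q 1) ⟩
    suc q ^ suc q * q  ∎)
    where
    id₂ : ∀ x b → 2 * x * b ≡ x * (b + b)
    id₂ = solve-∀

-- With p = m / N, this is  (1 - p) + p ((1 - p) / θ)^D ≤ θ  for θ = 1 - 1/Q and 1/Q ≤ D p² / 4.
branching-step : ∀ b m D q → let N = b + m; Q = suc q in 1 ≤ N →
  D * m ≤ N → 4 * (N * N) ≤ D * (m * m) * Q →
  b * (b * Q) * (N * q) ^ D + m * (b * Q) ^ suc D ≤ b * (N * q) ^ suc D
branching-step b m D q N≥1 Dm≤N large = cancelʳ {2 * N + D * m} (≤-trans N≥1 (≤-trans (m≤m+n N _) (m≤m+n (2 * N) _))) (begin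
  (b * y * Z + m * (y * Y)) * s  ≡⟨ id₁ b y Z m Y s ⟩
  b * y * Z * s + m * y * (Y * s)  ≤⟨ +-monoʳ-≤ (b * y * Z * s) (*-monoʳ-≤ (m * y) Y≤) ⟩
  b * y * Z * s + m * y * (Z * (2 * N))  ≡⟨ id₂ b Q Z s m N ⟩
  b * Z * (Q * (b * s + m * (2 * N)))  ≤⟨ *-monoʳ-≤ (b * Z) main ⟩
  b * Z * (N * q * s)  ≡⟨ id₃ b Z (N * q) s ⟩
  b * (z * Z) * s  ∎)
  where
  N = b + m
  Q = suc q
  y = b * Q
  z = N * q
  Y = y ^ D
  Z = z ^ D
  s = 2 * N + D * m
  id₁ : ∀ b y Z m Y s → (b * y * Z + m * (y * Y)) * s ≡ b * y * Z * s + m * y * (Y * s)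
  id₁ = solve-∀
  id₂ : ∀ b Q Z s m N → b * (b * Q) * Z * s + m * (b * Q) * (Z * (2 * N)) ≡ b * Z * (Q * (b * s + m * (2 * N)))
  id₂ = solve-∀
  id₃ : ∀ b Z z s → b * Z * (z * s) ≡ b * (z * Z) * s
  id₃ = solve-∀
  large′ : 4 * (N * N) ≤ m * N * Q
  large′ = begin
    4 * (N * N)  ≤⟨ large ⟩
    D * (m * m) * Q  ≡⟨ id₄ D m Q ⟩
    m * (D * m) * Q  ≤⟨ *-monoˡ-≤ Q (*-monoʳ-≤ m Dm≤N) ⟩
    m * N * Q  ∎
    where
    id₄ : ∀ D m Q → D * (m * m) * Q ≡ m * (D * m) * Q
    id₄ = solve-∀
  -- Here `y / z = (1 - p) / θ`. The bound `1 / (1 + p/2)` has the shape that Bernoulli needs: its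
  -- `D`-th power is at most `1 / (1 + Dp/2) = 2N / s`.
  y/z : y * (2 * N + m) ≤ 2 * N * z
  y/z = +-cancelʳ-≤ (4 * (N * N)) _ _ (begin
    y * (2 * N + m) + 4 * (N * N)  ≤⟨ +-monoʳ-≤ (y * (2 * N + m)) large′ ⟩
    y * (2 * N + m) + m * N * Q  ≤⟨ m≤m+n _ (2 * (N * N) + m * m * Q) ⟩
    y * (2 * N + m) + m * N * Q + (2 * (N * N) + m * m * Q)  ≡⟨ id₅ b m q ⟩
    2 * N * z + 4 * (N * N)  ∎)
    where
    id₅ : ∀ b m q → b * suc q * (2 * (b + m) + m) + m * (b + m) * suc q + (2 * ((b + m) * (b + m)) + m * m * suc q)
        ≡ 2 * (b + m) * ((b + m) * q) + 4 * ((b + m) * (b + m))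
    id₅ = solve-∀
  Y≤ : Y * s ≤ Z * (2 * N)
  Y≤ = cancelˡ (1≤^ D (≤-trans N≥1 (m≤m+n N _))) (begin
    (2 * N) ^ D * (Y * s)  ≡⟨ id₆ ((2 * N) ^ D) Y s ⟩
    Y * ((2 * N) ^ D * (2 * N + D * m))  ≤⟨ *-monoʳ-≤ Y (bernoulli (2 * N) m D) ⟩
    Y * ((2 * N + m) ^ D * (2 * N))  ≡⟨ *-assoc Y _ _ ⟨
    Y * (2 * N + m) ^ D * (2 * N)  ≡⟨ cong (_* (2 * N)) (*-^ y (2 * N + m) D) ⟨
    (y * (2 * N + m)) ^ D * (2 * N)  ≤⟨ *-monoˡ-≤ (2 * N) (^-monoˡ-≤ D y/z) ⟩
    (2 * N * z) ^ D * (2 * N)  ≡⟨ cong (_* (2 * N)) (*-^ (2 * N) z D) ⟩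
    (2 * N) ^ D * Z * (2 * N)  ≡⟨ *-assoc ((2 * N) ^ D) Z (2 * N) ⟩
    (2 * N) ^ D * (Z * (2 * N))  ∎)
    where
    id₆ : ∀ a b c → a * (b * c) ≡ b * (a * c)
    id₆ = solve-∀
  -- This amounts to `1/Q ≤ p · (Dp/2) / (1 + Dp/2) = D m² / (N s)`, and `s ≤ 4N` because `Dp ≤ 1`.
  main : Q * (b * s + m * (2 * N)) ≤ N * q * s
  main = +-cancelʳ-≤ (D * (m * m) * Q) _ _ (begin
    Q * (b * s + m * (2 * N)) + D * (m * m) * Q  ≡⟨ id₇ b m D q ⟩
    N * q * s + N * s  ≤⟨ +-monoʳ-≤ (N * q * s) (≤-trans Ns≤ large) ⟩
    N * q * s + D * (m * m) * Q  ∎)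
    where
    id₇ : ∀ b m D q → suc q * (b * (2 * (b + m) + D * m) + m * (2 * (b + m))) + D * (m * m) * suc q
        ≡ (b + m) * q * (2 * (b + m) + D * m) + (b + m) * (2 * (b + m) + D * m)
    id₇ = solve-∀
    id₈ : ∀ N → N * (2 * N + N) + N * N ≡ 4 * (N * N)
    id₈ = solve-∀
    Ns≤ : N * s ≤ 4 * (N * N)
    Ns≤ = begin
      N * s  ≤⟨ *-monoʳ-≤ N (+-monoʳ-≤ (2 * N) Dm≤N) ⟩
      N * (2 * N + N)  ≤⟨ m≤m+n _ (N * N) ⟩
      N * (2 * N + N) + N * N  ≡⟨ id₈ N ⟩
      4 * (N * N)  ∎

-- Finite sums, products and masses

𝟙 : Bool → ℕ
𝟙 true  = 1
𝟙 false = 0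

true≢false : ∀ {b} → b ≡ true → b ≢ false
true≢false refl ()

dichotomy : ∀ b → b ≡ true ⊎ b ≡ false
dichotomy true  = inj₁ refl
dichotomy false = inj₂ refl

∧-split : ∀ {a b} → a ∧ b ≡ true → a ≡ true × b ≡ true
∧-split {true} {true} _ = refl , refl

∧-join : ∀ {a b} → a ≡ true → b ≡ true → a ∧ b ≡ true
∧-join refl refl = refl

𝟙≤1 : ∀ b → 𝟙 b ≤ 1
𝟙≤1 true  = ≤-refl
𝟙≤1 false = z≤n

𝟙-true : ∀ {b} → b ≡ true → 𝟙 b ≡ 1
𝟙-true refl = refl

𝟙-pos : ∀ {b} → 1 ≤ 𝟙 b → b ≡ true
𝟙-pos {true} _ = refl

𝟙-≤ : ∀ {b k} → (b ≡ true → 1 ≤ k) → 𝟙 b ≤ k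
𝟙-≤ {true}  h = h refl
𝟙-≤ {false} h = z≤n

𝟙-mono : ∀ {b c} → (b ≡ true → c ≡ true) → 𝟙 b ≤ 𝟙 c
𝟙-mono h = 𝟙-≤ (λ p → ≤-reflexive (sym (𝟙-true (h p))))

𝟙-∧ : ∀ b c → 𝟙 (b ∧ c) ≡ 𝟙 b * 𝟙 c
𝟙-∧ true  c = sym (+-identityʳ (𝟙 c))
𝟙-∧ false c = refl

does-true : ∀ {P : Set} (d : Dec P) → P → does d ≡ true
does-true (yes _) _ = refl
does-true (no ¬p) p = ⊥-elim (¬p p)

does-sound : ∀ {P : Set} (d : Dec P) → does d ≡ true → P
does-sound (yes p) _ = p

𝟙*-≤ : ∀ {P : Set} (d : Dec P) {u v} → (P → u ≤ v) → 𝟙 (does d) * u ≤ v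
𝟙*-≤ (yes p) {u} h = ≤-trans (≤-reflexive (+-identityʳ u)) (h p)
𝟙*-≤ (no _)  h = z≤n

sum-mono : ∀ {n} {f g : Fin n → ℕ} → (∀ i → f i ≤ g i) → sum f ≤ sum g
sum-mono {zero}  h = z≤n
sum-mono {suc n} h = +-mono-≤ (h zero) (sum-mono (h ∘ suc))

sum-const : ∀ n c → sum {n} (λ _ → c) ≡ n * c
sum-const zero    c = refl
sum-const (suc n) c = cong (c +_) (sum-const n c)

term≤sum : ∀ {n} (f : Fin n → ℕ) i → f i ≤ sum f
term≤sum f zero    = m≤m+n _ _
term≤sum f (suc i) = ≤-trans (term≤sum (f ∘ suc) i) (m≤n+m _ _)

sum-pos : ∀ {n} (f : Fin n → ℕ) → 1 ≤ sum f → ∃ λ i → 1 ≤ f i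
sum-pos {suc n} f h with f zero in eq
... | suc _ = zero , subst (1 ≤_) (sym eq) (s≤s z≤n)
... | zero with sum-pos (f ∘ suc) h
...   | i , p = suc i , p

pigeonhole : ∀ {n} (f : Fin n → ℕ) k → 1 ≤ n → n * k ≤ sum f → ∃ λ i → k ≤ f i
pigeonhole {suc n} f k _ h with k ≤? f zero
... | yes p = zero , p
... | no ¬p with n
...   | zero  = ⊥-elim (¬p (subst₂ _≤_ (+-identityʳ k) (+-identityʳ (f zero)) h))
...   | suc l with pigeonhole (f ∘ suc) k (s≤s z≤n)
                   (+-cancelˡ-≤ k _ _ (≤-trans h (+-monoˡ-≤ _ (<⇒≤ (≰⇒> ¬p)))))
...     | i , q = suc i , q

sum≡0 : ∀ {n} {f : Fin n → ℕ} → (∀ i → f i ≡ 0) → sum f ≡ 0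
sum≡0 {n} h = trans (sum-cong-≗ h) (trans (sum-const n 0) (*-zeroʳ n))

sum-unique : ∀ {n} (p : Fin n → Bool) → (∀ i j → p i ≡ true → p j ≡ true → i ≡ j) → sum (𝟙 ∘ p) ≤ 1
sum-unique {zero}  p u = z≤n
sum-unique {suc n} p u with p zero in eq
... | false = sum-unique (p ∘ suc) (λ i j pi pj → suc-inj (u _ _ pi pj))
  where
  suc-inj : ∀ {i j : Fin n} → Fin.suc i ≡ suc j → i ≡ j
  suc-inj refl = refl
... | true = ≤-reflexive (cong suc (sum≡0 (λ i → [ (λ p → ⊥-elim (0≢suc (u _ _ eq p))) , cong 𝟙 ]′ (dichotomy (p (suc i))))))
  where
  0≢suc : ∀ {i : Fin n} → Fin.zero ≢ suc i
  0≢suc ()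

VSet : ℕ → Set
VSet n = Fin n → Bool

card : ∀ {n} → VSet n → ℕ
card A = sum (𝟙 ∘ A)

card-mono : ∀ {n} (A B : VSet n) → (∀ x → A x ≡ true → B x ≡ true) → card A ≤ card B
card-mono A B h = sum-mono (λ x → 𝟙-mono (h x))

card-cong : ∀ {n} {A B : VSet n} → (∀ x → A x ≡ B x) → card A ≡ card B
card-cong h = sum-cong-≗ (λ x → cong 𝟙 (h x))

card-split : ∀ {n} (A B : VSet n) → card A ≡ card (λ x → A x ∧ B x) + card (λ x → A x ∧ not (B x))
card-split A B = trans (sum-cong-≗ (λ x → split (A x) (B x))) (∑-distrib-+ (λ x → 𝟙 (A x ∧ B x)) (λ x → 𝟙 (A x ∧ not (B x))))
  where
  split : ∀ a b → 𝟙 a ≡ 𝟙 (a ∧ b) + 𝟙 (a ∧ not b)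
  split true  true  = refl
  split true  false = refl
  split false _     = refl

_≟ᵇ_ : ∀ {n} → Fin n → Fin n → Bool
x ≟ᵇ y = does (x Fin.≟ y)

≟ᵇ-refl : ∀ {n} (x : Fin n) → (x ≟ᵇ x) ≡ true
≟ᵇ-refl x = does-true (x Fin.≟ x) refl

≟ᵇ-sound : ∀ {n} {x y : Fin n} → (x ≟ᵇ y) ≡ true → x ≡ y
≟ᵇ-sound {x = x} {y} = does-sound (x Fin.≟ y)

card-singleton : ∀ {n} (v : Fin n) → card (λ x → x ≟ᵇ v) ≡ 1
card-singleton v = ≤-antisym
  (sum-unique (λ x → x ≟ᵇ v) (λ i j p q → trans (≟ᵇ-sound p) (sym (≟ᵇ-sound q))))
  (≤-trans (≤-reflexive (sym (𝟙-true (≟ᵇ-refl v)))) (term≤sum (λ x → 𝟙 (x ≟ᵇ v)) v))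

infixl 6 _⊖_ _⊕_ _∖_

_⊖_ _⊕_ : ∀ {n} → VSet n → Fin n → VSet n
(A ⊖ v) x = A x ∧ not (x ≟ᵇ v)
(T ⊕ v) x = T x ∨ (x ≟ᵇ v)

_∖_ : ∀ {n} → VSet n → VSet n → VSet n
(A ∖ M) x = A x ∧ not (M x)

card-∖ : ∀ {n} (A M : VSet n) → (∀ x → M x ≡ true → A x ≡ true) → card A ≡ card M + card (A ∖ M)
card-∖ A M M⊆A = trans (card-split A M) (cong (_+ card (A ∖ M)) (card-cong eq))
  where
  eq : ∀ x → A x ∧ M x ≡ M x
  eq x with M x in p
  ... | true  = ∧-join (M⊆A x p) refl
  ... | false with A x
  ...   | true  = refl
  ...   | false = refl

card-⊖ : ∀ {n} (A : VSet n) v → A v ≡ true → card A ≡ suc (card (A ⊖ v))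
card-⊖ A v v∈A = trans (card-∖ A (_≟ᵇ v) (λ x p → subst (λ t → A t ≡ true) (sym (≟ᵇ-sound p)) v∈A))
                       (cong (_+ card (A ⊖ v)) (card-singleton v))

card-⊕ : ∀ {n} (T : VSet n) v → T v ≡ false → card (T ⊕ v) ≡ suc (card T)
card-⊕ T v v∉T = trans (card-⊖ (T ⊕ v) v vT) (cong suc (card-cong back))
  where
  vT : (T ⊕ v) v ≡ true
  vT rewrite v∉T = ≟ᵇ-refl v
  back : ∀ x → (T ⊕ v ⊖ v) x ≡ T x
  back x with x Fin.≟ v
  ... | yes refl = trans (∧-zeroʳ (T v ∨ true)) (sym v∉T)
  ... | no _     = trans (∧-identityʳ (T x ∨ false)) (∨-identityʳ (T x))

∏ : ∀ {n} → (Fin n → ℕ) → ℕ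
∏ {zero}  f = 1
∏ {suc n} f = f zero * ∏ (f ∘ suc)

∏-mono : ∀ {n} {f g : Fin n → ℕ} → (∀ i → f i ≤ g i) → ∏ f ≤ ∏ g
∏-mono {zero}  h = ≤-refl
∏-mono {suc n} h = *-mono-≤ (h zero) (∏-mono (h ∘ suc))

∏-* : ∀ {n} (f g : Fin n → ℕ) → ∏ (λ i → f i * g i) ≡ ∏ f * ∏ g
∏-* {zero}  f g = refl
∏-* {suc n} f g = trans (cong (f zero * g zero *_) (∏-* (f ∘ suc) (g ∘ suc)))
                        (id₁ (f zero) (g zero) (∏ (f ∘ suc)) (∏ (g ∘ suc)))
  where
  id₁ : ∀ a b c d → a * b * (c * d) ≡ a * c * (b * d)
  id₁ = solve-∀

∏-^ : ∀ {n} u (f : Fin n → ℕ) → ∏ (λ i → u ^ f i) ≡ u ^ sum f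
∏-^ {zero}  u f = refl
∏-^ {suc n} u f = trans (cong (u ^ f zero *_) (∏-^ u (f ∘ suc))) (sym (^-distribˡ-+-* u (f zero) (sum (f ∘ suc))))

∏-const : ∀ n c → ∏ {n} (λ _ → c) ≡ c ^ n
∏-const zero    c = refl
∏-const (suc n) c = cong (c *_) (∏-const n c)

∑ˢ : ∀ {n} → (Subset n → ℕ) → ℕ
∑ˢ {zero}  f = f []
∑ˢ {suc n} f = ∑ˢ (λ S → f (outside ∷ S)) + ∑ˢ (λ S → f (inside ∷ S))

∑ˢ-mono : ∀ {n} {f g : Subset n → ℕ} → (∀ S → f S ≤ g S) → ∑ˢ f ≤ ∑ˢ g
∑ˢ-mono {zero}  h = h []
∑ˢ-mono {suc n} h = +-mono-≤ (∑ˢ-mono (λ S → h (outside ∷ S))) (∑ˢ-mono (λ S → h (inside ∷ S)))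

∑ˢ-cong : ∀ {n} {f g : Subset n → ℕ} → (∀ S → f S ≡ g S) → ∑ˢ f ≡ ∑ˢ g
∑ˢ-cong h = ≤-antisym (∑ˢ-mono (λ S → ≤-reflexive (h S))) (∑ˢ-mono (λ S → ≤-reflexive (sym (h S))))

∑ˢ-+ : ∀ {n} (f g : Subset n → ℕ) → ∑ˢ (λ S → f S + g S) ≡ ∑ˢ f + ∑ˢ g
∑ˢ-+ {zero}  f g = refl
∑ˢ-+ {suc n} f g = trans (cong₂ _+_ (∑ˢ-+ (f ∘ (outside ∷_)) (g ∘ (outside ∷_))) (∑ˢ-+ (f ∘ (inside ∷_)) (g ∘ (inside ∷_))))
  (id₁ (∑ˢ (f ∘ (outside ∷_))) (∑ˢ (g ∘ (outside ∷_))) (∑ˢ (f ∘ (inside ∷_))) (∑ˢ (g ∘ (inside ∷_))))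
  where
  id₁ : ∀ a b c d → (a + b) + (c + d) ≡ (a + c) + (b + d)
  id₁ = solve-∀

∑ˢ-*ʳ : ∀ {n} (f : Subset n → ℕ) c → ∑ˢ f * c ≡ ∑ˢ (λ S → f S * c)
∑ˢ-*ʳ {zero}  f c = refl
∑ˢ-*ʳ {suc n} f c = trans (*-distribʳ-+ c (∑ˢ (f ∘ (outside ∷_))) _)
  (cong₂ _+_ (∑ˢ-*ʳ (f ∘ (outside ∷_)) c) (∑ˢ-*ʳ (f ∘ (inside ∷_)) c))

∑ˢ-*ˡ : ∀ {n} c (f : Subset n → ℕ) → c * ∑ˢ f ≡ ∑ˢ (λ S → c * f S)
∑ˢ-*ˡ c f = trans (*-comm c (∑ˢ f)) (trans (∑ˢ-*ʳ f c) (∑ˢ-cong (λ S → *-comm (f S) c)))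

∑ˢ-zero : ∀ {n} → ∑ˢ {n} (λ _ → 0) ≡ 0
∑ˢ-zero {zero}  = refl
∑ˢ-zero {suc n} = cong₂ _+_ (∑ˢ-zero {n}) (∑ˢ-zero {n})

∑ˢ-sum : ∀ {n k} (f : Subset n → Fin k → ℕ) → ∑ˢ (λ S → sum (f S)) ≡ sum (λ i → ∑ˢ (λ S → f S i))
∑ˢ-sum {n} {zero}  f = ∑ˢ-zero {n}
∑ˢ-sum {n} {suc k} f = trans (∑ˢ-+ (λ S → f S zero) (λ S → sum (f S ∘ suc)))
  (cong (∑ˢ (λ S → f S zero) +_) (∑ˢ-sum (λ S → f S ∘ suc)))

∑ˢ-comm : ∀ {n k} (f : Subset n → Subset k → ℕ) → ∑ˢ (λ S → ∑ˢ (f S)) ≡ ∑ˢ (λ R → ∑ˢ (λ S → f S R))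
∑ˢ-comm {k = zero}  f = refl
∑ˢ-comm {k = suc k} f = trans (∑ˢ-+ (λ S → ∑ˢ (f S ∘ (outside ∷_))) (λ S → ∑ˢ (f S ∘ (inside ∷_))))
  (cong₂ _+_ (∑ˢ-comm (λ S → f S ∘ (outside ∷_))) (∑ˢ-comm (λ S → f S ∘ (inside ∷_))))

term≤∑ˢ : ∀ {n} (f : Subset n → ℕ) S → f S ≤ ∑ˢ f
term≤∑ˢ f []            = ≤-refl
term≤∑ˢ f (outside ∷ S) = ≤-trans (term≤∑ˢ (f ∘ (outside ∷_)) S) (m≤m+n _ _)
term≤∑ˢ f (inside ∷ S)  = ≤-trans (term≤∑ˢ (f ∘ (inside ∷_)) S) (m≤n+m _ _)

-- Distributivity: expanding the product chooses in or out at every vertex. All partition functions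
-- below are evaluated this way.
∑ˢ-∏ : ∀ {n} (F : Fin n → Bool → ℕ) → ∑ˢ (λ I → ∏ (λ x → F x (lookup I x))) ≡ ∏ (λ x → F x false + F x true)
∑ˢ-∏ {zero}  F = refl
∑ˢ-∏ {suc n} F = trans (cong₂ _+_ (factor false) (factor true)) (sym (*-distribʳ-+ _ (F zero false) (F zero true)))
  where
  factor : ∀ c → ∑ˢ (λ I → F zero c * ∏ (λ x → F (suc x) (lookup I x))) ≡ F zero c * ∏ (λ x → F (suc x) false + F (suc x) true)
  factor c = trans (sym (∑ˢ-*ˡ (F zero c) (λ I → ∏ (λ x → F (suc x) (lookup I x)))))
                   (cong (F zero c *_) (∑ˢ-∏ (λ x → F (suc x))))

module Mass {n : ℕ} (w : Subset n → ℕ) where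

  mass : {P : Subset n → Set} → (∀ I → Dec (P I)) → ℕ
  mass P? = ∑ˢ (λ I → 𝟙 (does (P? I)) * w I)

  mass-mono : ∀ {P Q : Subset n → Set} (P? : ∀ I → Dec (P I)) (Q? : ∀ I → Dec (Q I)) →
    (∀ I → P I → Q I) → mass P? ≤ mass Q?
  mass-mono P? Q? h = ∑ˢ-mono (λ I → *-monoˡ-≤ (w I) (𝟙-mono (λ p → does-true (Q? I) (h I (does-sound (P? I) p)))))

  mass-split : ∀ {P Q R : Subset n → Set} (P? : ∀ I → Dec (P I)) (Q? : ∀ I → Dec (Q I)) (R? : ∀ I → Dec (R I)) →
    (∀ I → P I → Q I ⊎ R I) → mass P? ≤ mass Q? + mass R?
  mass-split P? Q? R? h = ≤-trans
    (∑ˢ-mono (λ I → ≤-trans (*-monoˡ-≤ (w I) (𝟙-≤ (λ p → [ inQ I , inR I ]′ (h I (does-sound (P? I) p)))))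
                            (≤-reflexive (*-distribʳ-+ (w I) (𝟙 (does (Q? I))) _))))
    (≤-reflexive (∑ˢ-+ (λ I → 𝟙 (does (Q? I)) * w I) (λ I → 𝟙 (does (R? I)) * w I)))
    where
    inQ : ∀ I → _ → 1 ≤ 𝟙 (does (Q? I)) + 𝟙 (does (R? I))
    inQ I q = ≤-trans (≤-reflexive (sym (𝟙-true (does-true (Q? I) q)))) (m≤m+n _ _)
    inR : ∀ I → _ → 1 ≤ 𝟙 (does (Q? I)) + 𝟙 (does (R? I))
    inR I r = ≤-trans (≤-reflexive (sym (𝟙-true (does-true (R? I) r)))) (m≤n+m _ _)

  mass-union : ∀ {k} {P : Subset n → Set} {Q : Subset k → Subset n → Set}
    (P? : ∀ I → Dec (P I)) (Q? : ∀ S I → Dec (Q S I)) →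
    (∀ I → P I → ∃ λ S → Q S I) → mass P? ≤ ∑ˢ (λ S → mass (Q? S))
  mass-union P? Q? h = ≤-trans (∑ˢ-mono pointwise) (≤-reflexive (∑ˢ-comm (λ I S → 𝟙 (does (Q? S I)) * w I)))
    where
    pointwise : ∀ I → 𝟙 (does (P? I)) * w I ≤ ∑ˢ (λ S → 𝟙 (does (Q? S I)) * w I)
    pointwise I = 𝟙*-≤ (P? I) λ p → let S , q = h I p in begin
      w I  ≡⟨ +-identityʳ (w I) ⟨
      1 * w I  ≡⟨ cong (_* w I) (𝟙-true (does-true (Q? S I) q)) ⟨
      𝟙 (does (Q? S I)) * w I  ≤⟨ term≤∑ˢ (λ S → 𝟙 (does (Q? S I)) * w I) S ⟩
      ∑ˢ (λ S → 𝟙 (does (Q? S I)) * w I) ∎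

-- Decision trees over vertex sets

-- The union bound behind one node of the decision tree; the D vertices lost on the
-- branch that picks v pay for the factor a.
node-bound : ∀ {Z Z₁ Z₂ a b′ B τ W} y z D k k₂ → 1 ≤ b′ → y ≤ z →
  b′ * y * z ^ D + a * y ^ suc D ≤ b′ * z ^ suc D → k₂ + D ≤ k →
  Z ≤ Z₁ + Z₂ → Z₁ * B * y ^ k ≤ τ * z ^ k * W → Z₂ * (b′ * B) * y ^ k₂ ≤ a * τ * z ^ k₂ * W →
  Z * B * y ^ suc k ≤ τ * z ^ suc k * W
node-bound {Z} {Z₁} {Z₂} {a} {b′} {B} {τ} {W} y z D k k₂ b′≥1 y≤z cond k₂+D≤k Z≤ h₁ h₂ with ≤⇒+ k₂+D≤k
... | e , refl = cancelˡ b′≥1 (begin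
  b′ * (Z * B * (y * y ^ k))  ≤⟨ *-monoʳ-≤ b′ (*-monoˡ-≤ (y * y ^ k) (*-monoˡ-≤ B Z≤)) ⟩
  b′ * ((Z₁ + Z₂) * B * (y * y ^ k))  ≡⟨ id₁ b′ Z₁ Z₂ B y (y ^ k) ⟩
  b′ * y * (Z₁ * B * y ^ k) + y * (Z₂ * (b′ * B) * y ^ k)  ≤⟨ +-mono-≤ (*-monoʳ-≤ (b′ * y) h₁) (*-monoʳ-≤ y second) ⟩
  b′ * y * (τ * z ^ k * W) + y * (a * τ * (z ^ k₂ * z ^ e) * W * y ^ D)
    ≡⟨ cong (λ t → b′ * y * (τ * t * W) + y * (a * τ * (z ^ k₂ * z ^ e) * W * y ^ D)) (split z) ⟩
  b′ * y * (τ * (z ^ k₂ * z ^ D * z ^ e) * W) + y * (a * τ * (z ^ k₂ * z ^ e) * W * y ^ D)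
    ≡⟨ id₂ b′ y τ (z ^ k₂) (z ^ D) (z ^ e) W a (y ^ D) ⟩
  τ * W * (z ^ k₂ * z ^ e) * (b′ * y * z ^ D + a * y ^ suc D)  ≤⟨ *-monoʳ-≤ (τ * W * (z ^ k₂ * z ^ e)) cond ⟩
  τ * W * (z ^ k₂ * z ^ e) * (b′ * z ^ suc D)  ≡⟨ id₃ τ W (z ^ k₂) (z ^ e) b′ z (z ^ D) ⟩
  b′ * (τ * (z * (z ^ k₂ * z ^ D * z ^ e)) * W)  ≡⟨ cong (λ t → b′ * (τ * (z * t) * W)) (split z) ⟨
  b′ * (τ * (z * z ^ k) * W)  ∎)
  where
  split : ∀ x → x ^ (k₂ + D + e) ≡ x ^ k₂ * x ^ D * x ^ e
  split x = trans (^-distribˡ-+-* x (k₂ + D) e) (cong (_* x ^ e) (^-distribˡ-+-* x k₂ D))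
  id₁ : ∀ b′ Z₁ Z₂ B y Y → b′ * ((Z₁ + Z₂) * B * (y * Y)) ≡ b′ * y * (Z₁ * B * Y) + y * (Z₂ * (b′ * B) * Y)
  id₁ = solve-∀
  id₂ : ∀ b′ y τ z₂ zD ze W a yD → b′ * y * (τ * (z₂ * zD * ze) * W) + y * (a * τ * (z₂ * ze) * W * yD)
      ≡ τ * W * (z₂ * ze) * (b′ * y * zD + a * (y * yD))
  id₂ = solve-∀
  id₃ : ∀ τ W z₂ ze b′ z zD → τ * W * (z₂ * ze) * (b′ * (z * zD)) ≡ b′ * (τ * (z * (z₂ * zD * ze)) * W)
  id₃ = solve-∀
  -- Exactly `D` of the lost vertices are credited through `y ^ D`; for the surplus `e` only `y ≤ z`
  -- is used.
  second : Z₂ * (b′ * B) * y ^ (k₂ + D + e) ≤ a * τ * (z ^ k₂ * z ^ e) * W * y ^ D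
  second = begin
    Z₂ * (b′ * B) * y ^ (k₂ + D + e)  ≡⟨ cong (Z₂ * (b′ * B) *_) (split y) ⟩
    Z₂ * (b′ * B) * (y ^ k₂ * y ^ D * y ^ e)  ≡⟨ id₄ (Z₂ * (b′ * B)) (y ^ k₂) (y ^ D) (y ^ e) ⟩
    Z₂ * (b′ * B) * y ^ k₂ * (y ^ e * y ^ D)  ≤⟨ *-mono-≤ h₂ (*-monoˡ-≤ (y ^ D) (^-monoˡ-≤ e y≤z)) ⟩
    a * τ * z ^ k₂ * W * (z ^ e * y ^ D)  ≡⟨ id₅ (a * τ) (z ^ k₂) W (z ^ e) (y ^ D) ⟩
    a * τ * (z ^ k₂ * z ^ e) * W * y ^ D  ∎
    where
    id₄ : ∀ p q r s → p * (q * r * s) ≡ p * q * (s * r)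
    id₄ = solve-∀
    id₅ : ∀ p q r s t → p * q * r * (s * t) ≡ p * (q * s) * r * t
    id₅ = solve-∀

Disjoint : ∀ {n} → VSet n → VSet n → Set
Disjoint A T = ∀ x → A x ≡ true → T x ≡ false

module Weighted {n : ℕ} (a b : ℕ) where

  vertexWeight : Bool → ℕ
  vertexWeight i = if i then a else b

  weight : Subset n → ℕ
  weight I = ∏ (λ x → vertexWeight (lookup I x))

  open Mass weight public

  -- The factor `b ^ |I|` on the left spares the truncated exponent `n ∸ |I|`.
  weight-card : ∀ I → weight I * b ^ card (lookup I) ≡ a ^ card (lookup I) * b ^ n
  weight-card I = begin-equality
    weight I * b ^ card (lookup I)  ≡⟨ cong (weight I *_) (∏-^ b (𝟙 ∘ lookup I)) ⟨
    weight I * ∏ (λ x → b ^ 𝟙 (lookup I x))  ≡⟨ ∏-* (vertexWeight ∘ lookup I) (λ x → b ^ 𝟙 (lookup I x)) ⟨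
    ∏ (λ x → vertexWeight (lookup I x) * b ^ 𝟙 (lookup I x))  ≡⟨ ≤-antisym (∏-mono (≤-reflexive ∘ pt ∘ lookup I)) (∏-mono (≤-reflexive ∘ sym ∘ pt ∘ lookup I)) ⟩
    ∏ (λ x → a ^ 𝟙 (lookup I x) * b)  ≡⟨ ∏-* (λ x → a ^ 𝟙 (lookup I x)) (λ _ → b) ⟩
    ∏ (λ x → a ^ 𝟙 (lookup I x)) * ∏ {n} (λ _ → b)  ≡⟨ cong₂ _*_ (∏-^ a (𝟙 ∘ lookup I)) (∏-const n b) ⟩
    a ^ card (lookup I) * b ^ n  ∎
    where
    pt : ∀ i → vertexWeight i * b ^ 𝟙 i ≡ a ^ 𝟙 i * b
    pt true  = id₁ a b
      where
      id₁ : ∀ a b → a * (b * 1) ≡ a * 1 * b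
      id₁ = solve-∀
    pt false = *-comm b 1

  module Tree (P : Subset n → Set) (P? : ∀ I → Dec (P I)) where

    -- T holds the vertices already picked, A those still available.
    InState : VSet n → VSet n → Subset n → Set
    InState A T I = P I × (∀ x → T x ≡ true → lookup I x ≡ true) × (∀ x → lookup I x ≡ true → T x ∨ A x ≡ true)

    inState? : ∀ A T I → Dec (InState A T I)
    inState? A T I = P? I ×-dec all? (λ x → (T x Bool.≟ true) →-dec (lookup I x Bool.≟ true))
                          ×-dec all? (λ x → (lookup I x Bool.≟ true) →-dec (T x ∨ A x Bool.≟ true))

    Z : VSet n → VSet n → ℕ
    Z A T = mass (inState? A T)

    Z-split : ∀ A T v → Z A T ≤ Z (A ⊖ v) T + Z (A ⊖ v) (T ⊕ v)
    Z-split A T v = mass-split (inState? A T) (inState? (A ⊖ v) T) (inState? (A ⊖ v) (T ⊕ v)) cases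
      where
      cases : ∀ I → InState A T I → InState (A ⊖ v) T I ⊎ InState (A ⊖ v) (T ⊕ v) I
      cases I (p , T⊆I , I⊆) with dichotomy (lookup I v)
      ... | inj₂ v∉I = inj₁ (p , T⊆I , λ x x∈I → keep x x∈I (I⊆ x x∈I))
        where
        keep : ∀ x → lookup I x ≡ true → T x ∨ A x ≡ true → T x ∨ (A x ∧ not (x ≟ᵇ v)) ≡ true
        keep x x∈I h with x Fin.≟ v
        ... | yes refl = ⊥-elim (true≢false x∈I v∉I)
        ... | no _     = trans (cong (T x ∨_) (∧-identityʳ (A x))) h
      ... | inj₁ v∈I = inj₂ (p , T+⊆ , λ x x∈I → move x (I⊆ x x∈I))
        where
        T+⊆ : ∀ x → (T ⊕ v) x ≡ true → lookup I x ≡ true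
        T+⊆ x h with T x in eq
        ... | true  = T⊆I x eq
        ... | false = subst (λ t → lookup I t ≡ true) (sym (≟ᵇ-sound h)) v∈I
        move : ∀ x → T x ∨ A x ≡ true → (T ⊕ v) x ∨ (A ⊖ v) x ≡ true
        move x h with x Fin.≟ v
        ... | yes _ = cong (_∨ (A x ∧ false)) (∨-zeroʳ (T x))
        ... | no _  = trans (cong₂ _∨_ (∨-identityʳ (T x)) (∧-identityʳ (A x))) h

    Z-prune : ∀ A T M → (∀ I → InState A T I → ∀ x → M x ≡ true → lookup I x ≡ false) → Z A T ≤ Z (A ∖ M) T
    Z-prune A T M avoid = mass-mono (inState? A T) (inState? (A ∖ M) T) λ { I st@(p , T⊆I , I⊆) →
      p , T⊆I , λ x x∈I → keep x (¬-not (λ m → true≢false x∈I (avoid I st x m))) (I⊆ x x∈I) }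
      where
      keep : ∀ x → M x ≡ false → T x ∨ A x ≡ true → T x ∨ (A x ∧ not (M x)) ≡ true
      keep x m h rewrite m = trans (cong (T x ∨_) (∧-identityʳ (A x))) h

    -- Exponential Markov inequality: `x ^ j ≤ x ^ |I ∩ A ∩ M|` on the sets counted, and after this
    -- tilt the sum over `I` factorises over vertices. The powers of `b` on the left normalise the
    -- vertices of `T`, `A ∖ M` and `A ∩ M`; every other vertex contributes `b` and is covered by
    -- `b ^ n`.
    Z-tilted : ∀ A T M x j → 1 ≤ x → Disjoint A T →
      (∀ I → InState A T I → j ≤ card (λ v → lookup I v ∧ (A v ∧ M v))) →
      Z A T * x ^ j * (b ^ card T * (b ^ card (A ∖ M) * b ^ card (λ v → A v ∧ M v)))
        ≤ a ^ card T * (a + b) ^ card (A ∖ M) * (a * x + b) ^ card (λ v → A v ∧ M v) * b ^ n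
    Z-tilted A T M x j x≥1 disj many = begin
      Z A T * x ^ j * (b ^ card T * (b ^ card (A ∖ M) * b ^ card AM))
        ≡⟨ cong (_* (b ^ card T * (b ^ card (A ∖ M) * b ^ card AM))) (∑ˢ-*ʳ (λ I → 𝟙 (does (inState? A T I)) * weight I) (x ^ j)) ⟩
      ∑ˢ (λ I → 𝟙 (does (inState? A T I)) * weight I * x ^ j) * (b ^ card T * (b ^ card (A ∖ M) * b ^ card AM))
        ≤⟨ *-monoˡ-≤ _ (∑ˢ-mono pointwise) ⟩
      ∑ˢ (λ I → ∏ (λ v → F v (lookup I v))) * (b ^ card T * (b ^ card (A ∖ M) * b ^ card AM))
        ≡⟨ cong₂ _*_ (∑ˢ-∏ F) (sym (cong₂ _*_ (∏-^ b (𝟙 ∘ T)) (cong₂ _*_ (∏-^ b (𝟙 ∘ (A ∖ M))) (∏-^ b (𝟙 ∘ AM))))) ⟩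
      ∏ (λ v → F v false + F v true) * (∏ (λ v → b ^ 𝟙 (T v)) * (∏ (λ v → b ^ 𝟙 ((A ∖ M) v)) * ∏ (λ v → b ^ 𝟙 (AM v))))
        ≡⟨ cong (∏ (λ v → F v false + F v true) *_) (trans (∏-* (λ v → b ^ 𝟙 (T v)) _) (cong (∏ (λ v → b ^ 𝟙 (T v)) *_) (∏-* (λ v → b ^ 𝟙 ((A ∖ M) v)) _))) ⟨
      ∏ (λ v → F v false + F v true) * ∏ (λ v → b ^ 𝟙 (T v) * (b ^ 𝟙 ((A ∖ M) v) * b ^ 𝟙 (AM v)))
        ≡⟨ ∏-* (λ v → F v false + F v true) _ ⟨
      ∏ (λ v → (F v false + F v true) * (b ^ 𝟙 (T v) * (b ^ 𝟙 ((A ∖ M) v) * b ^ 𝟙 (AM v))))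
        ≤⟨ ∏-mono (λ v → factor (A v) (T v) (M v) (disj v)) ⟩
      ∏ (λ v → a ^ 𝟙 (T v) * (a + b) ^ 𝟙 ((A ∖ M) v) * (a * x + b) ^ 𝟙 (AM v) * b)
        ≡⟨ trans (∏-* (λ v → a ^ 𝟙 (T v) * (a + b) ^ 𝟙 ((A ∖ M) v) * (a * x + b) ^ 𝟙 (AM v)) (λ _ → b)) (cong₂ _*_ (trans (∏-* (λ v → a ^ 𝟙 (T v) * (a + b) ^ 𝟙 ((A ∖ M) v)) (λ v → (a * x + b) ^ 𝟙 (AM v))) (cong (_* ∏ (λ v → (a * x + b) ^ 𝟙 (AM v))) (∏-* (λ v → a ^ 𝟙 (T v)) (λ v → (a + b) ^ 𝟙 ((A ∖ M) v))))) (∏-const n b)) ⟩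
      ∏ (λ v → a ^ 𝟙 (T v)) * ∏ (λ v → (a + b) ^ 𝟙 ((A ∖ M) v)) * ∏ (λ v → (a * x + b) ^ 𝟙 (AM v)) * b ^ n
        ≡⟨ cong (_* b ^ n) (cong₂ _*_ (cong₂ _*_ (∏-^ a (𝟙 ∘ T)) (∏-^ (a + b) (𝟙 ∘ (A ∖ M)))) (∏-^ (a * x + b) (𝟙 ∘ AM))) ⟩
      a ^ card T * (a + b) ^ card (A ∖ M) * (a * x + b) ^ card AM * b ^ n ∎
      where
      AM : VSet n
      AM v = A v ∧ M v
      -- The zeros encode `T ⊆ I ⊆ T ∪ A`, so the constraint becomes part of the product.
      F : Fin n → Bool → ℕ
      F v true  = if T v ∨ A v then a * x ^ 𝟙 (AM v) else 0
      F v false = if T v then 0 else b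
      factor-≤ : ∀ v i → (T v ≡ true → i ≡ true) → (i ≡ true → T v ∨ A v ≡ true) →
        vertexWeight i * x ^ 𝟙 (i ∧ AM v) ≤ F v i
      factor-≤ v true  _ h rewrite h refl = ≤-refl
      factor-≤ v false h _ with T v
      ... | true with h refl
      ...   | ()
      factor-≤ v false h _ | false = ≤-reflexive (*-identityʳ b)
      pointwise : ∀ I → 𝟙 (does (inState? A T I)) * weight I * x ^ j ≤ ∏ (λ v → F v (lookup I v))
      pointwise I = ≤-trans (≤-reflexive (*-assoc (𝟙 (does (inState? A T I))) (weight I) (x ^ j)))
        (𝟙*-≤ (inState? A T I) λ { st@(_ , T⊆I , I⊆) → begin
        weight I * x ^ j  ≤⟨ *-monoʳ-≤ (weight I) (^-mono-exp x≥1 (many I st)) ⟩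
        weight I * x ^ card (λ v → lookup I v ∧ AM v)  ≡⟨ cong (weight I *_) (∏-^ x (λ v → 𝟙 (lookup I v ∧ AM v))) ⟨
        weight I * ∏ (λ v → x ^ 𝟙 (lookup I v ∧ AM v))  ≡⟨ ∏-* (λ v → vertexWeight (lookup I v)) _ ⟨
        ∏ (λ v → vertexWeight (lookup I v) * x ^ 𝟙 (lookup I v ∧ AM v))  ≤⟨ ∏-mono (λ v → factor-≤ v (lookup I v) (T⊆I v) (I⊆ v)) ⟩
        ∏ (λ v → F v (lookup I v))  ∎ })
      factor : ∀ Av Tv Mv → (Av ≡ true → Tv ≡ false) →
        ((if Tv then 0 else b) + (if Tv ∨ Av then a * x ^ 𝟙 (Av ∧ Mv) else 0)) * (b ^ 𝟙 Tv * (b ^ 𝟙 (Av ∧ not Mv) * b ^ 𝟙 (Av ∧ Mv)))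
          ≤ a ^ 𝟙 Tv * (a + b) ^ 𝟙 (Av ∧ not Mv) * (a * x + b) ^ 𝟙 (Av ∧ Mv) * b
      factor true true _ d with d refl
      ... | ()
      factor true false true _ = ≤-reflexive (id₁ a b x)
        where
        id₁ : ∀ a b x → (b + a * (x * 1)) * (1 * (1 * (b * 1))) ≡ 1 * 1 * ((a * x + b) * 1) * b
        id₁ = solve-∀
      factor true false false _ = ≤-reflexive (id₁ a b)
        where
        id₁ : ∀ a b → (b + a * 1) * (1 * (b * 1 * 1)) ≡ 1 * ((a + b) * 1) * 1 * b
        id₁ = solve-∀
      factor false true _ _ = ≤-reflexive (id₁ a b)
        where
        id₁ : ∀ a b → a * 1 * (b * 1 * 1) ≡ a * 1 * 1 * 1 * b
        id₁ = solve-∀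
      factor false false _ _ = ≤-reflexive (id₁ b)
        where
        id₁ : ∀ b → (b + 0) * 1 ≡ 1 * b
        id₁ = solve-∀

    Z-trivial : ∀ A T → Disjoint A T →
      Z A T * b ^ card T * b ^ card A ≤ a ^ card T * (a + b) ^ card A * b ^ n
    Z-trivial A T disj = begin
      Z A T * b ^ card T * b ^ card A  ≡⟨ id₁ (Z A T) (b ^ card T) (b ^ card A) ⟩
      Z A T * 1 * (b ^ card T * (b ^ card A * 1))  ≡⟨ cong₂ (λ s t → Z A T * 1 * (b ^ card T * (b ^ s * b ^ t))) A∖∅ A∩∅ ⟨
      Z A T * 1 * (b ^ card T * (b ^ card (A ∖ none) * b ^ card (λ v → A v ∧ none v)))  ≤⟨ Z-tilted A T none 1 0 ≤-refl disj (λ _ _ → z≤n) ⟩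
      a ^ card T * (a + b) ^ card (A ∖ none) * (a * 1 + b) ^ card (λ v → A v ∧ none v) * b ^ n  ≡⟨ cong₂ (λ s t → a ^ card T * (a + b) ^ s * (a * 1 + b) ^ t * b ^ n) A∖∅ A∩∅ ⟩
      a ^ card T * (a + b) ^ card A * 1 * b ^ n  ≡⟨ cong (_* b ^ n) (*-identityʳ (a ^ card T * (a + b) ^ card A)) ⟩
      a ^ card T * (a + b) ^ card A * b ^ n  ∎
      where
      none : VSet n
      none _ = false
      A∖∅ : card (A ∖ none) ≡ card A
      A∖∅ = card-cong (λ x → ∧-identityʳ (A x))
      A∩∅ : card (λ v → A v ∧ none v) ≡ 0
      A∩∅ = sum≡0 (λ x → cong 𝟙 (∧-zeroʳ (A x)))
      id₁ : ∀ z t s → z * t * s ≡ z * 1 * (t * (s * 1))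
      id₁ = solve-∀

    -- `pruned` consists of vertices that cannot belong to `I` once the pivot does. The index in `S`
    -- may differ between the two children because a pick can enlarge the recorded data.
    record Branch {S : Set} (Inv : S → VSet n → VSet n → Set) (D : ℕ) (A T : VSet n) : Set where
      field
        pivot         : Fin n
        pivot∈A       : A pivot ≡ true
        pruned        : VSet n
        pruned⊆A      : ∀ x → pruned x ≡ true → (A ⊖ pivot) x ≡ true
        D≤pruned      : D ≤ card pruned
        pruned-avoid  : ∀ I → InState (A ⊖ pivot) (T ⊕ pivot) I → ∀ x → pruned x ≡ true → lookup I x ≡ false
        unpicked      : S
        picked        : S
        inv-unpicked  : Inv unpicked (A ⊖ pivot) T
        inv-picked    : Inv picked (A ⊖ pivot ∖ pruned) (T ⊕ pivot)

    -- Put `V(A, T) = (a / b′)^|T| (z / y)^|A|`. The hypothesis on `y`, `z`, `D` says that the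
    -- values of `V` at the two children, the picked one having lost `D` extra vertices, sum to at
    -- most the value at the node; so a bound by `V` at the leaves climbs to the root. Taking `b′`
    -- larger than `b` discounts each pick.
    tree-bound : ∀ {S : Set} (Inv : S → VSet n → VSet n → Set) b′ y z D κ W →
      1 ≤ b′ → y ≤ z → b′ * y * z ^ D + a * y ^ suc D ≤ b′ * z ^ suc D →
      (∀ s A T → Disjoint A T → Inv s A T →
        κ * Z A T * b′ ^ card T * y ^ card A ≤ a ^ card T * z ^ card A * W ⊎ Branch Inv D A T) →
      ∀ s A T → Disjoint A T → Inv s A T →
      κ * Z A T * b′ ^ card T * y ^ card A ≤ a ^ card T * z ^ card A * W
    tree-bound {S} Inv b′ y z D κ W b′≥1 y≤z cond step s A T disj inv = go (card A) s A T ≤-refl disj inv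
      where
      Bound : VSet n → VSet n → Set
      Bound A T = κ * Z A T * b′ ^ card T * y ^ card A ≤ a ^ card T * z ^ card A * W
      go : ∀ fuel s A T → card A ≤ fuel → Disjoint A T → Inv s A T → Bound A T
      go fuel s A T le disj inv with step s A T disj inv
      ... | inj₁ bound = bound
      ... | inj₂ br = descend fuel le
        where
        open Branch br renaming (pivot to v; pruned to M)
        A⁻ = A ⊖ v
        T⁺ = T ⊕ v
        cardA : card A ≡ suc (card A⁻)
        cardA = card-⊖ A v pivot∈A
        cardT : card T⁺ ≡ suc (card T)
        cardT = card-⊕ T v (disj v pivot∈A)
        cardA⁻ : card A⁻ ≡ card M + card (A⁻ ∖ M)
        cardA⁻ = card-∖ A⁻ M pruned⊆A
        disj₁ : Disjoint A⁻ T
        disj₁ x h = disj x (proj₁ (∧-split h))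
        disj₂ : Disjoint (A⁻ ∖ M) T⁺
        disj₂ x h with x Fin.≟ v | ∧-split {A x} (proj₁ (∧-split h))
        ... | no _  | x∈A , _ = trans (∨-identityʳ (T x)) (disj x x∈A)
        ... | yes _ | _ , ()
        descend : ∀ fuel → card A ≤ fuel → Bound A T
        descend zero le with subst (_≤ 0) cardA le
        ... | ()
        descend (suc fuel) le = subst (λ c → κ * Z A T * b′ ^ card T * y ^ c ≤ a ^ card T * z ^ c * W) (sym cardA)
          (node-bound {κ * Z A T} {κ * Z A⁻ T} {κ * Z (A⁻ ∖ M) T⁺} {a} y z D (card A⁻) (card (A⁻ ∖ M)) b′≥1 y≤z cond size
            (≤-trans (*-monoʳ-≤ κ (≤-trans (Z-split A T v) (+-monoʳ-≤ (Z A⁻ T) (Z-prune A⁻ T⁺ M pruned-avoid)))) (≤-reflexive (*-distribˡ-+ κ (Z A⁻ T) (Z (A⁻ ∖ M) T⁺))))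
            (go fuel unpicked A⁻ T le′ disj₁ inv-unpicked)
            (subst (λ c → κ * Z (A⁻ ∖ M) T⁺ * b′ ^ c * y ^ card (A⁻ ∖ M) ≤ a ^ c * z ^ card (A⁻ ∖ M) * W) cardT
              (go fuel picked (A⁻ ∖ M) T⁺ le″ disj₂ inv-picked)))
          where
          le′ : card A⁻ ≤ fuel
          le′ = s≤s⁻¹ (subst (_≤ suc fuel) cardA le)
          le″ : card (A⁻ ∖ M) ≤ fuel
          le″ = ≤-trans (card-mono (A⁻ ∖ M) A⁻ (λ x h → proj₁ (∧-split h))) le′
          size : card (A⁻ ∖ M) + D ≤ card A⁻
          size = ≤-trans (+-monoʳ-≤ (card (A⁻ ∖ M)) D≤pruned) (≤-reflexive (trans (+-comm (card (A⁻ ∖ M)) (card M)) (sym cardA⁻)))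

-- Links and multigraph degrees in a triple system

record TripleSystem (n : ℕ) : Set where
  field
    h        : Fin n → Fin n → Fin n → Bool
    h-swapˡ  : ∀ x y z → h x y z ≡ h y x z
    h-swapʳ  : ∀ x y z → h x y z ≡ h x z y
    h-irrefl : ∀ x z → h x x z ≡ false
    Δ        : ℕ
    codeg≤Δ  : ∀ x y → sum (λ z → 𝟙 (h x y z)) ≤ Δ

module Triples {n : ℕ} (𝓗 : TripleSystem n) where
  open TripleSystem 𝓗 public

  Independent : Subset n → Set
  Independent I = ∀ x y z → lookup I x ≡ true → lookup I y ≡ true → lookup I z ≡ true → h x y z ≡ false

  h-irreflʳ : ∀ x z → h z x x ≡ false
  h-irreflʳ x z = trans (h-swapˡ z x x) (trans (h-swapʳ x z x) (h-irrefl x z))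

  h-irreflᵐ : ∀ x z → h x z x ≡ false
  h-irreflᵐ x z = trans (h-swapʳ x z x) (h-irrefl x z)

  -- Ordered pairs are counted, as in `edges` below.
  link : VSet n → Fin n → ℕ
  link A v = sum (λ x → sum (λ y → 𝟙 (A x ∧ (A y ∧ h v x y))))

  -- The multiplicity of the pair `x`, `y` in the multigraph formed by superposing the links of the
  -- vertices of `L`; `deg` and `edges` belong to the same multigraph.
  mult : VSet n → Fin n → Fin n → ℕ
  mult L x y = sum (λ t → 𝟙 (L t ∧ h t x y))

  deg : VSet n → VSet n → Fin n → ℕ
  deg L A x = sum (λ y → 𝟙 (A y) * mult L x y)

  edges : VSet n → VSet n → ℕ
  edges L A = sum (λ x → 𝟙 (A x) * deg L A x)

  neighbours : VSet n → VSet n → Fin n → VSet n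
  neighbours L A x y = A y ∧ does (1 ≤? mult L x y)

  mult≤Δ : ∀ L x y → mult L x y ≤ Δ
  mult≤Δ L x y = ≤-trans (sum-mono (λ t → 𝟙-mono (λ p → trans (sym (rot t)) (proj₂ (∧-split p))))) (codeg≤Δ x y)
    where
    rot : ∀ t → h t x y ≡ h x y t
    rot t = trans (h-swapˡ t x y) (h-swapʳ x t y)

  mult-sym : ∀ L x y → mult L x y ≡ mult L y x
  mult-sym L x y = sum-cong-≗ (λ t → cong (λ c → 𝟙 (L t ∧ c)) (h-swapʳ t x y))

  -- Multiplicities are codegrees, hence at most `Δ`. This converts degree, which averaging
  -- controls, into distinct vertices, which a pick can prune.
  deg≤Δ*neighbours : ∀ L A x → deg L A x ≤ Δ * card (neighbours L A x)
  deg≤Δ*neighbours L A x = ≤-trans (sum-mono pt) (≤-reflexive (sym (*-distribˡ-sum Δ (λ y → 𝟙 (neighbours L A x y)))))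
    where
    pt′ : ∀ a k → k ≤ Δ → 𝟙 a * k ≤ Δ * 𝟙 (a ∧ does (1 ≤? k))
    pt′ false k       _ = z≤n
    pt′ true  zero    _ = z≤n
    pt′ true  (suc k) h = subst₂ _≤_ (sym (+-identityʳ (suc k))) (sym (*-identityʳ Δ)) h
    pt : ∀ y → 𝟙 (A y) * mult L x y ≤ Δ * 𝟙 (neighbours L A x y)
    pt y = pt′ (A y) (mult L x y) (mult≤Δ L x y)

  neighbour-witness : ∀ L A x y → neighbours L A x y ≡ true → A y ≡ true × ∃ λ t → L t ≡ true × h t x y ≡ true
  neighbour-witness L A x y p =
    let y∈A , q = ∧-split p
        t , r   = sum-pos (λ t → 𝟙 (L t ∧ h t x y)) (does-sound (1 ≤? mult L x y) q)
    in y∈A , t , ∧-split (𝟙-pos r)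

  neighbours-avoid : ∀ {I} L A x y → Independent I → (∀ t → L t ≡ true → lookup I t ≡ true) → lookup I x ≡ true →
    neighbours L A x y ≡ true → lookup I y ≡ false
  neighbours-avoid L A x y ind L⊆I x∈I p =
    let _ , t , t∈L , e = neighbour-witness L A x y p
    in ¬-not (λ y∈I → true≢false e (ind t x y (L⊆I t t∈L) x∈I y∈I))

  neighbours-irrefl : ∀ L A x y → neighbours L A x y ≡ true → (A ⊖ x) y ≡ true
  neighbours-irrefl L A x y p with y Fin.≟ x | neighbour-witness L A x y p
  ... | no _     | y∈A , _ = trans (∧-identityʳ (A y)) y∈A
  ... | yes refl | _ , t , _ , e = ⊥-elim (true≢false e (h-irreflʳ x t))

  -- A lost pair has one of its two ends in `B ∖ A`, and such an end lies with `v` in at most `Δ`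
  -- edges.
  link-loss : ∀ A B v → link B v ≤ link A v + 2 * (Δ * card (B ∖ A))
  link-loss A B v = begin
    link B v  ≤⟨ sum-mono (λ x → sum-mono (λ y → pt x y)) ⟩
    sum (λ x → sum (λ y → p x y + (q x y + q y x))) ≡⟨ sum-cong-≗ (λ x → trans (∑-distrib-+ (p x) _) (cong (sum (p x) +_) (∑-distrib-+ (q x) (λ y → q y x)))) ⟩
    sum (λ x → sum (p x) + (sum (q x) + sum (λ y → q y x)))  ≡⟨ trans (∑-distrib-+ (sum ∘ p) _) (cong (link A v +_) (∑-distrib-+ (sum ∘ q) _)) ⟩
    link A v + (sum (sum ∘ q) + sum (λ x → sum (λ y → q y x)))  ≡⟨ cong (λ t → link A v + (sum (sum ∘ q) + t)) (∑-comm (λ x y → q y x)) ⟩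
    link A v + (sum (sum ∘ q) + sum (sum ∘ q))  ≤⟨ +-monoʳ-≤ (link A v) (+-mono-≤ qq qq) ⟩
    link A v + (Δ * card R + Δ * card R)  ≡⟨ cong (λ t → link A v + (Δ * card R + t)) (+-identityʳ (Δ * card R)) ⟨
    link A v + 2 * (Δ * card R)  ∎
    where
    R = B ∖ A
    p q : Fin n → Fin n → ℕ
    p x y = 𝟙 (A x ∧ (A y ∧ h v x y))
    q x y = 𝟙 (R x) * 𝟙 (h v x y)
    pt′ : ∀ a a′ b b′ c → 𝟙 (b ∧ (b′ ∧ c)) ≤ 𝟙 (a ∧ (a′ ∧ c)) + (𝟙 (b ∧ not a) * 𝟙 c + 𝟙 (b′ ∧ not a′) * 𝟙 c)
    pt′ _     _     false _     _     = z≤n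
    pt′ _     _     true  false _     = z≤n
    pt′ _     _     true  true  false = z≤n
    pt′ true  true  true  true  true  = ≤-refl
    pt′ true  false true  true  true  = ≤-refl
    pt′ false _     true  true  true  = s≤s z≤n
    pt : ∀ x y → 𝟙 (B x ∧ (B y ∧ h v x y)) ≤ p x y + (q x y + q y x)
    pt x y = ≤-trans (pt′ (A x) (A y) (B x) (B y) (h v x y))
      (≤-reflexive (cong (λ c → p x y + (q x y + 𝟙 (R y) * 𝟙 c)) (h-swapʳ v x y)))
    qq : sum (sum ∘ q) ≤ Δ * card R
    qq = begin
      sum (sum ∘ q)  ≡⟨ sum-cong-≗ (λ x → *-distribˡ-sum (𝟙 (R x)) (λ y → 𝟙 (h v x y))) ⟨
      sum (λ x → 𝟙 (R x) * sum (λ y → 𝟙 (h v x y)))  ≤⟨ sum-mono (λ x → *-monoʳ-≤ (𝟙 (R x)) (codeg≤Δ v x)) ⟩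
      sum (λ x → 𝟙 (R x) * Δ)  ≡⟨ *-distribʳ-sum Δ (𝟙 ∘ R) ⟨
      card R * Δ  ≡⟨ *-comm (card R) Δ ⟩
      Δ * card R  ∎

  edges≡links : ∀ L A → edges L A ≡ sum (λ t → 𝟙 (L t) * link A t)
  edges≡links L A = begin-equality
    sum (λ x → 𝟙 (A x) * deg L A x)
      ≡⟨ sum-cong-≗ (λ x → trans (*-distribˡ-sum (𝟙 (A x)) (λ y → 𝟙 (A y) * mult L x y)) (sum-cong-≗ (λ y →
           trans (cong (𝟙 (A x) *_) (*-distribˡ-sum (𝟙 (A y)) (λ t → 𝟙 (L t ∧ h t x y)))) (*-distribˡ-sum (𝟙 (A x)) (λ t → 𝟙 (A y) * 𝟙 (L t ∧ h t x y)))))) ⟩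
    sum (λ x → sum (λ y → sum (λ t → 𝟙 (A x) * (𝟙 (A y) * 𝟙 (L t ∧ h t x y)))))
      ≡⟨ sum-cong-≗ (λ x → ∑-comm (λ y t → 𝟙 (A x) * (𝟙 (A y) * 𝟙 (L t ∧ h t x y)))) ⟩
    sum (λ x → sum (λ t → sum (λ y → 𝟙 (A x) * (𝟙 (A y) * 𝟙 (L t ∧ h t x y)))))
      ≡⟨ ∑-comm (λ x t → sum (λ y → 𝟙 (A x) * (𝟙 (A y) * 𝟙 (L t ∧ h t x y)))) ⟩
    sum (λ t → sum (λ x → sum (λ y → 𝟙 (A x) * (𝟙 (A y) * 𝟙 (L t ∧ h t x y)))))
      ≡⟨ sum-cong-≗ (λ t → trans (sum-cong-≗ (λ x → trans (sum-cong-≗ (λ y → pt (A x) (A y) (L t) (h t x y)))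
           (sym (*-distribˡ-sum (𝟙 (L t)) (λ y → 𝟙 (A x ∧ (A y ∧ h t x y))))))) (sym (*-distribˡ-sum (𝟙 (L t)) (λ x → sum (λ y → 𝟙 (A x ∧ (A y ∧ h t x y))))))) ⟩
    sum (λ t → 𝟙 (L t) * link A t) ∎
    where
    pt : ∀ a b l c → 𝟙 a * (𝟙 b * 𝟙 (l ∧ c)) ≡ 𝟙 l * 𝟙 (a ∧ (b ∧ c))
    pt false _     l     _ = sym (*-zeroʳ (𝟙 l))
    pt true  false l     _ = sym (*-zeroʳ (𝟙 l))
    pt true  true  false _ = refl
    pt true  true  true  c = cong (_+ 0) (+-identityʳ (𝟙 c))

  deg-mono : ∀ L A′ A x → (∀ y → A′ y ≡ true → A y ≡ true) → deg L A′ x ≤ deg L A x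
  deg-mono L A′ A x A′⊆A = sum-mono (λ y → *-monoˡ-≤ (mult L x y) (𝟙-mono (A′⊆A y)))

  edges-loss : ∀ L A A′ → edges L A ≤ edges L A′ + 2 * sum (λ x → 𝟙 ((A ∖ A′) x) * deg L A x)
  edges-loss L A A′ = begin
    edges L A
      ≡⟨ sum-cong-≗ (λ x → *-distribˡ-sum (𝟙 (A x)) (λ y → 𝟙 (A y) * mult L x y)) ⟩
    sum (λ x → sum (λ y → 𝟙 (A x) * (𝟙 (A y) * mult L x y)))
      ≤⟨ sum-mono (λ x → sum-mono (λ y → pt x y)) ⟩
    sum (λ x → sum (λ y → p x y + (q x y + q y x)))
      ≡⟨ sum-cong-≗ (λ x → trans (∑-distrib-+ (p x) _) (cong (sum (p x) +_) (∑-distrib-+ (q x) (λ y → q y x)))) ⟩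
    sum (λ x → sum (p x) + (sum (q x) + sum (λ y → q y x)))
      ≡⟨ trans (∑-distrib-+ (sum ∘ p) _) (cong (sum (sum ∘ p) +_) (∑-distrib-+ (sum ∘ q) _)) ⟩
    sum (sum ∘ p) + (sum (sum ∘ q) + sum (λ x → sum (λ y → q y x)))
      ≡⟨ cong (λ t → sum (sum ∘ p) + (sum (sum ∘ q) + t)) (∑-comm (λ x y → q y x)) ⟩
    sum (sum ∘ p) + (sum (sum ∘ q) + sum (sum ∘ q))
      ≡⟨ cong₂ _+_ pp (trans (cong (sum (sum ∘ q) +_) (sym (+-identityʳ (sum (sum ∘ q))))) (cong (2 *_) qq)) ⟩
    edges L A′ + 2 * sum (λ x → 𝟙 (R x) * deg L A x) ∎
    where
    R = A ∖ A′
    p q : Fin n → Fin n → ℕ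
    p x y = 𝟙 (A′ x) * (𝟙 (A′ y) * mult L x y)
    q x y = 𝟙 (R x) * (𝟙 (A y) * mult L x y)
    pp : sum (sum ∘ p) ≡ edges L A′
    pp = sym (sum-cong-≗ (λ x → *-distribˡ-sum (𝟙 (A′ x)) (λ y → 𝟙 (A′ y) * mult L x y)))
    qq : sum (sum ∘ q) ≡ sum (λ x → 𝟙 (R x) * deg L A x)
    qq = sym (sum-cong-≗ (λ x → *-distribˡ-sum (𝟙 (R x)) (λ y → 𝟙 (A y) * mult L x y)))
    pt′ : ∀ a b a′ b′ k → 𝟙 a * (𝟙 b * k) ≤ 𝟙 a′ * (𝟙 b′ * k) + (𝟙 (a ∧ not a′) * (𝟙 b * k) + 𝟙 (b ∧ not b′) * (𝟙 a * k))
    pt′ false _     _     _     _ = z≤n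
    pt′ true  false _     _     _ = z≤n
    pt′ true  true  true  true  k = m≤m+n _ _
    pt′ true  true  true  false k = ≤-refl
    pt′ true  true  false b′    k = m≤m+n _ _
    pt : ∀ x y → 𝟙 (A x) * (𝟙 (A y) * mult L x y) ≤ p x y + (q x y + q y x)
    pt x y = subst (λ c → 𝟙 (A x) * (𝟙 (A y) * mult L x y) ≤ p x y + (q x y + 𝟙 (R y) * (𝟙 (A x) * c)))
      (mult-sym L x y) (pt′ (A x) (A y) (A′ x) (A′ y) (mult L x y))

-- Independent sets with a prescribed part outside B

module Near {n : ℕ} (𝓗 : TripleSystem n) (a b : ℕ) (P : Subset n → Set) (P? : ∀ I → Dec (P I))
            (P⇒Independent : ∀ I → P I → Triples.Independent 𝓗 I) where
  open Triples 𝓗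
  open Weighted {n} a b
  open Tree P P?

  -- Removing at most `n / 4kΔ` vertices from `B` destroys at most half of each link, so the links
  -- of `S` still carry `|S| n / 2k` pairs inside `A`. Averaging over the `n` vertices and dividing
  -- by the multiplicity bound `Δ` gives the vertex.
  busy-vertex : ∀ k B S A → 1 ≤ n → 1 ≤ card S → (∀ v → S v ≡ true → n ≤ k * link B v) →
    card (B ∖ A) * (2 * (2 * (k * Δ))) ≤ n →
    ∃ λ x → A x ≡ true × card S ≤ 2 * (k * Δ) * card (neighbours S A x)
  busy-vertex k B S A n≥1 S≥1 links few with pigeonhole (λ x → 2 * k * (𝟙 (A x) * deg S A x)) (card S) n≥1 total
    where
    halfLink : ∀ v → S v ≡ true → n ≤ 2 * k * link A v
    halfLink v v∈S = +-cancelʳ-≤ n _ _ (begin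
      n + n  ≤⟨ +-mono-≤ (links v v∈S) (links v v∈S) ⟩
      k * link B v + k * link B v  ≤⟨ +-mono-≤ l l ⟩
      k * (link A v + 2 * (Δ * r)) + k * (link A v + 2 * (Δ * r))  ≡⟨ id₁ k (link A v) Δ r ⟩
      2 * k * link A v + r * (2 * (2 * (k * Δ)))  ≤⟨ +-monoʳ-≤ (2 * k * link A v) few ⟩
      2 * k * link A v + n  ∎)
      where
      r = card (B ∖ A)
      l = *-monoʳ-≤ k (link-loss A B v)
      id₁ : ∀ k l Δ r → k * (l + 2 * (Δ * r)) + k * (l + 2 * (Δ * r)) ≡ 2 * k * l + r * (2 * (2 * (k * Δ)))
      id₁ = solve-∀
    pt : ∀ v → n * 𝟙 (S v) ≤ 2 * k * (𝟙 (S v) * link A v)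
    pt v with S v in eq
    ... | false = ≤-trans (≤-reflexive (*-zeroʳ n)) z≤n
    ... | true  = subst₂ _≤_ (sym (*-identityʳ n)) (cong (2 * k *_) (sym (+-identityʳ (link A v)))) (halfLink v eq)
    total : n * card S ≤ sum (λ x → 2 * k * (𝟙 (A x) * deg S A x))
    total = begin
      n * card S  ≡⟨ *-distribˡ-sum n (𝟙 ∘ S) ⟩
      sum (λ v → n * 𝟙 (S v))  ≤⟨ sum-mono pt ⟩
      sum (λ v → 2 * k * (𝟙 (S v) * link A v))  ≡⟨ *-distribˡ-sum (2 * k) (λ v → 𝟙 (S v) * link A v) ⟨
      2 * k * sum (λ v → 𝟙 (S v) * link A v)  ≡⟨ cong (2 * k *_) (edges≡links S A) ⟨
      2 * k * edges S A  ≡⟨ *-distribˡ-sum (2 * k) (λ x → 𝟙 (A x) * deg S A x) ⟩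
      sum (λ x → 2 * k * (𝟙 (A x) * deg S A x))  ∎
  ... | x , h with A x in eq
  ...   | false = ⊥-elim (<⇒≱ S≥1 (≤-trans h (≤-reflexive (*-zeroʳ (2 * k)))))
  ...   | true  = x , eq , (begin
    card S  ≤⟨ h ⟩
    2 * k * (deg S A x + 0)  ≡⟨ cong (2 * k *_) (+-identityʳ (deg S A x)) ⟩
    2 * k * deg S A x  ≤⟨ *-monoʳ-≤ (2 * k) (deg≤Δ*neighbours S A x) ⟩
    2 * k * (Δ * card (neighbours S A x))  ≡⟨ id₂ k Δ (card (neighbours S A x)) ⟩
    2 * (k * Δ) * card (neighbours S A x)  ∎)
    where
    id₂ : ∀ k Δ c → 2 * k * (Δ * c) ≡ 2 * (k * Δ) * c
    id₂ = solve-∀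

  -- The tree starts from `T = S` and stops once `E` vertices of `B` are settled; until then the
  -- removed part of `B` is small enough for `busy-vertex`. Each settled vertex saves `q / (q + 1)`,
  -- and `q + 1` such factors are worth a 2.
  near-bound : ∀ k B S D q E F → let N = a + b in
    1 ≤ n → 1 ≤ card S → Disjoint B S → (∀ v → S v ≡ true → n ≤ k * link B v) →
    1 ≤ b → D * a ≤ N → 4 * (N * N) ≤ D * (a * a) * suc q → 1 ≤ q →
    (∀ c → card S ≤ 2 * (k * Δ) * c → D ≤ c) →
    E * (2 * (2 * (k * Δ))) ≤ n → F * suc q ≤ E →
    Z B S * b ^ card S * b ^ card B * 2 ^ F ≤ a ^ card S * N ^ card B * b ^ n
  near-bound k B S D q E F n≥1 S≥1 disj links b≥1 Da≤N large q≥1 D≤ E≤ FQ≤E = cancelˡ (1≤^ E q≥1) (begin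
    q ^ E * (Z B S * bs * bB * 2 ^ F)  ≡⟨ id₁ (q ^ E) (Z B S * bs * bB) (2 ^ F) ⟩
    Z B S * bs * bB * (q ^ E * 2 ^ F)  ≤⟨ *-monoʳ-≤ (Z B S * bs * bB) (halving q F E FQ≤E) ⟩
    Z B S * bs * bB * Q ^ E  ≤⟨ cancelled ⟩
    q ^ E * (a ^ card S * N ^ card B * b ^ n)  ∎)
    where
    N = a + b
    Q = suc q
    bs = b ^ card S
    bB = b ^ card B
    y = b * Q
    z = N * q
    -- `W / κ = b^n (Q / q)^(|B| - E)`. A leaf has at most `|B| - E` vertices available, and this
    -- factor returns the saving `q / Q` that was granted in advance for them.
    κ = Q ^ E * q ^ card B
    W = b ^ n * (Q ^ card B * q ^ E)
    id₁ : ∀ u v w → u * (v * w) ≡ v * (u * w)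
    id₁ = solve-∀
    N′ : b + a ≡ N
    N′ = +-comm b a
    N≥1 : 1 ≤ N
    N≥1 = ≤-trans b≥1 (m≤n+m b a)
    cond : b * y * z ^ D + a * y ^ suc D ≤ b * z ^ suc D
    cond = subst (λ t → b * y * (t * q) ^ D + a * y ^ suc D ≤ b * (t * q) ^ suc D) N′
      (branching-step b a D q (subst (1 ≤_) (sym N′) N≥1) (subst (D * a ≤_) (sym N′) Da≤N)
        (subst (λ t → 4 * (t * t) ≤ D * (a * a) * Q) (sym N′) large))
    y≤z : y ≤ z
    y≤z = +-cancelʳ-≤ a _ _ (begin
      b * suc q + a  ≡⟨ id₂ a b q ⟩
      b * q + N  ≤⟨ +-monoʳ-≤ (b * q) N≤aQ ⟩
      b * q + a * suc q  ≡⟨ id₃ a b q ⟩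
      N * q + a  ∎)
      where
      id₂ : ∀ a b q → b * suc q + a ≡ b * q + (a + b)
      id₂ = solve-∀
      id₃ : ∀ a b q → b * q + a * suc q ≡ (a + b) * q + a
      id₃ = solve-∀
      id₄ : ∀ D a Q → D * (a * a) * Q ≡ D * a * (a * Q)
      id₄ = solve-∀
      N≤aQ : N ≤ a * Q
      N≤aQ = cancelˡ N≥1 (begin
        N * N  ≤⟨ m≤n*m (N * N) 4 ⟩
        4 * (N * N)  ≤⟨ large ⟩
        D * (a * a) * Q  ≡⟨ id₄ D a Q ⟩
        D * a * (a * Q)  ≤⟨ *-monoˡ-≤ (a * Q) Da≤N ⟩
        N * (a * Q)  ∎)
    Inv : ℕ → VSet n → VSet n → Set
    Inv _ A T = (∀ x → A x ≡ true → B x ≡ true) × (∀ x → S x ≡ true → T x ≡ true)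
    step : ∀ s A T → Disjoint A T → Inv s A T →
      κ * Z A T * b ^ card T * y ^ card A ≤ a ^ card T * z ^ card A * W ⊎ Branch Inv D A T
    step s A T disj (A⊆B , S⊆T) with card A + E ≤? card B
    ... | yes small = inj₁ terminal
      where
      terminal : κ * Z A T * b ^ card T * y ^ card A ≤ a ^ card T * z ^ card A * W
      terminal with ≤⇒+ small
      ... | r , eq = begin
        κ * Z A T * bT * y ^ cA  ≡⟨ cong₂ (λ s t → Q ^ E * q ^ s * Z A T * bT * t) eq (*-^ b Q cA) ⟩
        Q ^ E * q ^ (cA + E + r) * Z A T * bT * (b ^ cA * Q ^ cA)  ≡⟨ cong (λ t → Q ^ E * t * Z A T * bT * (b ^ cA * Q ^ cA)) (split q) ⟩
        Q ^ E * (q ^ cA * q ^ E * q ^ r) * Z A T * bT * (b ^ cA * Q ^ cA)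
          ≡⟨ id₅ (Q ^ E) (q ^ cA) (q ^ E) (q ^ r) (Z A T) bT (b ^ cA) (Q ^ cA) ⟩
        Z A T * bT * b ^ cA * (Q ^ cA * Q ^ E * q ^ cA * q ^ E * q ^ r)
          ≤⟨ *-mono-≤ (Z-trivial A T disj) (*-monoʳ-≤ (Q ^ cA * Q ^ E * q ^ cA * q ^ E) (^-monoˡ-≤ r (n≤1+n q))) ⟩
        a ^ card T * N ^ cA * b ^ n * (Q ^ cA * Q ^ E * q ^ cA * q ^ E * Q ^ r)
          ≡⟨ id₆ (a ^ card T) (N ^ cA) (b ^ n) (Q ^ cA) (Q ^ E) (q ^ cA) (q ^ E) (Q ^ r) ⟩
        a ^ card T * (N ^ cA * q ^ cA) * (b ^ n * (Q ^ cA * Q ^ E * Q ^ r * q ^ E))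
          ≡⟨ cong₂ (λ s t → a ^ card T * s * (b ^ n * (t * q ^ E))) (*-^ N q cA) (split Q) ⟨
        a ^ card T * z ^ cA * (b ^ n * (Q ^ (cA + E + r) * q ^ E))  ≡⟨ cong (λ s → a ^ card T * z ^ cA * (b ^ n * (Q ^ s * q ^ E))) eq ⟨
        a ^ card T * z ^ cA * W  ∎
        where
        cA = card A
        bT = b ^ card T
        split : ∀ x → x ^ (cA + E + r) ≡ x ^ cA * x ^ E * x ^ r
        split x = trans (^-distribˡ-+-* x (cA + E) r) (cong (_* x ^ r) (^-distribˡ-+-* x cA E))
        id₅ : ∀ QE qA qE qr Z t bA QA → QE * (qA * qE * qr) * Z * t * (bA * QA) ≡ Z * t * bA * (QA * QE * qA * qE * qr)
        id₅ = solve-∀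
        id₆ : ∀ α NA bn QA QE qA qE Qr → α * NA * bn * (QA * QE * qA * qE * Qr) ≡ α * (NA * qA) * (bn * (QA * QE * Qr * qE))
        id₆ = solve-∀
    ... | no ¬small with busy-vertex k B S A n≥1 S≥1 links few
      where
      few : card (B ∖ A) * (2 * (2 * (k * Δ))) ≤ n
      few = ≤-trans (*-monoˡ-≤ _ (+-cancelˡ-≤ (card A) _ _ (begin
        card A + card (B ∖ A)  ≡⟨ card-∖ B A A⊆B ⟨
        card B  ≤⟨ <⇒≤ (≰⇒> ¬small) ⟩
        card A + E  ∎))) E≤
    ...   | x , x∈A , busy = inj₂ (record
      { pivot = x ; pivot∈A = x∈A ; pruned = neighbours S A x ; pruned⊆A = neighbours-irrefl S A x
      ; D≤pruned = D≤ _ busy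
      ; pruned-avoid = λ { I (p , T⁺⊆I , _) y y∈M → neighbours-avoid {I} S A x y (P⇒Independent I p)
          (λ t t∈S → T⁺⊆I t (cong (_∨ (t ≟ᵇ x)) (S⊆T t t∈S)))
          (T⁺⊆I x (trans (cong (T x ∨_) (≟ᵇ-refl x)) (∨-zeroʳ (T x)))) y∈M }
      ; unpicked = 0 ; picked = 0
      ; inv-unpicked = (λ t h → A⊆B t (proj₁ (∧-split h))) , S⊆T
      ; inv-picked = (λ t h → A⊆B t (proj₁ (∧-split (proj₁ (∧-split {(A ⊖ x) t} h))))) , λ t h → cong (_∨ (t ≟ᵇ x)) (S⊆T t h) })
    cancelled : Z B S * bs * bB * Q ^ E ≤ q ^ E * (a ^ card S * N ^ card B * b ^ n)
    cancelled = cancelʳ (1≤* (1≤^ (card B) q≥1) (1≤^ (card B) (s≤s {n = q} z≤n))) (begin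
      Z B S * bs * bB * Q ^ E * (q ^ card B * Q ^ card B)  ≡⟨ id₇ (Z B S) bs bB (Q ^ E) (q ^ card B) (Q ^ card B) ⟩
      κ * Z B S * bs * (bB * Q ^ card B)  ≡⟨ cong (κ * Z B S * bs *_) (*-^ b Q (card B)) ⟨
      κ * Z B S * bs * y ^ card B  ≤⟨ tree-bound Inv b y z D κ W b≥1 y≤z cond step 0 B S disj ((λ _ h → h) , (λ _ h → h)) ⟩
      a ^ card S * z ^ card B * W  ≡⟨ cong (λ t → a ^ card S * t * W) (*-^ N q (card B)) ⟩
      a ^ card S * (N ^ card B * q ^ card B) * W  ≡⟨ id₈ (a ^ card S) (N ^ card B) (q ^ card B) (b ^ n) (Q ^ card B) (q ^ E) ⟩
      q ^ E * (a ^ card S * N ^ card B * b ^ n) * (q ^ card B * Q ^ card B) ∎)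
      where
      id₇ : ∀ Z s bB QE qB QB → Z * s * bB * QE * (qB * QB) ≡ QE * qB * Z * s * (bB * QB)
      id₇ = solve-∀
      id₈ : ∀ α NB qB bn QB qE → α * (NB * qB) * (bn * (QB * qE)) ≡ qE * (α * NB * bn) * (qB * QB)
      id₈ = solve-∀

-- Independent sets of a triple system

module Far {n : ℕ} (𝓗 : TripleSystem n) (a b : ℕ) (P : Subset n → Set) (P? : ∀ I → Dec (P I))
           (P⇒Independent : ∀ I → P I → Triples.Independent 𝓗 I) where
  open Triples 𝓗
  open Weighted {n} a b
  open Tree P P?

  -- L is the set of picked vertices whose links are recorded; its multigraph on A has degrees
  -- at most 2ΔD, every member of L contributed n / k edges to it, and the picks outside L
  -- removed D vertices each.
  record Ledger (k D : ℕ) (L A T : VSet n) : Set where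
    field
      L⊆T         : ∀ x → L x ≡ true → T x ≡ true
      bounded     : ∀ x → A x ≡ true → deg L A x ≤ 2 * (Δ * D)
      contributed : n * card L + k * (4 * (Δ * D)) * card A ≤ k * (edges L A + 4 * (Δ * D) * n)
      removed     : D * card T + card A ≤ n + D * card L

  edges-removal : ∀ L A A′ c → (∀ x → A x ≡ true → deg L A x ≤ c) → (∀ x → A′ x ≡ true → A x ≡ true) →
    edges L A + 2 * c * card A′ ≤ edges L A′ + 2 * c * card A
  edges-removal L A A′ c deg≤ A′⊆A = begin
    edges L A + 2 * c * card A′  ≤⟨ +-monoˡ-≤ (2 * c * card A′) (edges-loss L A A′) ⟩
    edges L A′ + 2 * sum (λ x → 𝟙 ((A ∖ A′) x) * deg L A x) + 2 * c * card A′  ≤⟨ +-monoˡ-≤ (2 * c * card A′) (+-monoʳ-≤ (edges L A′) (*-monoʳ-≤ 2 total)) ⟩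
    edges L A′ + 2 * (card (A ∖ A′) * c) + 2 * c * card A′  ≡⟨ id₁ (edges L A′) (card (A ∖ A′)) c (card A′) ⟩
    edges L A′ + 2 * c * (card A′ + card (A ∖ A′))  ≡⟨ cong (λ t → edges L A′ + 2 * c * t) (card-∖ A A′ A′⊆A) ⟨
    edges L A′ + 2 * c * card A  ∎
    where
    id₁ : ∀ e r c a → e + 2 * (r * c) + 2 * c * a ≡ e + 2 * c * (a + r)
    id₁ = solve-∀
    pt : ∀ x → 𝟙 ((A ∖ A′) x) * deg L A x ≤ 𝟙 ((A ∖ A′) x) * c
    pt x with A x in eq
    ... | false = z≤n
    ... | true  = *-monoʳ-≤ (𝟙 (not (A′ x))) (deg≤ x eq)
    total : sum (λ x → 𝟙 ((A ∖ A′) x) * deg L A x) ≤ card (A ∖ A′) * c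
    total = ≤-trans (sum-mono pt) (≤-reflexive (sym (*-distribʳ-sum c (𝟙 ∘ (A ∖ A′)))))

  -- By `bounded`, a removed vertex takes at most `2 · 2ΔD` ordered pairs with it, the price charged
  -- per missing vertex in `contributed`.
  ledger-shrink : ∀ k D L A A′ T → (∀ x → A′ x ≡ true → A x ≡ true) → Ledger k D L A T →
    n * card L + k * (4 * (Δ * D)) * card A′ ≤ k * (edges L A′ + 4 * (Δ * D) * n)
  ledger-shrink k D L A A′ T A′⊆A led = +-cancelʳ-≤ (k * (c * card A)) _ _ (begin
    n * card L + k * c * card A′ + k * (c * card A)  ≡⟨ id₁ (n * card L) k c (card A′) (card A) ⟩
    n * card L + k * c * card A + k * (c * card A′)  ≤⟨ +-monoˡ-≤ (k * (c * card A′)) contributed ⟩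
    k * (edges L A + c * n) + k * (c * card A′)  ≡⟨ id₂ k (edges L A) (c * n) (c * card A′) ⟩
    k * (edges L A + c * card A′) + k * (c * n)  ≤⟨ +-monoˡ-≤ (k * (c * n)) (*-monoʳ-≤ k loss) ⟩
    k * (edges L A′ + c * card A) + k * (c * n)  ≡⟨ id₂ k (edges L A′) (c * card A) (c * n) ⟩
    k * (edges L A′ + c * n) + k * (c * card A)  ∎)
    where
    open Ledger led
    c = 4 * (Δ * D)
    id₁ : ∀ p k c a′ a → p + k * c * a′ + k * (c * a) ≡ p + k * c * a + k * (c * a′)
    id₁ = solve-∀
    id₂ : ∀ k e u v → k * (e + u) + k * v ≡ k * (e + v) + k * u
    id₂ = solve-∀
    id₃ : ∀ D Δ → 2 * (2 * (Δ * D)) ≡ 4 * (Δ * D)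
    id₃ = solve-∀
    loss : edges L A + c * card A′ ≤ edges L A′ + c * card A
    loss = subst (λ t → edges L A + t * card A′ ≤ edges L A′ + t * card A) (id₃ D Δ)
      (edges-removal L A A′ (2 * (Δ * D)) bounded A′⊆A)

  -- At most `2ΔDn` pairs are present and `4ΔDn` were lost, while each member of `L` brought
  -- `n / k`; hence `|L| ≤ 6kΔD`. The picks outside `L` number at most `n / D`. Balancing the two at
  -- `D` of order `√n` makes the depth of order `√n`.
  ledger-size : ∀ k D L A T t₀ → 1 ≤ n → 1 ≤ D → Ledger k D L A T →
    n + D * (6 * (k * (Δ * D))) ≤ D * t₀ → card T ≤ t₀
  ledger-size k D L A T t₀ n≥1 D≥1 led budget = cancelˡ D≥1 (begin
    D * card T  ≤⟨ m≤m+n _ (card A) ⟩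
    D * card T + card A  ≤⟨ removed ⟩
    n + D * card L  ≤⟨ +-monoʳ-≤ n (*-monoʳ-≤ D L≤) ⟩
    n + D * (6 * (k * (Δ * D)))  ≤⟨ budget ⟩
    D * t₀  ∎)
    where
    open Ledger led
    c = 4 * (Δ * D)
    pt : ∀ x → 𝟙 (A x) * deg L A x ≤ 2 * (Δ * D)
    pt x with A x in eq
    ... | false = z≤n
    ... | true  = ≤-trans (≤-reflexive (+-identityʳ _)) (bounded x eq)
    edges≤ : edges L A ≤ n * (2 * (Δ * D))
    edges≤ = ≤-trans (sum-mono pt) (≤-reflexive (sum-const n (2 * (Δ * D))))
    id₁ : ∀ k n Δ D → k * (n * (2 * (Δ * D)) + 4 * (Δ * D) * n) ≡ n * (6 * (k * (Δ * D)))
    id₁ = solve-∀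
    L≤ : card L ≤ 6 * (k * (Δ * D))
    L≤ = cancelˡ n≥1 (begin
      n * card L  ≤⟨ m≤m+n _ (k * c * card A) ⟩
      n * card L + k * c * card A  ≤⟨ contributed ⟩
      k * (edges L A + c * n)  ≤⟨ *-monoʳ-≤ k (+-monoˡ-≤ (c * n) edges≤) ⟩
      k * (n * (2 * (Δ * D)) + c * n)  ≡⟨ id₁ k n Δ D ⟩
      n * (6 * (k * (Δ * D)))  ∎)

  edges-⊕ : ∀ L A v → L v ≡ false → edges (L ⊕ v) A ≡ edges L A + link A v
  edges-⊕ L A v v∉L = begin-equality
    edges (L ⊕ v) A  ≡⟨ edges≡links (L ⊕ v) A ⟩
    sum (λ t → 𝟙 ((L ⊕ v) t) * link A t)  ≡⟨ sum-cong-≗ pt ⟩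
    sum (λ t → 𝟙 (L t) * link A t + 𝟙 (t ≟ᵇ v) * link A v)  ≡⟨ ∑-distrib-+ (λ t → 𝟙 (L t) * link A t) _ ⟩
    sum (λ t → 𝟙 (L t) * link A t) + sum (λ t → 𝟙 (t ≟ᵇ v) * link A v)  ≡⟨ cong₂ _+_ (edges≡links L A) (*-distribʳ-sum (link A v) (λ t → 𝟙 (t ≟ᵇ v))) ⟨
    edges L A + card (_≟ᵇ v) * link A v  ≡⟨ cong (λ c → edges L A + c * link A v) (card-singleton v) ⟩
    edges L A + 1 * link A v  ≡⟨ cong (edges L A +_) (*-identityˡ (link A v)) ⟩
    edges L A + link A v  ∎
    where
    pt : ∀ t → 𝟙 ((L ⊕ v) t) * link A t ≡ 𝟙 (L t) * link A t + 𝟙 (t ≟ᵇ v) * link A v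
    pt t with t Fin.≟ v
    ... | no _ = trans (cong (λ c → 𝟙 c * link A t) (∨-identityʳ (L t))) (sym (+-identityʳ _))
    ... | yes refl rewrite v∉L = refl

  deg-⊕ : ∀ L A v x → deg (L ⊕ v) A x ≤ deg L A x + Δ
  deg-⊕ L A v x = begin
    deg (L ⊕ v) A x  ≤⟨ sum-mono pt ⟩
    sum (λ y → 𝟙 (A y) * mult L x y + 𝟙 (h v x y))  ≡⟨ ∑-distrib-+ (λ y → 𝟙 (A y) * mult L x y) _ ⟩
    deg L A x + sum (λ y → 𝟙 (h v x y))  ≤⟨ +-monoʳ-≤ (deg L A x) (codeg≤Δ v x) ⟩
    deg L A x + Δ  ∎
    where
    one : ∀ l e c → 𝟙 ((l ∨ e) ∧ c) ≤ 𝟙 (l ∧ c) + 𝟙 e * 𝟙 c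
    one true  e c = m≤m+n _ _
    one false e c = ≤-reflexive (𝟙-∧ e c)
    single : ∀ y → sum (λ t → 𝟙 (t ≟ᵇ v) * 𝟙 (h t x y)) ≤ 𝟙 (h v x y)
    single y = begin
      sum (λ t → 𝟙 (t ≟ᵇ v) * 𝟙 (h t x y))  ≡⟨ sum-cong-≗ at-v ⟩
      sum (λ t → 𝟙 (t ≟ᵇ v) * 𝟙 (h v x y))  ≡⟨ *-distribʳ-sum (𝟙 (h v x y)) (λ t → 𝟙 (t ≟ᵇ v)) ⟨
      card (_≟ᵇ v) * 𝟙 (h v x y)  ≡⟨ trans (cong (_* 𝟙 (h v x y)) (card-singleton v)) (*-identityˡ _) ⟩
      𝟙 (h v x y)  ∎
      where
      at-v : ∀ t → 𝟙 (t ≟ᵇ v) * 𝟙 (h t x y) ≡ 𝟙 (t ≟ᵇ v) * 𝟙 (h v x y)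
      at-v t with t Fin.≟ v
      ... | yes refl = refl
      ... | no _     = refl
    mult≤ : ∀ y → mult (L ⊕ v) x y ≤ mult L x y + 𝟙 (h v x y)
    mult≤ y = begin
      mult (L ⊕ v) x y  ≤⟨ sum-mono (λ t → one (L t) (t ≟ᵇ v) (h t x y)) ⟩
      sum (λ t → 𝟙 (L t ∧ h t x y) + 𝟙 (t ≟ᵇ v) * 𝟙 (h t x y))  ≡⟨ ∑-distrib-+ (λ t → 𝟙 (L t ∧ h t x y)) _ ⟩
      mult L x y + sum (λ t → 𝟙 (t ≟ᵇ v) * 𝟙 (h t x y))  ≤⟨ +-monoʳ-≤ (mult L x y) (single y) ⟩
      mult L x y + 𝟙 (h v x y)  ∎
    pt : ∀ y → 𝟙 (A y) * mult (L ⊕ v) x y ≤ 𝟙 (A y) * mult L x y + 𝟙 (h v x y)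
    pt y with A y
    ... | false = z≤n
    ... | true  = subst₂ _≤_ (sym (+-identityʳ _)) (cong (_+ 𝟙 (h v x y)) (sym (+-identityʳ _))) (mult≤ y)

  link-⊖ : ∀ A v A′ → (∀ x → (A ⊖ v) x ≡ true → A′ x ≡ true) → link A v ≤ link A′ v
  link-⊖ A v A′ keep = sum-mono (λ x → sum-mono (λ y → 𝟙-mono (pt x y)))
    where
    other : ∀ t → A t ≡ true → t ≢ v → A′ t ≡ true
    other t t∈A t≢v with keep t
    ... | f with t Fin.≟ v
    ...   | yes eq = ⊥-elim (t≢v eq)
    ...   | no _   = f (trans (∧-identityʳ (A t)) t∈A)
    pt : ∀ x y → A x ∧ (A y ∧ h v x y) ≡ true → A′ x ∧ (A′ y ∧ h v x y) ≡ true
    pt x y p =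
      let x∈A , q = ∧-split p
          y∈A , e = ∧-split q
      in ∧-join (other x x∈A (λ { refl → true≢false e (h-irrefl x y) }))
                (∧-join (other y y∈A (λ { refl → true≢false e (h-irreflᵐ y x) })) e)

  everything nothing : VSet n
  everything _ = true
  nothing _ = false

  card-nothing : card nothing ≡ 0
  card-nothing = sum≡0 {n} (λ _ → refl)

  card-everything : card everything ≡ n
  card-everything = trans (sum-const n 1) (*-identityʳ n)

  -- A Chernoff bound over branches: since leaves have at most `t₀` picks, weighting each pick by
  -- `1 / X` costs at most `X ^ t₀`, and the sum over all branches is then at most
  -- `(1 + a / (b X)) ^ n`. The recursion holds with equality for `b′ = y = b X` and `z = y + a`.
  far-bound : ∀ k D X t₀ κ W → 1 ≤ Δ → 1 ≤ n → 1 ≤ D → 1 ≤ X → 1 ≤ b →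
    n + D * (6 * (k * (Δ * D))) ≤ D * t₀ →
    (∀ A T → Disjoint A T → card T ≤ t₀ →
      κ * Z A T * b ^ card T ≤ a ^ card T * W ⊎ ∃ λ v → A v ≡ true × n ≤ k * link A v) →
    κ * Z everything nothing * (b * X) ^ n ≤ (b * X + a) ^ n * (X ^ t₀ * W)
  far-bound k D X t₀ κ W Δ≥1 n≥1 D≥1 X≥1 b≥1 budget dense = begin
    κ * Z everything nothing * y ^ n  ≡⟨ cong (_* y ^ n) (*-identityʳ (κ * Z everything nothing)) ⟨
    κ * Z everything nothing * y ^ 0 * y ^ n  ≡⟨ cong₂ (λ s t → κ * Z everything nothing * y ^ s * y ^ t) card-nothing card-everything ⟨
    -- The tree recursion gets credit for 0 pruned vertices. Pruning acts only through `removed`,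
    -- which limits the number of picks.
    κ * Z everything nothing * y ^ card nothing * y ^ card everything  ≤⟨ tree-bound (Ledger k D) y y z 0 κ (X ^ t₀ * W) bX≥1 (m≤m+n y a) cond step nothing everything nothing (λ _ _ → refl) initial ⟩
    a ^ card nothing * z ^ card everything * (X ^ t₀ * W)  ≡⟨ cong₂ (λ s t → a ^ s * z ^ t * (X ^ t₀ * W)) card-nothing card-everything ⟩
    1 * z ^ n * (X ^ t₀ * W)  ≡⟨ cong (_* (X ^ t₀ * W)) (*-identityˡ (z ^ n)) ⟩
    z ^ n * (X ^ t₀ * W)  ∎
    where
    y = b * X
    z = y + a
    c = 4 * (Δ * D)
    bX≥1 : 1 ≤ y
    bX≥1 = 1≤* b≥1 X≥1
    cond : y * y * z ^ 0 + a * y ^ 1 ≤ y * z ^ 1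
    cond = ≤-reflexive (id₁ y a)
      where
      id₁ : ∀ y a → y * y * 1 + a * (y * 1) ≡ y * ((y + a) * 1)
      id₁ = solve-∀
    initial : Ledger k D nothing everything nothing
    initial = record
      { L⊆T = λ _ ()
      ; bounded = λ x _ → ≤-trans (≤-reflexive (sum≡0 {n} (λ y → trans (cong (1 *_) (sum≡0 {n} (λ _ → refl))) refl))) z≤n
      ; contributed = begin
          n * card nothing + k * c * card everything  ≡⟨ cong₂ (λ s t → n * s + k * c * t) card-nothing card-everything ⟩
          n * 0 + k * c * n  ≡⟨ cong₂ _+_ (*-zeroʳ n) (*-assoc k c n) ⟩
          k * (c * n)  ≤⟨ *-monoʳ-≤ k (m≤n+m (c * n) _) ⟩
          k * (edges nothing everything + c * n)  ∎
      ; removed = ≤-reflexive (trans (cong₂ (λ s t → D * s + t) card-nothing card-everything)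
          (trans (cong (_+ n) (*-zeroʳ D)) (sym (trans (cong (λ s → n + D * s) card-nothing) (trans (cong (n +_) (*-zeroʳ D)) (+-identityʳ n))))))
      }
    step : ∀ L A T → Disjoint A T → Ledger k D L A T →
      κ * Z A T * y ^ card T * y ^ card A ≤ a ^ card T * z ^ card A * (X ^ t₀ * W) ⊎ Branch (Ledger k D) 0 A T
    step L A T disj led with dense A T disj (ledger-size k D L A T t₀ n≥1 D≥1 led budget)
    ... | inj₁ small = inj₁ (begin
      κ * Z A T * y ^ card T * y ^ card A  ≡⟨ cong (λ t → κ * Z A T * t * y ^ card A) (*-^ b X (card T)) ⟩
      κ * Z A T * (b ^ card T * X ^ card T) * y ^ card A  ≡⟨ id₁ (κ * Z A T) (b ^ card T) (X ^ card T) (y ^ card A) ⟩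
      κ * Z A T * b ^ card T * (X ^ card T * y ^ card A)
        ≤⟨ *-mono-≤ small (*-mono-≤ (^-mono-exp X≥1 (ledger-size k D L A T t₀ n≥1 D≥1 led budget)) (^-monoˡ-≤ (card A) (m≤m+n y a))) ⟩
      a ^ card T * W * (X ^ t₀ * z ^ card A)  ≡⟨ id₂ (a ^ card T) W (X ^ t₀) (z ^ card A) ⟩
      a ^ card T * z ^ card A * (X ^ t₀ * W)  ∎)
      where
      id₁ : ∀ p q r s → p * (q * r) * s ≡ p * q * (r * s)
      id₁ = solve-∀
      id₂ : ∀ p q r s → p * q * (r * s) ≡ p * s * (r * q)
      id₂ = solve-∀
    -- A vertex of degree at least `ΔD` takes precedence over `v`. So whenever `L` grows, all
    -- degrees are below `ΔD`, and the new link adds at most `Δ ≤ ΔD`; this keeps `bounded`.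
    ... | inj₂ (v , v∈A , n≤link) with any? (λ x → (A x Bool.≟ true) ×-dec (Δ * D ≤? deg L A x))
    ...   | yes (x , x∈A , busy) = inj₂ (record
      { pivot = x ; pivot∈A = x∈A ; pruned = M ; pruned⊆A = neighbours-irrefl L A x ; D≤pruned = z≤n
      ; pruned-avoid = λ { I (p , T⁺⊆I , _) y y∈M → neighbours-avoid {I} L A x y (P⇒Independent I p)
          (λ t t∈L → T⁺⊆I t (cong (_∨ (t ≟ᵇ x)) (L⊆T t t∈L)))
          (T⁺⊆I x (trans (cong (T x ∨_) (≟ᵇ-refl x)) (∨-zeroʳ (T x)))) y∈M }
      ; unpicked = L ; picked = L
      ; inv-unpicked = shrink (A ⊖ x) T (λ t t∈ → proj₁ (∧-split t∈)) L⊆T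
          (≤-trans (+-monoʳ-≤ (D * card T) (card-mono (A ⊖ x) A (λ t t∈ → proj₁ (∧-split t∈)))) removed)
      ; inv-picked = shrink A⁺ (T ⊕ x) A⁺⊆A (λ t t∈ → cong (_∨ (t ≟ᵇ x)) (L⊆T t t∈)) (begin
          D * card (T ⊕ x) + card A⁺  ≡⟨ cong (λ t → D * t + card A⁺) (card-⊕ T x (disj x x∈A)) ⟩
          D * suc (card T) + card A⁺  ≡⟨ id₁ D (card T) (card A⁺) ⟩
          D * card T + (D + card A⁺)  ≤⟨ +-monoʳ-≤ (D * card T) (≤-trans (+-monoˡ-≤ (card A⁺) D≤M) (≤-trans (n≤1+n _) (≤-reflexive (sym cardA)))) ⟩
          D * card T + card A  ≤⟨ removed ⟩
          n + D * card L  ∎)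
      })
      where
      open Ledger led
      M = neighbours L A x
      A⁺ = A ⊖ x ∖ M
      A⁺⊆A : ∀ t → A⁺ t ≡ true → A t ≡ true
      A⁺⊆A t t∈ = proj₁ (∧-split (proj₁ (∧-split {(A ⊖ x) t} t∈)))
      cardA : card A ≡ suc (card M + card A⁺)
      cardA = trans (card-⊖ A x x∈A) (cong suc (card-∖ (A ⊖ x) M (neighbours-irrefl L A x)))
      id₁ : ∀ D t a → D * suc t + a ≡ D * t + (D + a)
      id₁ = solve-∀
      D≤M : D ≤ card M
      D≤M = cancelˡ Δ≥1 (≤-trans busy (deg≤Δ*neighbours L A x))
      shrink : ∀ A′ T′ → (∀ t → A′ t ≡ true → A t ≡ true) → (∀ t → L t ≡ true → T′ t ≡ true) →
        D * card T′ + card A′ ≤ n + D * card L → Ledger k D L A′ T′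
      shrink A′ T′ A′⊆A L⊆T′ rem = record
        { L⊆T = L⊆T′
        ; bounded = λ t t∈ → ≤-trans (deg-mono L A′ A t A′⊆A) (bounded t (A′⊆A t t∈))
        ; contributed = ledger-shrink k D L A A′ T A′⊆A led
        ; removed = rem }
    ...   | no ¬busy = inj₂ (record
      { pivot = v ; pivot∈A = v∈A ; pruned = nothing ; pruned⊆A = λ _ () ; D≤pruned = z≤n
      ; pruned-avoid = λ _ _ _ ()
      ; unpicked = L ; picked = L ⊕ v
      ; inv-unpicked = record
        { L⊆T = L⊆T
        ; bounded = λ t t∈ → ≤-trans (deg-mono L (A ⊖ v) A t ⊖⊆) (bounded t (⊖⊆ t t∈))
        ; contributed = ledger-shrink k D L A (A ⊖ v) T ⊖⊆ led
        ; removed = ≤-trans (+-monoʳ-≤ (D * card T) (card-mono (A ⊖ v) A ⊖⊆)) removed }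
      ; inv-picked = record
        { L⊆T = λ t t∈ → grow t (L t) (t ≟ᵇ v) (T t) (L⊆T t) t∈
        ; bounded = λ t t∈ → begin
            deg (L ⊕ v) A⁺ t  ≤⟨ deg-⊕ L A⁺ v t ⟩
            deg L A⁺ t + Δ  ≤⟨ +-mono-≤ (≤-trans (deg-mono L A⁺ A t A⁺⊆A) (<⇒≤ (≰⇒> (λ q → ¬busy (t , A⁺⊆A t t∈ , q)))))
                                              (≤-trans (≤-reflexive (sym (*-identityʳ Δ))) (*-monoʳ-≤ Δ D≥1)) ⟩
            Δ * D + Δ * D  ≡⟨ cong (Δ * D +_) (+-identityʳ (Δ * D)) ⟨
            2 * (Δ * D)  ∎
        ; contributed = begin
            n * card (L ⊕ v) + k * c * card A⁺  ≡⟨ cong (λ t → n * t + k * c * card A⁺) (card-⊕ L v v∉L) ⟩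
            n * suc (card L) + k * c * card A⁺  ≡⟨ id₁ n (card L) (k * c * card A⁺) ⟩
            (n * card L + k * c * card A⁺) + n  ≤⟨ +-mono-≤ (ledger-shrink k D L A A⁺ T A⁺⊆A led) (≤-trans n≤link (*-monoʳ-≤ k (link-⊖ A v A⁺ (λ t t∈ → trans (∧-identityʳ _) t∈)))) ⟩
            k * (edges L A⁺ + c * n) + k * link A⁺ v  ≡⟨ id₂ k (edges L A⁺) (c * n) (link A⁺ v) ⟩
            k * (edges L A⁺ + link A⁺ v + c * n)  ≡⟨ cong (λ t → k * (t + c * n)) (edges-⊕ L A⁺ v v∉L) ⟨
            k * (edges (L ⊕ v) A⁺ + c * n)  ∎
        ; removed = begin
            D * card (T ⊕ v) + card A⁺  ≡⟨ cong (λ t → D * t + card A⁺) (card-⊕ T v (disj v v∈A)) ⟩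
            D * suc (card T) + card A⁺  ≡⟨ id₃ D (card T) (card A⁺) ⟩
            (D * card T + card A⁺) + D  ≤⟨ +-monoˡ-≤ D (≤-trans (+-monoʳ-≤ (D * card T) (card-mono A⁺ A A⁺⊆A)) removed) ⟩
            n + D * card L + D  ≡⟨ id₄ n D (card L) ⟩
            n + D * suc (card L)  ≡⟨ cong (λ t → n + D * t) (card-⊕ L v v∉L) ⟨
            n + D * card (L ⊕ v)  ∎
        }
      })
      where
      open Ledger led
      A⁺ = A ⊖ v ∖ nothing
      ⊖⊆ : ∀ t → (A ⊖ v) t ≡ true → A t ≡ true
      ⊖⊆ t t∈ = proj₁ (∧-split t∈)
      A⁺⊆A : ∀ t → A⁺ t ≡ true → A t ≡ true
      A⁺⊆A t t∈ = proj₁ (∧-split (proj₁ (∧-split {(A ⊖ v) t} t∈)))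
      v∉L : L v ≡ false
      v∉L = ¬-not (λ v∈L → true≢false (L⊆T v v∈L) (disj v v∈A))
      grow : ∀ t l e τ → (l ≡ true → τ ≡ true) → l ∨ e ≡ true → τ ∨ e ≡ true
      grow t true  e τ f _ rewrite f refl = refl
      grow t false e τ f p = trans (cong (τ ∨_) p) (∨-zeroʳ τ)
      id₁ : ∀ n l r → n * suc l + r ≡ n * l + r + n
      id₁ = solve-∀
      id₂ : ∀ k e c l → k * (e + c) + k * l ≡ k * (e + l + c)
      id₂ = solve-∀
      id₃ : ∀ D t a → D * suc t + a ≡ D * t + a + D
      id₃ = solve-∀
      id₄ : ∀ n D l → n + D * l + D ≡ n + D * suc l
      id₄ = solve-∀

-- Independent sets far from every member of the family

module FarMass {n : ℕ} (𝓗 : TripleSystem n) (ℬ : Subset n → Bool) (m b : ℕ)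
  (P : Subset n → Set) (P? : ∀ I → Dec (P I))
  (P⇒Independent : ∀ I → P I → Triples.Independent 𝓗 I)
  (δ̄ : ℕ) (P⇒far : ∀ I → P I → ∀ B → ℬ B ≡ true → m ≤ δ̄ * card (lookup I ∖ lookup B)) where
  open Triples 𝓗
  open Weighted {n} m b
  open Tree P P?
  open Far 𝓗 m b P P? P⇒Independent

  module _ (b≥1 : 1 ≤ b) (Bound : ∀ B → ℬ B ≡ true → card (lookup B) ≤ m + b) where
    private N = m + b

    -- Each of the `d = N - |A|` missing vertices saves `b / N`. Only `n ≤ d β̄` is known about `d`,
    -- so `gain` is checked after raising to the power `β̄`.
    terminal-small : ∀ β̄ Y → 1 ≤ β̄ → Y ^ β̄ * b ^ n ≤ N ^ n → ∀ A T → Disjoint A T → β̄ * card A + n ≤ β̄ * N →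
      b ^ N * Y * Z A T * b ^ card T ≤ m ^ card T * (N ^ N * b ^ n)
    terminal-small β̄ Y β̄≥1 Y≤ A T disj small with ≤⇒+ {card A} {N} (cancelˡ β̄≥1 (≤-trans (m≤m+n _ n) small))
    ... | d , eq = begin
      b ^ N * Y * Z A T * b ^ card T  ≡⟨ cong (λ t → t * Y * Z A T * b ^ card T) (split b) ⟩
      b ^ cA * b ^ d * Y * Z A T * b ^ card T  ≡⟨ id₁ (b ^ cA) (b ^ d) Y (Z A T) (b ^ card T) ⟩
      Z A T * b ^ card T * b ^ cA * (b ^ d * Y)  ≤⟨ *-mono-≤ (Z-trivial A T disj) gain ⟩
      m ^ card T * N ^ cA * b ^ n * N ^ d  ≡⟨ id₂ (m ^ card T) (N ^ cA) (b ^ n) (N ^ d) ⟩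
      m ^ card T * (N ^ cA * N ^ d * b ^ n)  ≡⟨ cong (λ t → m ^ card T * (t * b ^ n)) (split N) ⟨
      m ^ card T * (N ^ N * b ^ n)  ∎
      where
      cA = card A
      split : ∀ x → x ^ N ≡ x ^ cA * x ^ d
      split x = trans (cong (x ^_) eq) (^-distribˡ-+-* x cA d)
      id₁ : ∀ p q y z t → p * q * y * z * t ≡ z * t * p * (q * y)
      id₁ = solve-∀
      id₂ : ∀ p q r s → p * q * r * s ≡ p * (q * s * r)
      id₂ = solve-∀
      n≤dβ̄ : n ≤ d * β̄
      n≤dβ̄ = +-cancelˡ-≤ (β̄ * cA) _ _ (begin
        β̄ * cA + n  ≤⟨ small ⟩
        β̄ * N  ≡⟨ cong (β̄ *_) eq ⟩
        β̄ * (cA + d)  ≡⟨ trans (*-distribˡ-+ β̄ cA d) (cong (β̄ * cA +_) (*-comm β̄ d)) ⟩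
        β̄ * cA + d * β̄  ∎)
      gain : b ^ d * Y ≤ N ^ d
      gain with ≤⇒+ n≤dβ̄
      ... | r , eq′ = ^-cancel-≤ β̄≥1 (begin
        (b ^ d * Y) ^ β̄  ≡⟨ trans (*-^ (b ^ d) Y β̄) (cong (_* Y ^ β̄) (^-*-assoc b d β̄)) ⟩
        b ^ (d * β̄) * Y ^ β̄  ≡⟨ cong (_* Y ^ β̄) (trans (cong (b ^_) eq′) (^-distribˡ-+-* b n r)) ⟩
        b ^ n * b ^ r * Y ^ β̄  ≡⟨ id₃ (b ^ n) (b ^ r) (Y ^ β̄) ⟩
        Y ^ β̄ * b ^ n * b ^ r  ≤⟨ *-mono-≤ Y≤ (^-monoˡ-≤ r (m≤n+m b m)) ⟩
        N ^ n * N ^ r  ≡⟨ trans (cong (N ^_) eq′) (^-distribˡ-+-* N n r) ⟨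
        N ^ (d * β̄)  ≡⟨ ^-*-assoc N d β̄ ⟨
        (N ^ d) ^ β̄  ∎)
        where
        id₃ : ∀ p q r → p * q * r ≡ r * p * q
        id₃ = solve-∀

    -- Members of P have many vertices in A ∖ B, so their weight is estimated by tilting A ∖ B by x.
    terminal-near : ∀ x j g c̄ Y t₀ → 1 ≤ x → 1 ≤ g → n ≤ c̄ * b → Y ^ g * 4 ^ (c̄ * (m * x)) ≤ x ^ (j * g) →
      1 ≤ δ̄ → 2 * δ̄ * j ≤ m → 2 * δ̄ * t₀ ≤ m →
      ∀ A T B → Disjoint A T → card T ≤ t₀ → ℬ B ≡ true → g * card (A ∖ lookup B) ≤ n →
      b ^ N * Y * Z A T * b ^ card T ≤ m ^ card T * (N ^ N * b ^ n)
    terminal-near x j g c̄ Y t₀ x≥1 g≥1 n≤c̄b Y≤ δ̄≥1 j≤ t₀≤ A T B disj T≤ B∈ℬ near with ≤⇒+ c₀≤N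
      where
      M : VSet n
      M v = not (lookup B v)
      c₀≤N : card (A ∖ M) ≤ N
      c₀≤N = ≤-trans (card-mono (A ∖ M) (lookup B) (λ v p → trans (sym (not-involutive (lookup B v))) (proj₂ (∧-split p)))) (Bound B B∈ℬ)
    ... | d , eq = cancelʳ (1≤* (1≤^ j x≥1) (1≤^ s b≥1)) (begin
      b ^ N * Y * Z A T * b ^ card T * (x ^ j * b ^ s)  ≡⟨ cong (λ t → t * Y * Z A T * b ^ card T * (x ^ j * b ^ s)) (split b) ⟩
      b ^ c₀ * b ^ d * Y * Z A T * b ^ card T * (x ^ j * b ^ s)  ≡⟨ id₁ (b ^ c₀) (b ^ d) Y (Z A T) (b ^ card T) (x ^ j) (b ^ s) ⟩
      b ^ d * Y * (Z A T * x ^ j * (b ^ card T * (b ^ c₀ * b ^ s)))  ≤⟨ *-mono-≤ (*-monoˡ-≤ Y (^-monoˡ-≤ d (m≤n+m b m))) (Z-tilted A T M x j x≥1 disj many) ⟩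
      N ^ d * Y * (m ^ card T * N ^ c₀ * (m * x + b) ^ s * b ^ n)  ≡⟨ id₂ (N ^ d) Y (m ^ card T) (N ^ c₀) ((m * x + b) ^ s) (b ^ n) ⟩
      m ^ card T * (N ^ c₀ * N ^ d * b ^ n) * (Y * (m * x + b) ^ s)  ≤⟨ *-monoʳ-≤ (m ^ card T * (N ^ c₀ * N ^ d * b ^ n)) tilt ⟩
      m ^ card T * (N ^ c₀ * N ^ d * b ^ n) * (x ^ j * b ^ s)  ≡⟨ cong (λ t → m ^ card T * (t * b ^ n) * (x ^ j * b ^ s)) (split N) ⟨
      m ^ card T * (N ^ N * b ^ n) * (x ^ j * b ^ s)  ∎)
      where
      M : VSet n
      M v = not (lookup B v)
      s = card (λ v → A v ∧ M v)
      c₀ = card (A ∖ M)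
      split : ∀ x → x ^ N ≡ x ^ c₀ * x ^ d
      split x = trans (cong (x ^_) eq) (^-distribˡ-+-* x c₀ d)
      id₁ : ∀ p q y z t u v → p * q * y * z * t * (u * v) ≡ q * y * (z * u * (t * (p * v)))
      id₁ = solve-∀
      id₂ : ∀ q y t p u v → q * y * (t * p * u * v) ≡ t * (p * q * v) * (y * u)
      id₂ = solve-∀
      -- `I` has `m / δ̄` vertices outside `B`, and `T` accounts for at most `t₀ ≤ m / 2δ̄` of them;
      -- the others lie in `A ∖ B`.
      many : ∀ I → InState A T I → j ≤ card (λ v → lookup I v ∧ (A v ∧ M v))
      many I (p , T⊆I , I⊆) = cancelˡ {2 * δ̄} (1≤* {2} (s≤s z≤n) δ̄≥1) (begin
        2 * δ̄ * j  ≤⟨ j≤ ⟩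
        m  ≤⟨ +-cancelʳ-≤ m _ _ (begin
          m + m  ≤⟨ +-mono-≤ far far ⟩
          δ̄ * (card T + c) + δ̄ * (card T + c)  ≤⟨ +-mono-≤ (*-monoʳ-≤ δ̄ (+-monoˡ-≤ c T≤)) (*-monoʳ-≤ δ̄ (+-monoˡ-≤ c T≤)) ⟩
          δ̄ * (t₀ + c) + δ̄ * (t₀ + c)  ≡⟨ id₃ δ̄ t₀ c ⟩
          2 * δ̄ * c + 2 * δ̄ * t₀  ≤⟨ +-monoʳ-≤ (2 * δ̄ * c) t₀≤ ⟩
          2 * δ̄ * c + m  ∎) ⟩
        2 * δ̄ * c  ∎)
        where
        c = card (λ v → lookup I v ∧ (A v ∧ M v))
        id₃ : ∀ δ t c → δ * (t + c) + δ * (t + c) ≡ 2 * δ * c + 2 * δ * t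
        id₃ = solve-∀
        pt : ∀ i t α β → (i ≡ true → t ∨ α ≡ true) → 𝟙 (i ∧ not β) ≤ 𝟙 t + 𝟙 (i ∧ (α ∧ not β))
        pt false _     _     _     _ = z≤n
        pt true  true  _     β     _ = ≤-trans (𝟙≤1 (not β)) (s≤s z≤n)
        pt true  false true  _     _ = ≤-refl
        pt true  false false _     f with f refl
        ... | ()
        far : m ≤ δ̄ * (card T + c)
        far = ≤-trans (P⇒far I p B B∈ℬ) (*-monoʳ-≤ δ̄ (≤-trans (sum-mono (λ v → pt (lookup I v) (T v) (A v) (lookup B v) (I⊆ v)))
                (≤-reflexive (∑-distrib-+ (𝟙 ∘ T) (λ v → 𝟙 (lookup I v ∧ (A v ∧ M v)))))))
      -- The tilt costs `(1 + mx/b)^s` with `s = |A ∖ B|`. As `s ≤ n / g` is available only in the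
      -- form `g s ≤ n`, the comparison is made between `g`-th powers.
      tilt : Y * (m * x + b) ^ s ≤ x ^ j * b ^ s
      tilt = ^-cancel-≤ g≥1 (begin
        (Y * (m * x + b) ^ s) ^ g  ≡⟨ trans (*-^ Y _ g) (cong (Y ^ g *_) (^-*-assoc (m * x + b) s g)) ⟩
        Y ^ g * (m * x + b) ^ (s * g)  ≡⟨ cong (λ t → Y ^ g * t ^ (s * g)) (+-comm (m * x) b) ⟩
        Y ^ g * (b + m * x) ^ (s * g)  ≤⟨ *-monoʳ-≤ (Y ^ g) ([1+m/b]^n≤4^cm b (m * x) (s * g) c̄ b≥1 (≤-trans (≤-reflexive (*-comm s g)) (≤-trans near n≤c̄b))) ⟩
        Y ^ g * (4 ^ (c̄ * (m * x)) * b ^ (s * g))  ≡⟨ *-assoc (Y ^ g) _ _ ⟨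
        Y ^ g * 4 ^ (c̄ * (m * x)) * b ^ (s * g)  ≤⟨ *-monoˡ-≤ (b ^ (s * g)) Y≤ ⟩
        x ^ (j * g) * b ^ (s * g)  ≡⟨ cong₂ _*_ (^-*-assoc x j g) (^-*-assoc b s g) ⟨
        (x ^ j) ^ g * (b ^ s) ^ g  ≡⟨ *-^ (x ^ j) (b ^ s) g ⟨
        (x ^ j * b ^ s) ^ g  ∎)

    far-mass : ∀ k D X t₀ β̄ Y x j g c̄ w → 1 ≤ Δ → 1 ≤ n → 1 ≤ D → 1 ≤ X →
      n + D * (6 * (k * (Δ * D))) ≤ D * t₀ →
      1 ≤ β̄ → Y ^ β̄ * b ^ n ≤ N ^ n →
      1 ≤ x → 1 ≤ g → n ≤ c̄ * b → Y ^ g * 4 ^ (c̄ * (m * x)) ≤ x ^ (j * g) →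
      1 ≤ δ̄ → 2 * δ̄ * j ≤ m → 2 * δ̄ * t₀ ≤ m → 1 ≤ Y →
      (∀ A → β̄ * N ≤ β̄ * card A + n → (∃ λ v → A v ≡ true × n ≤ k * link A v) ⊎ (∃ λ B → ℬ B ≡ true × g * card (A ∖ lookup B) ≤ n)) →
      w * ((b * X + m) ^ n * X ^ t₀) ≤ (b * X) ^ n * Y →
      w * (b ^ N * mass P?) ≤ N ^ N * b ^ n
    far-mass k D X t₀ β̄ Y x j g c̄ w Δ≥1 n≥1 D≥1 X≥1 budget β̄≥1 Y≤₁ x≥1 g≥1 n≤c̄b Y≤₂ δ̄≥1 j≤ t₀≤ Y≥1 stable saving =
      cancelʳ (1≤* (1≤^ n (1≤* b≥1 X≥1)) Y≥1) (begin
        w * (b ^ N * mass P?) * (y ^ n * Y)  ≤⟨ *-monoˡ-≤ (y ^ n * Y) (*-monoʳ-≤ w (*-monoʳ-≤ (b ^ N) whole)) ⟩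
        w * (b ^ N * Z₀) * (y ^ n * Y)  ≡⟨ id₁ w (b ^ N) Z₀ (y ^ n) Y ⟩
        w * (b ^ N * Y * Z₀ * y ^ n)  ≤⟨ *-monoʳ-≤ w (far-bound k D X t₀ (b ^ N * Y) (N ^ N * b ^ n) Δ≥1 n≥1 D≥1 X≥1 b≥1 budget cases) ⟩
        w * ((y + m) ^ n * (X ^ t₀ * (N ^ N * b ^ n)))  ≡⟨ id₂ w ((y + m) ^ n) (X ^ t₀) (N ^ N * b ^ n) ⟩
        w * ((y + m) ^ n * X ^ t₀) * (N ^ N * b ^ n)  ≤⟨ *-monoˡ-≤ (N ^ N * b ^ n) saving ⟩
        y ^ n * Y * (N ^ N * b ^ n)  ≡⟨ *-comm (y ^ n * Y) _ ⟩
        N ^ N * b ^ n * (y ^ n * Y)  ∎)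
      where
      y = b * X
      Z₀ = Z everything nothing
      id₁ : ∀ w p z q r → w * (p * z) * (q * r) ≡ w * (p * r * z * q)
      id₁ = solve-∀
      id₂ : ∀ w p q r → w * (p * (q * r)) ≡ w * (p * q) * r
      id₂ = solve-∀
      whole : mass P? ≤ Z₀
      whole = mass-mono P? (inState? everything nothing) (λ I p → p , (λ _ ()) , (λ _ _ → refl))
      cases : ∀ A T → Disjoint A T → card T ≤ t₀ →
        b ^ N * Y * Z A T * b ^ card T ≤ m ^ card T * (N ^ N * b ^ n) ⊎ ∃ λ v → A v ≡ true × n ≤ k * link A v
      cases A T disj T≤ with β̄ * N ≤? β̄ * card A + n
      ... | no ¬large = inj₁ (terminal-small β̄ Y β̄≥1 Y≤₁ A T disj (<⇒≤ (≰⇒> ¬large)))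
      ... | yes large with stable A large
      ...   | inj₁ dense = inj₂ dense
      ...   | inj₂ (B , B∈ℬ , near) = inj₁ (terminal-near x j g c̄ Y t₀ x≥1 g≥1 n≤c̄b Y≤₂ δ̄≥1 j≤ t₀≤ A T B disj T≤ B∈ℬ near)

-- Independent sets close to a member of the family

quotient : ∀ m {n} → 1 ≤ n → ∃ λ q → q * n ≤ m × m < suc q * n
quotient m {n} n≥1 = m / n , m/n*n≤m m n , <suc-quotient m n
  where instance _ = >-nonZero n≥1

quotient≥1 : ∀ {m n} q → n ≤ m → m < suc q * n → 1 ≤ q
quotient≥1 {n = n} zero n≤m m< = ⊥-elim (<⇒≱ m< (≤-trans (≤-reflexive (+-identityʳ n)) n≤m))
quotient≥1 (suc q) _ _ = s≤s z≤n

*-cancelʳ-<′ : ∀ {a b} n → a * n < b * n → a < b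
*-cancelʳ-<′ {a} {b} n = *-cancelʳ-< n a b

-- `⌊(s - 1) / d⌋ + 1` is `⌈s / d⌉`, the number of neighbours a busy vertex is sure to have, while
-- `branching-step` admits only `D ≤ N / m`. The final alternative records which of the two attains
-- the minimum, as the resulting savings are spent differently.
capped-ceiling : ∀ m N d s → 1 ≤ m → m ≤ N → 1 ≤ d → 1 ≤ s →
  ∃ λ D → 1 ≤ D × D * m ≤ N × (∀ c → s ≤ d * c → D ≤ c) × (N ≤ 2 * (D * m) ⊎ s ≤ d * D)
capped-ceiling m N d s m≥1 m≤N d≥1 s≥1 with quotient (s ∸ 1) d≥1 | quotient N m≥1
... | c₁ , low , high | c₂ , c₂m≤N , N< = D , D≥1 , ≤-trans (*-monoˡ-≤ m (m⊓n≤n (suc c₁) c₂)) c₂m≤N , D≤ , alternative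
  where
  D = suc c₁ ⊓ c₂
  c₂≥1 = quotient≥1 c₂ m≤N N<
  D≥1 : 1 ≤ D
  D≥1 = ⊓-glb (s≤s z≤n) c₂≥1
  D≤ : ∀ c → s ≤ d * c → D ≤ c
  D≤ c h = ≤-trans (m⊓n≤m (suc c₁) c₂) (*-cancelʳ-<′ d (begin-strict
    c₁ * d  ≤⟨ low ⟩
    s ∸ 1  <⟨ ≤-reflexive (m+[n∸m]≡n s≥1) ⟩
    s  ≤⟨ h ⟩
    d * c  ≡⟨ *-comm d c ⟩
    c * d  ∎))
  N≤2c₂m : N ≤ 2 * (c₂ * m)
  N≤2c₂m = begin
    N  ≤⟨ <⇒≤ N< ⟩
    m + c₂ * m  ≤⟨ +-monoˡ-≤ (c₂ * m) (≤-trans (≤-reflexive (sym (*-identityˡ m))) (*-monoˡ-≤ m c₂≥1)) ⟩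
    c₂ * m + c₂ * m  ≡⟨ cong (c₂ * m +_) (+-identityʳ (c₂ * m)) ⟨
    2 * (c₂ * m)  ∎
  s≤dc₁ : s ≤ d * suc c₁
  s≤dc₁ = begin
    s  ≡⟨ m+[n∸m]≡n s≥1 ⟨
    suc (s ∸ 1)  ≤⟨ high ⟩
    suc c₁ * d  ≡⟨ *-comm (suc c₁) d ⟩
    d * suc c₁  ∎
  alternative : N ≤ 2 * (D * m) ⊎ s ≤ d * D
  alternative with ⊓-sel (suc c₁) c₂
  ... | inj₁ eq = inj₂ (subst (λ t → s ≤ d * t) (sym eq) s≤dc₁)
  ... | inj₂ eq = inj₁ (subst (λ t → N ≤ 2 * (t * m)) (sym eq) N≤2c₂m)

-- D is ⌈s/d⌉ capped at ⌊N/m⌋, 1/(q+1) ≈ D m² / 4N², and F ≈ E D m² / N² with E = ⌊n/2d⌋.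
near-parameters : ∀ n m N d s ε → 4 * d * 5 ≤ ε → 1 ≤ m → m ≤ N → N ≤ n → 1 ≤ d → 1 ≤ s → 4 * d ≤ n →
  ∃ λ D → ∃ λ q → ∃ λ E → ∃ λ F →
    D * m ≤ N × 4 * (N * N) ≤ D * (m * m) * suc q × 1 ≤ q × (∀ c → s ≤ d * c → D ≤ c) ×
    E * (2 * d) ≤ n × F * suc q ≤ E ×
    D * (m * m) ≤ ε * suc F * N × (N ≤ 2 * (D * m) ⊎ s ≤ d * D)
near-parameters n m N d s ε ε≥ m≥1 m≤N N≤n d≥1 s≥1 4d≤n with capped-ceiling m N d s m≥1 m≤N d≥1 s≥1
... | D , D≥1 , Dm≤N , D≤ , alternative
    with quotient (4 * (N * N)) (1≤* D≥1 (1≤* m≥1 m≥1)) | quotient n (1≤* {2} (s≤s z≤n) d≥1)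
...   | q , q≤ , q< | E , E≤ , n< with quotient E {suc q} (s≤s z≤n)
...     | F , F≤ , E< =
  D , q , E , F , Dm≤N , ≤-trans (<⇒≤ q<) (≤-reflexive (*-comm (suc q) (D * (m * m)))) , q≥1 , D≤ , E≤ , F≤ , rate , alternative
  where
  id₁ : ∀ D m → D * (m * m) ≡ D * m * m
  id₁ = solve-∀
  Dmm≤NN : D * (m * m) ≤ N * N
  Dmm≤NN = ≤-trans (≤-reflexive (id₁ D m)) (*-mono-≤ Dm≤N m≤N)
  q≥1 : 1 ≤ q
  q≥1 = quotient≥1 q (≤-trans Dmm≤NN (m≤n*m (N * N) 4)) q<
  n≤4dE : n ≤ 4 * d * E
  n≤4dE = +-cancelʳ-≤ (4 * d) _ _ (begin
    n + 4 * d  ≤⟨ +-monoʳ-≤ n 4d≤n ⟩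
    n + n  ≤⟨ +-mono-≤ (<⇒≤ n<) (<⇒≤ n<) ⟩
    suc E * (2 * d) + suc E * (2 * d)  ≡⟨ id₂ d E ⟩
    4 * d * E + 4 * d  ∎)
    where
    id₂ : ∀ d E → suc E * (2 * d) + suc E * (2 * d) ≡ 4 * d * E + 4 * d
    id₂ = solve-∀
  -- The 4 comes from `q` and the extra 1 from rounding it up to `q + 1`. Together with `n ≤ 4dE`
  -- this accounts for `4 * d * 5` in the hypothesis on `ε`.
  QDmm≤ : suc q * (D * (m * m)) ≤ 5 * (N * N)
  QDmm≤ = +-mono-≤ Dmm≤NN q≤
  rate : D * (m * m) ≤ ε * suc F * N
  rate = cancelˡ (≤-trans (≤-trans m≥1 m≤N) N≤n) (begin
    n * (D * (m * m))  ≤⟨ *-monoˡ-≤ (D * (m * m)) (≤-trans n≤4dE (*-monoʳ-≤ (4 * d) (<⇒≤ E<))) ⟩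
    4 * d * (suc F * suc q) * (D * (m * m))  ≡⟨ id₃ (4 * d) (suc F) (suc q) (D * (m * m)) ⟩
    4 * d * suc F * (suc q * (D * (m * m)))  ≤⟨ *-monoʳ-≤ (4 * d * suc F) QDmm≤ ⟩
    4 * d * suc F * (5 * (N * N))  ≡⟨ id₄ (4 * d) 5 (suc F) N ⟩
    N * (4 * d * 5 * suc F * N)  ≤⟨ *-monoʳ-≤ N (*-monoˡ-≤ N (*-monoˡ-≤ (suc F) ε≥)) ⟩
    N * (ε * suc F * N)  ≤⟨ *-monoˡ-≤ (ε * suc F * N) N≤n ⟩
    n * (ε * suc F * N)  ∎)
    where
    id₃ : ∀ d f q r → d * (f * q) * r ≡ d * f * (q * r)
    id₃ = solve-∀
    id₄ : ∀ u v f N → u * f * (v * (N * N)) ≡ N * (u * v * f * N)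
    id₄ = solve-∀

-- In the capped case `D` is about `N / m`, so `D m²` is about `N m` and `F` is linear in `m`. The
-- lower bound on `m` absorbs the rounding in `suc F`.
capped-rate : ∀ m N ε D F → 1 ≤ N → 4 * ε ≤ m → N ≤ 2 * (D * m) → D * (m * m) ≤ ε * suc F * N →
  m ≤ 4 * ε * F
capped-rate m N ε D F N≥1 m-large N≤ rate = +-cancelʳ-≤ m _ _ (begin
  m + m  ≤⟨ +-mono-≤ m≤ m≤ ⟩
  2 * ε * suc F + 2 * ε * suc F  ≡⟨ id₁ ε F ⟩
  4 * ε * F + 4 * ε  ≤⟨ +-monoʳ-≤ (4 * ε * F) m-large ⟩
  4 * ε * F + m  ∎)
  where
  id₁ : ∀ ε F → 2 * ε * suc F + 2 * ε * suc F ≡ 4 * ε * F + 4 * ε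
  id₁ = solve-∀
  id₂ : ∀ D m → 2 * (D * m) * m ≡ 2 * (D * (m * m))
  id₂ = solve-∀
  id₃ : ∀ ε f N → 2 * (ε * f * N) ≡ N * (2 * ε * f)
  id₃ = solve-∀
  m≤ : m ≤ 2 * ε * suc F
  m≤ = cancelˡ N≥1 (begin
    N * m  ≤⟨ *-monoˡ-≤ m N≤ ⟩
    2 * (D * m) * m  ≡⟨ id₂ D m ⟩
    2 * (D * (m * m))  ≤⟨ *-monoʳ-≤ 2 rate ⟩
    2 * (ε * suc F * N)  ≡⟨ id₃ ε (suc F) N ⟩
    N * (2 * ε * suc F)  ∎)

-- With `D ≥ s / d` the exponent `F` is of order `s m² / n`, which is where `m² ≥ C n log n` is
-- used. The spare unit in `suc c` pays for the one in `suc F`.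
uncapped-rate : ∀ n m N d ε s D F c ℓ → 1 ≤ n → 1 ≤ d → 1 ≤ ε → 1 ≤ s → 1 ≤ ℓ → N ≤ n → s ≤ d * D →
  d * ε * suc c * n * ℓ ≤ m * m → D * (m * m) ≤ ε * suc F * N → s * c * ℓ ≤ F
uncapped-rate n m N d ε s D F c ℓ n≥1 d≥1 ε≥1 s≥1 ℓ≥1 N≤n s≤ m-large rate = s≤s⁻¹ (begin
  suc (s * c * ℓ)  ≤⟨ +-monoˡ-≤ (s * c * ℓ) (1≤* s≥1 ℓ≥1) ⟩
  s * ℓ + s * c * ℓ  ≡⟨ id₁ s c ℓ ⟩
  s * (suc c * ℓ)  ≤⟨ cancelˡ {d * ε * n} (1≤* (1≤* d≥1 ε≥1) n≥1) (begin
    d * ε * n * (s * (suc c * ℓ))  ≡⟨ id₂ d ε n s (suc c) ℓ ⟩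
    s * (d * ε * suc c * n * ℓ)  ≤⟨ *-mono-≤ s≤ m-large ⟩
    d * D * (m * m)  ≡⟨ *-assoc d D (m * m) ⟩
    d * (D * (m * m))  ≤⟨ *-monoʳ-≤ d rate ⟩
    d * (ε * suc F * N)  ≤⟨ *-monoʳ-≤ d (*-monoʳ-≤ (ε * suc F) N≤n) ⟩
    d * (ε * suc F * n)  ≡⟨ id₃ d ε (suc F) n ⟩
    d * ε * n * suc F  ∎) ⟩
  suc F  ∎)
  where
  id₁ : ∀ s c l → s * l + s * c * l ≡ s * (suc c * l)
  id₁ = solve-∀
  id₂ : ∀ d ε n s c l → d * ε * n * (s * (c * l)) ≡ s * (d * ε * c * n * l)
  id₂ = solve-∀
  id₃ : ∀ d ε f n → d * (ε * f * n) ≡ d * ε * n * f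
  id₃ = solve-∀

module NearState {n : ℕ} (𝓗 : TripleSystem n) (m b : ℕ) (P : Subset n → Set) (P? : ∀ I → Dec (P I))
  (P⇒Independent : ∀ I → P I → Triples.Independent 𝓗 I) where
  open Triples 𝓗
  open Weighted {n} m b
  open Tree P P?
  open Near 𝓗 m b P P? P⇒Independent

  module _ (k : ℕ) (B : VSet n) (S : Subset n) (m≥1 : 1 ≤ m) (b≥1 : 1 ≤ b) (N≤n : m + b ≤ n)
           (S≥1 : 1 ≤ card (lookup S)) (disj : Disjoint B (lookup S)) (B≤N : card B ≤ m + b)
           (links : ∀ v → lookup S v ≡ true → n ≤ k * link B v) where
    private
      N = m + b
      d = 2 * (k * Δ)
      s = card (lookup S)
      n≥1 : 1 ≤ n
      n≥1 = ≤-trans (≤-trans m≥1 (m≤m+n m b)) N≤n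

    -- Padding `|B|` up to `N`, at ratio `N / b ≥ 1`, makes the bound uniform over the members of
    -- the family.
    near-bound-in-N : ∀ D q E F → D * m ≤ N → 4 * (N * N) ≤ D * (m * m) * suc q → 1 ≤ q →
      (∀ c → s ≤ d * c → D ≤ c) → E * (2 * d) ≤ n → F * suc q ≤ E →
      Z B (lookup S) * b ^ N * 2 ^ F ≤ weight S * N ^ N
    near-bound-in-N D q E F Dm≤N large q≥1 D≤ E≤ F≤ = cancelʳ (1≤^ s b≥1) (begin
      Z₀ * b ^ N * 2 ^ F * b ^ s  ≡⟨ cong (λ t → Z₀ * t * 2 ^ F * b ^ s) (split b) ⟩
      Z₀ * (b ^ card B * b ^ r) * 2 ^ F * b ^ s  ≡⟨ id₁ Z₀ (b ^ card B) (b ^ r) (2 ^ F) (b ^ s) ⟩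
      Z₀ * b ^ s * b ^ card B * 2 ^ F * b ^ r  ≤⟨ *-mono-≤ (near-bound k B (lookup S) D q E F n≥1 S≥1 disj links b≥1 Dm≤N large q≥1 D≤ E≤ F≤) (^-monoˡ-≤ r (m≤n+m b m)) ⟩
      m ^ s * N ^ card B * b ^ n * N ^ r  ≡⟨ id₂ (m ^ s) (N ^ card B) (b ^ n) (N ^ r) ⟩
      m ^ s * b ^ n * (N ^ card B * N ^ r)  ≡⟨ cong₂ _*_ (weight-card S) (split N) ⟨
      weight S * b ^ s * N ^ N  ≡⟨ id₃ (weight S) (b ^ s) (N ^ N) ⟩
      weight S * N ^ N * b ^ s  ∎)
      where
      Z₀ = Z B (lookup S)
      r = proj₁ (≤⇒+ B≤N)
      split : ∀ x → x ^ N ≡ x ^ card B * x ^ r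
      split x = trans (cong (x ^_) (proj₂ (≤⇒+ B≤N))) (^-distribˡ-+-* x (card B) r)
      id₁ : ∀ z p r f s → z * (p * r) * f * s ≡ z * s * p * f * r
      id₁ = solve-∀
      id₂ : ∀ p q r s → p * q * r * s ≡ p * r * (q * s)
      id₂ = solve-∀
      id₃ : ∀ p q r → p * q * r ≡ p * r * q
      id₃ = solve-∀

    -- Capped `D` saves an exponential in `m`, enough to enumerate all `S` with `|S| ≤ m / δ̄` at
    -- once; uncapped `D` saves `n ^ (c |S|)`, enough to choose the vertices of `S` one by one. The
    -- factor 2 before `c` and `ℓ` compensates the floor in the logarithm.
    near-state : ∀ c ε ℓ → 1 ≤ d → 4 * d * 5 ≤ ε → 4 * d ≤ n → 4 * ε ≤ m → 1 ≤ ℓ → n ≤ 2 ^ (2 * ℓ) →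
      d * ε * suc (2 * c) * n * ℓ ≤ m * m →
      (∀ f → 4 * ε * f ≤ m → Z B (lookup S) * b ^ N * 2 ^ f ≤ weight S * N ^ N) ⊎
      Z B (lookup S) * b ^ N * n ^ (c * s) ≤ weight S * N ^ N
    near-state c ε ℓ d≥1 ε≥ 4d≤n m-large ℓ≥1 n≤ C-large =
      let D , q , E , F , Dm≤N , large , q≥1 , D≤ , E≤ , F≤ , rate , alternative =
            near-parameters n m N d s ε ε≥ m≥1 (m≤m+n m b) N≤n d≥1 S≥1 4d≤n
      in finish D F rate (near-bound-in-N D q E F Dm≤N large q≥1 D≤ E≤ F≤) alternative
      where
      ε≥1 : 1 ≤ ε
      ε≥1 = ≤-trans (1≤* (1≤* {4} (s≤s z≤n) d≥1) (s≤s z≤n)) ε≥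
      id₄ : ∀ l c s → 2 * l * (c * s) ≡ s * (2 * c) * l
      id₄ = solve-∀
      finish : ∀ D F → D * (m * m) ≤ ε * suc F * N → Z B (lookup S) * b ^ N * 2 ^ F ≤ weight S * N ^ N →
        N ≤ 2 * (D * m) ⊎ s ≤ d * D →
        (∀ f → 4 * ε * f ≤ m → Z B (lookup S) * b ^ N * 2 ^ f ≤ weight S * N ^ N) ⊎
        Z B (lookup S) * b ^ N * n ^ (c * s) ≤ weight S * N ^ N
      finish D F rate bound (inj₁ N≤) = inj₁ λ f h → ≤-trans (*-monoʳ-≤ (Z B (lookup S) * b ^ N) (^-mono-exp {2} {f} {F} (s≤s z≤n)
        (cancelˡ {4 * ε} (1≤* {4} (s≤s z≤n) ε≥1) (≤-trans h (capped-rate m N ε D F (≤-trans m≥1 (m≤m+n m b)) m-large N≤ rate))))) bound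
      finish D F rate bound (inj₂ s≤) = inj₂ (≤-trans (*-monoʳ-≤ (Z B (lookup S) * b ^ N) (begin
        n ^ (c * s)  ≤⟨ ^-monoˡ-≤ (c * s) n≤ ⟩
        (2 ^ (2 * ℓ)) ^ (c * s)  ≡⟨ ^-*-assoc 2 (2 * ℓ) (c * s) ⟩
        2 ^ (2 * ℓ * (c * s))  ≡⟨ cong (2 ^_) (id₄ ℓ c s) ⟩
        2 ^ (s * (2 * c) * ℓ)  ≤⟨ ^-mono-exp {2} {s * (2 * c) * ℓ} {F} (s≤s z≤n) (uncapped-rate n m N d ε s D F (2 * c) ℓ n≥1 d≥1 ε≥1 S≥1 ℓ≥1 N≤n s≤ C-large rate) ⟩
        2 ^ F  ∎)) bound)

total-weight : ∀ {n} a b → ∑ˢ (Weighted.weight {n} a b) ≡ (a + b) ^ n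
total-weight {n} a b = trans (∑ˢ-∏ {n} (λ _ i → if i then a else b)) (trans (∏-const n (b + a)) (cong (_^ n) (+-comm b a)))

module NearMass {n : ℕ} (𝓗 : TripleSystem n) (ℬ : Subset n → Bool) (m b : ℕ)
  (P : Subset n → Set) (P? : ∀ I → Dec (P I))
  (P⇒Independent : ∀ I → P I → Triples.Independent 𝓗 I)
  (δ̄ : ℕ) (P⇒near : ∀ I → P I → ∃ λ B → ℬ B ≡ true × 1 ≤ card (lookup I ∖ lookup B) × δ̄ * card (lookup I ∖ lookup B) ≤ m) where
  open Triples 𝓗
  open Weighted {n} m b
  open Tree P P?
  open NearState 𝓗 m b P P? P⇒Independent
  private N = m + b

  Admissible : Subset n → Subset n → Set
  Admissible B S = ℬ B ≡ true × 1 ≤ card (lookup S) × Disjoint (lookup B) (lookup S) × δ̄ * card (lookup S) ≤ m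

  admissible? : ∀ B S → Dec (Admissible B S)
  admissible? B S = (ℬ B Bool.≟ true) ×-dec (1 ≤? card (lookup S)) ×-dec
    all? (λ x → (lookup B x Bool.≟ true) →-dec (lookup S x Bool.≟ false)) ×-dec (δ̄ * card (lookup S) ≤? m)

  mass-by-exception : mass P? ≤ ∑ˢ (λ B → ∑ˢ (λ S → 𝟙 (does (admissible? B S)) * Z (lookup B) (lookup S)))
  mass-by-exception = begin
    mass P?  ≤⟨ mass-union P? near? (λ I p → let B , B∈ℬ , _ , small = P⇒near I p in B , p , B∈ℬ , proj₁ (proj₂ (proj₂ (P⇒near I p))) , small) ⟩
    ∑ˢ (λ B → mass (near? B))  ≤⟨ ∑ˢ-mono (λ B → mass-union (near? B) (state? B) (exception B)) ⟩
    ∑ˢ (λ B → ∑ˢ (λ S → mass (state? B S)))  ≤⟨ ∑ˢ-mono (λ B → ∑ˢ-mono (λ S → factor B S)) ⟩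
    ∑ˢ (λ B → ∑ˢ (λ S → 𝟙 (does (admissible? B S)) * Z (lookup B) (lookup S))) ∎
    where
    Near : Subset n → Subset n → Set
    Near B I = P I × ℬ B ≡ true × 1 ≤ card (lookup I ∖ lookup B) × δ̄ * card (lookup I ∖ lookup B) ≤ m
    near? : ∀ B I → Dec (Near B I)
    near? B I = P? I ×-dec (ℬ B Bool.≟ true) ×-dec (1 ≤? card (lookup I ∖ lookup B)) ×-dec (δ̄ * card (lookup I ∖ lookup B) ≤? m)
    state? : ∀ B S I → Dec (Admissible B S × InState (lookup B) (lookup S) I)
    state? B S I = admissible? B S ×-dec inState? (lookup B) (lookup S) I
    exception : ∀ B I → Near B I → ∃ λ S → Admissible B S × InState (lookup B) (lookup S) I
    exception B I (p , B∈ℬ , nonempty , small) = S , (B∈ℬ , subst (1 ≤_) cardS nonempty , disj , subst (λ t → δ̄ * t ≤ m) cardS small) , p , S⊆I , I⊆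
      where
      S = tabulate (lookup I ∖ lookup B)
      S≡ : ∀ x → lookup S x ≡ (lookup I ∖ lookup B) x
      S≡ = lookup∘tabulate (lookup I ∖ lookup B)
      cardS : card (lookup I ∖ lookup B) ≡ card (lookup S)
      cardS = card-cong (λ x → sym (S≡ x))
      disj : Disjoint (lookup B) (lookup S)
      disj x x∈B = trans (S≡ x) (trans (cong (λ t → lookup I x ∧ not t) x∈B) (∧-zeroʳ (lookup I x)))
      S⊆I : ∀ x → lookup S x ≡ true → lookup I x ≡ true
      S⊆I x x∈S = proj₁ (∧-split (trans (sym (S≡ x)) x∈S))
      or-not : ∀ i β → i ≡ true → (i ∧ not β) ∨ β ≡ true
      or-not true true  _ = refl
      or-not true false _ = refl
      I⊆ : ∀ x → lookup I x ≡ true → lookup S x ∨ lookup B x ≡ true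
      I⊆ x x∈I = trans (cong (_∨ lookup B x) (S≡ x)) (or-not (lookup I x) (lookup B x) x∈I)
    factor : ∀ B S → mass (state? B S) ≤ 𝟙 (does (admissible? B S)) * Z (lookup B) (lookup S)
    factor B S = ≤-reflexive (trans (∑ˢ-cong (λ I → trans (cong (_* weight I) (𝟙-∧ (does (admissible? B S)) (does (inState? (lookup B) (lookup S) I))))
                                       (*-assoc (𝟙 (does (admissible? B S))) _ (weight I))))
      (sym (∑ˢ-*ˡ (𝟙 (does (admissible? B S))) (λ I → 𝟙 (does (inState? (lookup B) (lookup S) I)) * weight I))))

  module _ (k c ε ℓ X j f w : ℕ) (m≥1 : 1 ≤ m) (b≥1 : 1 ≤ b) (X≥1 : 1 ≤ X) (N≤n : N ≤ n)
    (d≥1 : 1 ≤ 2 * (k * Δ)) (ε≥ : 4 * (2 * (k * Δ)) * 5 ≤ ε) (4d≤n : 4 * (2 * (k * Δ)) ≤ n) (m-large : 4 * ε ≤ m)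
    (ℓ≥1 : 1 ≤ ℓ) (n≤ : n ≤ 2 ^ (2 * ℓ)) (C-large : 2 * (k * Δ) * ε * suc (2 * (2 + c)) * n * ℓ ≤ m * m)
    (Bound : ∀ B → ℬ B ≡ true → card (lookup B) ≤ N)
    (links : ∀ B → ℬ B ≡ true → ∀ v → lookup B v ≡ false → n ≤ k * link (lookup B) v)
    (f≤ : 4 * ε * f ≤ m) (j≥ : ∀ s → δ̄ * s ≤ m → s ≤ j)
    (saving : w * ((b * X + m) ^ n * X ^ j) ≤ (b * X) ^ n * 2 ^ f)
    (poly : w * 4 ≤ n ^ c) where
    private
      G = N ^ N * b ^ n
      -- `M₁` and `M₂` are the denominators of the capped and the uncapped estimate. Both are
      -- carried along so that `R₁` and `R₂` can be added.
      M₁ = (b * X) ^ n * 2 ^ f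
      M₂ = n ^ c * n ^ n
      weight′ = Weighted.weight {n} m (b * X)
      weight″ = Weighted.weight {n} 1 n
      R₁ R₂ : Subset n → ℕ
      R₁ S = weight′ S * (w * X ^ j * G * M₂)
      R₂ S = weight″ S * (w * G * M₁)
      n≥1 : 1 ≤ n
      n≥1 = ≤-trans (≤-trans m≥1 (m≤m+n m b)) N≤n

    -- As `|S| ≤ j`, each vertex of `S` may be discounted by `X` at a total cost of `X ^ j`. Summing
    -- `weight′` over all `S` then replaces a tail of binomial coefficients by `(b X + m) ^ n`.
    dense-exception : ∀ S Z₀ → δ̄ * card (lookup S) ≤ m → Z₀ * b ^ N * 2 ^ f ≤ weight S * N ^ N →
      w * Z₀ * b ^ N * (M₁ * M₂) ≤ R₁ S
    dense-exception S Z₀ small bound = begin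
      w * Z₀ * b ^ N * ((b * X) ^ n * 2 ^ f * M₂)  ≡⟨ cong (λ t → w * Z₀ * b ^ N * (t * 2 ^ f * M₂)) (*-^ b X n) ⟩
      w * Z₀ * b ^ N * (b ^ n * X ^ n * 2 ^ f * M₂)  ≡⟨ id₁ w Z₀ (b ^ N) (b ^ n) (X ^ n) (2 ^ f) M₂ ⟩
      Z₀ * b ^ N * 2 ^ f * (w * b ^ n * X ^ n * M₂)  ≤⟨ *-monoˡ-≤ (w * b ^ n * X ^ n * M₂) bound ⟩
      weight S * N ^ N * (w * b ^ n * X ^ n * M₂)  ≡⟨ id₂ (weight S) (N ^ N) w (b ^ n) (X ^ n) M₂ ⟩
      weight S * X ^ n * (w * (N ^ N * b ^ n) * M₂)  ≤⟨ *-monoˡ-≤ (w * G * M₂) ω≤ ⟩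
      weight′ S * X ^ j * (w * G * M₂)  ≡⟨ id₃ (weight′ S) (X ^ j) w G M₂ ⟩
      weight′ S * (w * X ^ j * G * M₂)  ∎
      where
      s = card (lookup S)
      id₁ : ∀ w z bN bn Xn f M → w * z * bN * (bn * Xn * f * M) ≡ z * bN * f * (w * bn * Xn * M)
      id₁ = solve-∀
      id₂ : ∀ o NN w bn Xn M → o * NN * (w * bn * Xn * M) ≡ o * Xn * (w * (NN * bn) * M)
      id₂ = solve-∀
      id₃ : ∀ o x w G M → o * x * (w * G * M) ≡ o * (w * x * G * M)
      id₃ = solve-∀
      id₄ : ∀ p q r → p * q * r ≡ p * r * q
      id₄ = solve-∀
      id₅ : ∀ o p q → o * (p * q) ≡ o * q * p
      id₅ = solve-∀
      ω≤ : weight S * X ^ n ≤ weight′ S * X ^ j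
      ω≤ = ≤-trans (cancelʳ (1≤^ s b≥1) (begin
        weight S * X ^ n * b ^ s  ≡⟨ id₄ (weight S) (X ^ n) (b ^ s) ⟩
        weight S * b ^ s * X ^ n  ≡⟨ cong (_* X ^ n) (weight-card S) ⟩
        m ^ s * b ^ n * X ^ n  ≡⟨ *-assoc (m ^ s) _ _ ⟩
        m ^ s * (b ^ n * X ^ n)  ≡⟨ cong (m ^ s *_) (*-^ b X n) ⟨
        m ^ s * (b * X) ^ n  ≡⟨ Weighted.weight-card m (b * X) S ⟨
        weight′ S * (b * X) ^ s  ≡⟨ cong (weight′ S *_) (*-^ b X s) ⟩
        weight′ S * (b ^ s * X ^ s)  ≡⟨ id₅ (weight′ S) (b ^ s) (X ^ s) ⟩
        weight′ S * X ^ s * b ^ s  ∎)) (*-monoʳ-≤ (weight′ S) (^-mono-exp X≥1 (j≥ s small)))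

    -- Of the `2 + c` factors `n ^ s`, one covers the weight of `S`, one the choice of `S` (summing
    -- `n ^ (-|S|)` over all `S` gives `(1 + 1/n)^n ≤ 4`), and the rest, at least `n ^ c` as
    -- `s ≥ 1`, cover `w`.
    sparse-exception : ∀ S Z₀ → 1 ≤ card (lookup S) → Z₀ * b ^ N * n ^ ((2 + c) * card (lookup S)) ≤ weight S * N ^ N →
      w * Z₀ * b ^ N * (M₁ * M₂) ≤ R₂ S
    sparse-exception S Z₀ s≥1 bound = begin
      w * Z₀ * b ^ N * (M₁ * (n ^ c * n ^ n))  ≡⟨ id₁ w Z₀ (b ^ N) M₁ (n ^ c) (n ^ n) ⟩
      Z₀ * b ^ N * n ^ c * n ^ n * (w * M₁)  ≡⟨ cong (λ t → Z₀ * b ^ N * n ^ c * t * (w * M₁)) ω″ ⟨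
      Z₀ * b ^ N * n ^ c * (weight″ S * n ^ s) * (w * M₁)  ≡⟨ id₂ (Z₀ * b ^ N * n ^ c) (weight″ S) (n ^ s) (w * M₁) ⟩
      Z₀ * b ^ N * n ^ c * n ^ s * (weight″ S * (w * M₁))  ≤⟨ *-monoˡ-≤ (weight″ S * (w * M₁)) main ⟩
      G * (weight″ S * (w * M₁))  ≡⟨ id₃ G (weight″ S) w M₁ ⟩
      weight″ S * (w * G * M₁)  ∎
      where
      s = card (lookup S)
      id₁ : ∀ w z p M q r → w * z * p * (M * (q * r)) ≡ z * p * q * r * (w * M)
      id₁ = solve-∀
      id₂ : ∀ p o s r → p * (o * s) * r ≡ p * s * (o * r)
      id₂ = solve-∀
      id₃ : ∀ G o w M → G * (o * (w * M)) ≡ o * (w * G * M)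
      id₃ = solve-∀
      ω″ : weight″ S * n ^ s ≡ n ^ n
      ω″ = trans (Weighted.weight-card 1 n S) (trans (cong (_* n ^ n) (^-zeroˡ s)) (*-identityˡ (n ^ n)))
      ω≤ : weight S ≤ n ^ s * b ^ n
      ω≤ = begin
        weight S  ≡⟨ *-identityʳ (weight S) ⟨
        weight S * 1  ≤⟨ *-monoʳ-≤ (weight S) (1≤^ s b≥1) ⟩
        weight S * b ^ s  ≡⟨ weight-card S ⟩
        m ^ s * b ^ n  ≤⟨ *-monoˡ-≤ (b ^ n) (^-monoˡ-≤ s (≤-trans (m≤m+n m b) N≤n)) ⟩
        n ^ s * b ^ n  ∎
      exponent : c + s + s ≤ (2 + c) * s
      exponent = begin
        c + s + s  ≤⟨ +-monoˡ-≤ s (+-monoˡ-≤ s (≤-trans (≤-reflexive (sym (*-identityʳ c))) (*-monoʳ-≤ c s≥1))) ⟩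
        c * s + s + s  ≡⟨ id₄ c s ⟩
        (2 + c) * s  ∎
        where
        id₄ : ∀ c s → c * s + s + s ≡ (2 + c) * s
        id₄ = solve-∀
      main : Z₀ * b ^ N * n ^ c * n ^ s ≤ G
      main = cancelʳ (1≤^ s n≥1) (begin
        Z₀ * b ^ N * n ^ c * n ^ s * n ^ s  ≡⟨ id₅ (Z₀ * b ^ N) (n ^ c) (n ^ s) ⟩
        Z₀ * b ^ N * (n ^ c * n ^ s * n ^ s)  ≡⟨ cong (Z₀ * b ^ N *_) (trans (^-distribˡ-+-* n (c + s) s) (cong (_* n ^ s) (^-distribˡ-+-* n c s))) ⟨
        Z₀ * b ^ N * n ^ (c + s + s)  ≤⟨ *-monoʳ-≤ (Z₀ * b ^ N) (^-mono-exp n≥1 exponent) ⟩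
        Z₀ * b ^ N * n ^ ((2 + c) * s)  ≤⟨ bound ⟩
        weight S * N ^ N  ≤⟨ *-monoˡ-≤ (N ^ N) ω≤ ⟩
        n ^ s * b ^ n * N ^ N  ≡⟨ id₆ (n ^ s) (b ^ n) (N ^ N) ⟩
        G * n ^ s  ∎)
        where
        id₅ : ∀ p q r → p * q * r * r ≡ p * (q * r * r)
        id₅ = solve-∀
        id₆ : ∀ p q r → p * q * r ≡ r * q * p
        id₆ = solve-∀

    exceptions-total : ∀ B → w * ∑ˢ (λ S → 𝟙 (does (admissible? B S)) * Z (lookup B) (lookup S)) * b ^ N ≤ 𝟙 (ℬ B) * (2 * G)
    exceptions-total B = cancelʳ {M₁ * M₂} (1≤* (1≤* (1≤^ n (1≤* b≥1 X≥1)) (1≤^ f (s≤s {n = 1} z≤n))) (1≤* (1≤^ c n≥1) (1≤^ n n≥1))) (begin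
      w * ∑ˢ term * b ^ N * (M₁ * M₂)  ≡⟨ id₁ w (∑ˢ term) (b ^ N) (M₁ * M₂) ⟩
      ∑ˢ term * (w * b ^ N * (M₁ * M₂))  ≡⟨ ∑ˢ-*ʳ term (w * b ^ N * (M₁ * M₂)) ⟩
      ∑ˢ (λ S → term S * (w * b ^ N * (M₁ * M₂)))  ≤⟨ ∑ˢ-mono pointwise ⟩
      ∑ˢ (λ S → 𝟙 (ℬ B) * (R₁ S + R₂ S))  ≡⟨ ∑ˢ-*ˡ (𝟙 (ℬ B)) (λ S → R₁ S + R₂ S) ⟨
      𝟙 (ℬ B) * ∑ˢ (λ S → R₁ S + R₂ S)  ≡⟨ cong (𝟙 (ℬ B) *_) (∑ˢ-+ R₁ R₂) ⟩
      𝟙 (ℬ B) * (∑ˢ R₁ + ∑ˢ R₂)  ≤⟨ *-monoʳ-≤ (𝟙 (ℬ B)) (+-mono-≤ sum₁ sum₂) ⟩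
      𝟙 (ℬ B) * (G * (M₁ * M₂) + G * (M₁ * M₂))  ≡⟨ id₂ (𝟙 (ℬ B)) G (M₁ * M₂) ⟩
      𝟙 (ℬ B) * (2 * G) * (M₁ * M₂)  ∎)
      where
      term : Subset n → ℕ
      term S = 𝟙 (does (admissible? B S)) * Z (lookup B) (lookup S)
      id₁ : ∀ w t p M → w * t * p * M ≡ t * (w * p * M)
      id₁ = solve-∀
      id₂ : ∀ i G M → i * (G * M + G * M) ≡ i * (2 * G) * M
      id₂ = solve-∀
      id₃ : ∀ z w p M → z * (w * p * M) ≡ w * z * p * M
      id₃ = solve-∀
      pointwise : ∀ S → term S * (w * b ^ N * (M₁ * M₂)) ≤ 𝟙 (ℬ B) * (R₁ S + R₂ S)
      pointwise S = ≤-trans (≤-reflexive (*-assoc (𝟙 (does (admissible? B S))) (Z (lookup B) (lookup S)) _))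
        (𝟙*-≤ (admissible? B S) λ { (B∈ℬ , s≥1 , disj , small) →
          ≤-trans (≤-trans (≤-reflexive (id₃ (Z (lookup B) (lookup S)) w (b ^ N) (M₁ * M₂))) (classified B∈ℬ s≥1 disj small))
                  (≤-reflexive (sym (trans (cong (λ i → 𝟙 i * (R₁ S + R₂ S)) B∈ℬ) (*-identityˡ _)))) })
        where
        classified : ℬ B ≡ true → 1 ≤ card (lookup S) → Disjoint (lookup B) (lookup S) → δ̄ * card (lookup S) ≤ m →
          w * Z (lookup B) (lookup S) * b ^ N * (M₁ * M₂) ≤ R₁ S + R₂ S
        classified B∈ℬ s≥1 disj small =
          [ (λ dense → ≤-trans (dense-exception S (Z (lookup B) (lookup S)) small (dense f f≤)) (m≤m+n (R₁ S) (R₂ S)))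
          , (λ sparse → ≤-trans (sparse-exception S (Z (lookup B) (lookup S)) s≥1 sparse) (m≤n+m (R₂ S) (R₁ S)))
          ]′ (near-state k (lookup B) S m≥1 b≥1 N≤n s≥1 disj (Bound B B∈ℬ)
                (λ v v∈S → links B B∈ℬ v (¬-not (λ v∈B → true≢false v∈S (disj v v∈B))))
                (2 + c) ε ℓ d≥1 ε≥ 4d≤n m-large ℓ≥1 n≤ C-large)
      sum₁ : ∑ˢ R₁ ≤ G * (M₁ * M₂)
      sum₁ = begin
        ∑ˢ R₁  ≡⟨ ∑ˢ-*ʳ weight′ (w * X ^ j * G * M₂) ⟨
        ∑ˢ weight′ * (w * X ^ j * G * M₂)  ≡⟨ cong (_* (w * X ^ j * G * M₂)) (trans (total-weight {n} m (b * X)) (cong (_^ n) (+-comm m (b * X)))) ⟩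
        (b * X + m) ^ n * (w * X ^ j * G * M₂)  ≡⟨ id₄ ((b * X + m) ^ n) w (X ^ j) G M₂ ⟩
        w * ((b * X + m) ^ n * X ^ j) * (G * M₂)  ≤⟨ *-monoˡ-≤ (G * M₂) saving ⟩
        M₁ * (G * M₂)  ≡⟨ id₅ M₁ G M₂ ⟩
        G * (M₁ * M₂)  ∎
        where
        id₄ : ∀ y w x G M → y * (w * x * G * M) ≡ w * (y * x) * (G * M)
        id₄ = solve-∀
        id₅ : ∀ p q r → p * (q * r) ≡ q * (p * r)
        id₅ = solve-∀
      sum₂ : ∑ˢ R₂ ≤ G * (M₁ * M₂)
      sum₂ = begin
        ∑ˢ R₂  ≡⟨ ∑ˢ-*ʳ weight″ (w * G * M₁) ⟨
        ∑ˢ weight″ * (w * G * M₁)  ≡⟨ cong (_* (w * G * M₁)) (trans (total-weight {n} 1 n) (cong (_^ n) (+-comm 1 n))) ⟩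
        (n + 1) ^ n * (w * G * M₁)  ≤⟨ *-monoˡ-≤ (w * G * M₁) ([1+1/q]^q≤4 n) ⟩
        4 * n ^ n * (w * G * M₁)  ≡⟨ id₆ 4 (n ^ n) w G M₁ ⟩
        w * 4 * (n ^ n * (G * M₁))  ≤⟨ *-monoˡ-≤ (n ^ n * (G * M₁)) poly ⟩
        n ^ c * (n ^ n * (G * M₁))  ≡⟨ id₇ (n ^ c) (n ^ n) G M₁ ⟩
        G * (M₁ * M₂)  ∎
        where
        id₆ : ∀ q p w G M → q * p * (w * G * M) ≡ w * q * (p * (G * M))
        id₆ = solve-∀
        id₇ : ∀ c n G M → c * (n * (G * M)) ≡ G * (M * (c * n))
        id₇ = solve-∀

    near-mass : ∀ F v → 1 ≤ F → ∑ˢ (𝟙 ∘ ℬ) ≤ F → w ≡ 2 * F * v → v * (b ^ N * mass P?) ≤ N ^ N * b ^ n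
    near-mass F v F≥1 size w≡ = cancelˡ {2 * F} (1≤* {2} (s≤s z≤n) F≥1) (begin
      2 * F * (v * (b ^ N * mass P?))  ≡⟨ id₁ (2 * F) v (b ^ N) (mass P?) ⟩
      mass P? * (2 * F * v * b ^ N)  ≡⟨ cong (λ t → mass P? * (t * b ^ N)) w≡ ⟨
      mass P? * (w * b ^ N)  ≤⟨ *-monoˡ-≤ (w * b ^ N) mass-by-exception ⟩
      ∑ˢ (λ B → ∑ˢ (term B)) * (w * b ^ N)  ≡⟨ ∑ˢ-*ʳ (λ B → ∑ˢ (term B)) (w * b ^ N) ⟩
      ∑ˢ (λ B → ∑ˢ (term B) * (w * b ^ N))  ≤⟨ ∑ˢ-mono (λ B → ≤-trans (≤-reflexive (id₂ (∑ˢ (term B)) w (b ^ N))) (exceptions-total B)) ⟩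
      ∑ˢ (λ B → 𝟙 (ℬ B) * (2 * G))  ≡⟨ ∑ˢ-*ʳ (𝟙 ∘ ℬ) (2 * G) ⟨
      ∑ˢ (𝟙 ∘ ℬ) * (2 * G)  ≤⟨ *-monoˡ-≤ (2 * G) size ⟩
      F * (2 * G)  ≡⟨ id₃ F G ⟩
      2 * F * G  ∎)
      where
      term : Subset n → Subset n → ℕ
      term B S = 𝟙 (does (admissible? B S)) * Z (lookup B) (lookup S)
      id₁ : ∀ p v q r → p * (v * (q * r)) ≡ r * (p * v * q)
      id₁ = solve-∀
      id₂ : ∀ p w q → p * (w * q) ≡ w * p * q
      id₂ = solve-∀
      id₃ : ∀ F G → F * (2 * G) ≡ 2 * F * G
      id₃ = solve-∀

-- Binomial coefficients

-- The absorption identity `(k + 1) C(n, k + 1) = (n - k) C(n, k)` with the negative term moved to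
-- the left, so it holds for `k > n` too.
C-absorb : ∀ n k → suc k * n choose suc k + k * n choose k ≡ n * n choose k
C-absorb zero    k = trans (cong₂ _+_ (trans (cong (suc k *_) (k>n⇒nCk≡0 {0} {suc k} (s≤s z≤n))) (*-zeroʳ k)) (vanish k)) refl
  where
  vanish : ∀ k → k * 0 choose k ≡ 0
  vanish zero    = refl
  vanish (suc k) = trans (cong (suc k *_) (k>n⇒nCk≡0 {0} {suc k} (s≤s z≤n))) (*-zeroʳ (suc k))
C-absorb (suc n) zero = trans (trans (+-identityʳ _) (*-identityˡ _)) (trans (nC1≡n (suc n)) (sym (*-identityʳ (suc n))))
C-absorb (suc n) (suc k) = begin-equality
  suc (suc k) * suc n choose suc (suc k) + suc k * suc n choose suc k
    ≡⟨ cong₂ (λ s t → suc (suc k) * s + suc k * t) (nCk+nC[k+1]≡[n+1]C[k+1] n (suc k)) (nCk+nC[k+1]≡[n+1]C[k+1] n k) ⟨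
  suc (suc k) * (y + z) + suc k * (x + y)  ≡⟨ id₁ k x y z ⟩
  (suc (suc k) * z + suc k * y) + y + (suc k * y + k * x) + x  ≡⟨ cong₂ (λ s t → s + y + t + x) (C-absorb n (suc k)) (C-absorb n k) ⟩
  n * y + y + n * x + x  ≡⟨ id₂ n x y ⟩
  suc n * (x + y)  ≡⟨ cong (suc n *_) (nCk+nC[k+1]≡[n+1]C[k+1] n k) ⟩
  suc n * suc n choose suc k  ∎
  where
  x = n choose k
  y = n choose suc k
  z = n choose suc (suc k)
  id₁ : ∀ k x y z → suc (suc k) * (y + z) + suc k * (x + y) ≡ (suc (suc k) * z + suc k * y) + y + (suc k * y + k * x) + x
  id₁ = solve-∀
  id₂ : ∀ n x y → n * y + y + n * x + x ≡ suc n * (x + y)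
  id₂ = solve-∀

module _ (a b : ℕ) where

  private
    -- A term of the binomial expansion of `(a + b) ^ (j + i)`, indexed by both exponents to avoid
    -- subtraction.
    T : ℕ → ℕ → ℕ
    T j i = (j + i) choose j * (a ^ j * b ^ i)

    ratio : ∀ j i → suc j * (suc (j + i) choose suc j) ≡ suc i * (suc (j + i) choose j)
    ratio j i = +-cancelʳ-≡ (j * (suc (j + i) choose j)) _ _ (trans (C-absorb (suc (j + i)) j) (id₁ j i (suc (j + i) choose j)))
      where
      id₁ : ∀ j i c → suc (j + i) * c ≡ suc i * c + j * c
      id₁ = solve-∀

    rise : ∀ j i → suc j * b ≤ suc i * a → T j (suc i) ≤ T (suc j) i
    rise j i h = cancelˡ {suc j} (s≤s z≤n) (begin
      suc j * ((j + suc i) choose j * (a ^ j * (b * b ^ i)))  ≡⟨ cong (λ t → suc j * (t choose j * (a ^ j * (b * b ^ i)))) (+-suc j i) ⟩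
      suc j * (c * (a ^ j * (b * b ^ i)))  ≡⟨ id₁ (suc j) c (a ^ j) b (b ^ i) ⟩
      suc j * b * (c * (a ^ j * b ^ i))  ≤⟨ *-monoˡ-≤ (c * (a ^ j * b ^ i)) h ⟩
      suc i * a * (c * (a ^ j * b ^ i))  ≡⟨ id₂ (suc i) a c (a ^ j) (b ^ i) ⟩
      suc i * c * (a * a ^ j * b ^ i)  ≡⟨ cong (_* (a * a ^ j * b ^ i)) (ratio j i) ⟨
      suc j * c′ * (a * a ^ j * b ^ i)  ≡⟨ *-assoc (suc j) c′ _ ⟩
      suc j * (c′ * (a * a ^ j * b ^ i))  ∎)
      where
      c = suc (j + i) choose j
      c′ = suc (j + i) choose suc j
      id₁ : ∀ s c A b B → s * (c * (A * (b * B))) ≡ s * b * (c * (A * B))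
      id₁ = solve-∀
      id₂ : ∀ s a c A B → s * a * (c * (A * B)) ≡ s * c * (a * A * B)
      id₂ = solve-∀

    fall : ∀ j i → suc i * a ≤ suc j * b → T (suc j) i ≤ T j (suc i)
    fall j i h = cancelˡ {suc j} (s≤s z≤n) (begin
      suc j * (c′ * (a * a ^ j * b ^ i))  ≡⟨ *-assoc (suc j) c′ _ ⟨
      suc j * c′ * (a * a ^ j * b ^ i)  ≡⟨ cong (_* (a * a ^ j * b ^ i)) (ratio j i) ⟩
      suc i * c * (a * a ^ j * b ^ i)  ≡⟨ id₂ (suc i) a c (a ^ j) (b ^ i) ⟨
      suc i * a * (c * (a ^ j * b ^ i))  ≤⟨ *-monoˡ-≤ (c * (a ^ j * b ^ i)) h ⟩
      suc j * b * (c * (a ^ j * b ^ i))  ≡⟨ id₁ (suc j) c (a ^ j) b (b ^ i) ⟨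
      suc j * (c * (a ^ j * (b * b ^ i)))  ≡⟨ cong (λ t → suc j * (t choose j * (a ^ j * (b * b ^ i)))) (+-suc j i) ⟨
      suc j * ((j + suc i) choose j * (a ^ j * (b * b ^ i)))  ∎)
      where
      c = suc (j + i) choose j
      c′ = suc (j + i) choose suc j
      id₁ : ∀ s c A b B → s * (c * (A * (b * B))) ≡ s * b * (c * (A * B))
      id₁ = solve-∀
      id₂ : ∀ s a c A B → s * a * (c * (A * B)) ≡ s * c * (a * A * B)
      id₂ = solve-∀

    rising : ∀ d j → j + d ≡ a → T j (b + d) ≤ T a b
    rising zero    j eq = ≤-reflexive (cong₂ T (trans (sym (+-identityʳ j)) eq) (+-identityʳ b))
    rising (suc d) j eq = subst (λ t → T j t ≤ T a b) (sym (+-suc b d)) (≤-trans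
      (rise j (b + d) (≤-trans (*-mono-≤ j<a (≤-trans (m≤m+n b d) (n≤1+n (b + d)))) (≤-reflexive (*-comm a (suc (b + d))))))
      (rising d (suc j) (trans (sym (+-suc j d)) eq)))
      where
      j<a : suc j ≤ a
      j<a = ≤-trans (m≤m+n (suc j) d) (≤-reflexive (trans (sym (+-suc j d)) eq))

    falling : ∀ d i → d + i ≡ b → T (a + d) i ≤ T a b
    falling zero    i eq = ≤-reflexive (cong₂ T (+-identityʳ a) eq)
    falling (suc d) i eq = subst (λ t → T t i ≤ T a b) (sym (+-suc a d)) (≤-trans
      (fall (a + d) i (≤-trans (*-mono-≤ i<b (≤-trans (m≤m+n a d) (n≤1+n (a + d)))) (≤-reflexive (*-comm b (suc (a + d))))))
      (falling d (suc i) (trans (+-suc d i) eq)))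
      where
      i<b : suc i ≤ b
      i<b = ≤-trans (m≤n+m (suc i) d) (≤-reflexive (trans (+-suc d i) eq))

    -- The ratio of `T (suc j) i` to `T j (suc i)` is `(i + 1) a / ((j + 1) b)`, at least 1 before
    -- `(a , b)` and at most 1 after it. Hence the choice `b = ‖ℬ‖ - m`: it makes size `m` the
    -- heaviest layer.
    modal : ∀ j i → j + i ≡ a + b → T j i ≤ T a b
    modal j i eq with ≤-total j a
    ... | inj₁ j≤a with ≤⇒+ j≤a
    ...   | d , refl = subst (λ t → T j t ≤ T a b) (+-cancelˡ-≡ j _ _ (trans (id₁ j b d) (sym eq))) (rising d j refl)
      where
      id₁ : ∀ j b d → j + (b + d) ≡ j + d + b
      id₁ = solve-∀
    modal j i eq | inj₂ a≤j with ≤⇒+ a≤j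
    ...   | d , refl = falling d i (+-cancelˡ-≡ a _ _ (trans (sym (+-assoc a d i)) eq))

    ^′≡^ : ∀ x k → x ^′ k ≡ x ^ k
    ^′≡^ x zero    = refl
    ^′≡^ x (suc k) = cong (x *_) (^′≡^ x k)

    ·≡* : ∀ k x → k · x ≡ k * x
    ·≡* zero    x = refl
    ·≡* (suc k) x = cong (x +_) (·≡* k x)

  modal-term : (a + b) ^ (a + b) ≤ suc (a + b) * ((a + b) choose a * (a ^ a * b ^ b))
  modal-term = begin
    N ^ N  ≡⟨ ^′≡^ N N ⟨
    N ^′ N  ≡⟨ Binomial.theorem +-*-commutativeSemiring N a b ⟩
    sum (Binomial.binomialTerm +-*-commutativeSemiring a b N)  ≤⟨ sum-mono term≤ ⟩
    sum {suc N} (λ _ → T a b)  ≡⟨ sum-const (suc N) (T a b) ⟩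
    suc N * T a b  ∎
    where
    N = a + b
    term≤ : ∀ k → Binomial.binomialTerm +-*-commutativeSemiring a b N k ≤ T a b
    term≤ k = begin
      (N choose toℕ k) · (a ^′ toℕ k * b ^′ (N ∸ toℕ k))  ≡⟨ ·≡* (N choose toℕ k) _ ⟩
      N choose toℕ k * (a ^′ toℕ k * b ^′ (N ∸ toℕ k))  ≡⟨ cong₂ (λ s t → N choose toℕ k * (s * t)) (^′≡^ a (toℕ k)) (^′≡^ b (N ∸ toℕ k)) ⟩
      N choose toℕ k * (a ^ toℕ k * b ^ (N ∸ toℕ k))  ≡⟨ cong (λ t → t choose toℕ k * (a ^ toℕ k * b ^ (N ∸ toℕ k))) split ⟨
      T (toℕ k) (N ∸ toℕ k)  ≤⟨ modal (toℕ k) (N ∸ toℕ k) split ⟩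
      T a b  ∎
      where
      split : toℕ k + (N ∸ toℕ k) ≡ N
      split = m+[n∸m]≡n (s≤s⁻¹ (toℕ<n k))

C-mono : ∀ {N M} k → N ≤ M → N choose k ≤ M choose k
C-mono {N} k N≤M with ≤⇒+ N≤M
... | d , refl = go d
  where
  step : ∀ n k → n choose k ≤ suc n choose k
  step n zero    = ≤-refl
  step n (suc k) = ≤-trans (m≤n+m (n choose suc k) (n choose k)) (≤-reflexive (nCk+nC[k+1]≡[n+1]C[k+1] n k))
  go : ∀ d → N choose k ≤ (N + d) choose k
  go zero    = ≤-reflexive (cong (_choose k) (sym (+-identityʳ N)))
  go (suc d) = ≤-trans (go d) (≤-trans (step (N + d) k) (≤-reflexive (cong (_choose k) (sym (+-suc N d)))))

∣∣≡card : ∀ {n} (A : Subset n) → ∣ A ∣ ≡ card (lookup A)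
∣∣≡card []            = refl
∣∣≡card (outside ∷ A) = ∣∣≡card A
∣∣≡card (inside ∷ A)  = cong suc (∣∣≡card A)

contained : ∀ {n} → Subset n → Subset n → Bool
contained []      []      = true
contained (i ∷ I) (j ∷ J) = (not i ∨ j) ∧ contained I J

contained-sound : ∀ {n} (I J : Subset n) → contained I J ≡ true → ∀ x → lookup I x ≡ true → lookup J x ≡ true
contained-sound (true  ∷ I) (true ∷ J) h zero    _   = refl
contained-sound (true  ∷ I) (true ∷ J) h (suc x) x∈I = contained-sound I J h x x∈I
contained-sound (false ∷ I) (j ∷ J)    h (suc x) x∈I = contained-sound I J h x x∈I

count-subsets : ∀ {n} (J : Subset n) k → ∑ˢ (λ I → 𝟙 (contained I J ∧ does (card (lookup I) ≟ k))) ≡ card (lookup J) choose k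
count-subsets []            zero    = refl
count-subsets []            (suc k) = sym (k>n⇒nCk≡0 {0} {suc k} (s≤s z≤n))
count-subsets {suc n} (outside ∷ J) k = trans (cong (∑ˢ (λ I → 𝟙 (contained I J ∧ does (card (lookup I) ≟ k))) +_) (∑ˢ-zero {n}))
  (trans (+-identityʳ _) (count-subsets J k))
count-subsets {suc n} (inside ∷ J) zero = trans (cong₂ _+_ (count-subsets J 0) (trans (∑ˢ-cong {n} (λ I → cong 𝟙 (∧-zeroʳ (contained I J)))) (∑ˢ-zero {n}))) refl
count-subsets {suc n} (inside ∷ J) (suc k) = trans (cong₂ _+_ (count-subsets J (suc k)) (count-subsets J k))
  (trans (+-comm (card (lookup J) choose suc k) _) (nCk+nC[k+1]≡[n+1]C[k+1] (card (lookup J)) k))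

-- From the hypergraph encoding to sums

listSum : {A : Set} → (A → ℕ) → List A → ℕ
listSum f = foldr (λ x acc → f x + acc) 0

length-filter : {A : Set} (p : A → Bool) (xs : List A) → length (filter (λ x → p x Bool.≟ true) xs) ≡ listSum (𝟙 ∘ p) xs
length-filter p []       = refl
length-filter p (x ∷ xs) with p x
... | true  = cong suc (length-filter p xs)
... | false = length-filter p xs

listSum-++ : {A : Set} (f : A → ℕ) (xs ys : List A) → listSum f (xs ++ ys) ≡ listSum f xs + listSum f ys
listSum-++ f []       ys = refl
listSum-++ f (x ∷ xs) ys = trans (cong (f x +_) (listSum-++ f xs ys)) (sym (+-assoc (f x) _ _))

listSum-map : {A B : Set} (f : B → ℕ) (g : A → B) (xs : List A) → listSum f (map g xs) ≡ listSum (f ∘ g) xs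
listSum-map f g []       = refl
listSum-map f g (x ∷ xs) = cong (f (g x) +_) (listSum-map f g xs)

listSum-allSubsets : ∀ n (f : Subset n → ℕ) → listSum f (allSubsets n) ≡ ∑ˢ f
listSum-allSubsets zero    f = +-identityʳ (f [])
listSum-allSubsets (suc n) f = trans (listSum-++ f (map (outside ∷_) (allSubsets n)) _)
  (cong₂ _+_ (trans (listSum-map f (outside ∷_) (allSubsets n)) (listSum-allSubsets n (f ∘ (outside ∷_))))
             (trans (listSum-map f (inside ∷_) (allSubsets n)) (listSum-allSubsets n (f ∘ (inside ∷_)))))

count≡∑ˢ : ∀ {n} (p : Subset n → Bool) → count p ≡ ∑ˢ (𝟙 ∘ p)
count≡∑ˢ {n} p = trans (length-filter p (allSubsets n)) (listSum-allSubsets n (𝟙 ∘ p))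

∈-allSubsets : ∀ {n} (S : Subset n) → S ∈ˡ allSubsets n
∈-allSubsets []            = here refl
∈-allSubsets (outside ∷ S) = ∈-++⁺ˡ (∈-map⁺ (outside ∷_) (∈-allSubsets S))
∈-allSubsets {suc n} (inside ∷ S) = ∈-++⁺ʳ (map (outside ∷_) (allSubsets n)) (∈-map⁺ (inside ∷_) (∈-allSubsets S))

any-complete : ∀ {n} (p : Subset n → Bool) S → p S ≡ true → any p (allSubsets n) ≡ true
any-complete {n} p S h = Equivalence.to T-≡ (any⁺ p (Any.map (λ { refl → Equivalence.from T-≡ h }) (∈-allSubsets S)))

any-sound : ∀ {n} (p : Subset n → Bool) → any p (allSubsets n) ≡ true → ∃ λ S → p S ≡ true
any-sound {n} p h = let S , q = satisfied (any⁻ p (allSubsets n) (Equivalence.from T-≡ h)) in S , Equivalence.to T-≡ q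

maxOver-bound : ∀ {n} (p : Subset n → Bool) f S → p S ≡ true → f S ≤ maxOver p f
maxOver-bound {n} p f S h = go (allSubsets n) (∈-allSubsets S)
  where
  step : Subset n → ℕ → ℕ
  step S acc = (if p S then f S else 0) ⊔ acc
  go : ∀ xs → S ∈ˡ xs → f S ≤ foldr step 0 xs
  go (x ∷ xs) (here refl) rewrite h = m≤m⊔n (f S) _
  go (x ∷ xs) (there q)   = ≤-trans (go xs q) (m≤n⊔m (if p x then f x else 0) _)

maxOver-attained : ∀ {n} (p : Subset n → Bool) f → 1 ≤ maxOver p f → ∃ λ S → p S ≡ true × maxOver p f ≤ f S
maxOver-attained {n} p f = go (allSubsets n)
  where
  step : Subset n → ℕ → ℕ
  step S acc = (if p S then f S else 0) ⊔ acc
  go : ∀ xs → 1 ≤ foldr step 0 xs → ∃ λ S → p S ≡ true × foldr step 0 xs ≤ f S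
  go (x ∷ xs) h with p x in eq | ⊔-sel (if p x then f x else 0) (foldr step 0 xs)
  ... | false | _ = go xs h
  ... | true  | inj₁ e = x , eq , ≤-reflexive e
  ... | true  | inj₂ e rewrite e = go xs h

∈⇒lookup : ∀ {n} {x : Fin n} {A : Subset n} → x ∈ A → lookup A x ≡ true
∈⇒lookup = []=⇒lookup

lookup⇒∈ : ∀ {n} {x : Fin n} {A : Subset n} → lookup A x ≡ true → x ∈ A
lookup⇒∈ {x = x} {A} = lookup⇒[]= x A

lookup-∪ : ∀ {n} (A B : Subset n) x → lookup (A ∪ B) x ≡ lookup A x ∨ lookup B x
lookup-∪ A B x = lookup-zipWith _∨_ x A B

lookup-∩ : ∀ {n} (A B : Subset n) x → lookup (A ∩ B) x ≡ lookup A x ∧ lookup B x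
lookup-∩ A B x = lookup-zipWith _∧_ x A B

∣∪∣≤ : ∀ {n} (A B : Subset n) → ∣ A ∪ B ∣ ≤ ∣ A ∣ + ∣ B ∣
∣∪∣≤ A B = subst₂ _≤_ (sym (∣∣≡card (A ∪ B))) (sym (cong₂ _+_ (∣∣≡card A) (∣∣≡card B)))
  (≤-trans (sum-mono (λ x → ≤-trans (≤-reflexive (cong 𝟙 (lookup-∪ A B x))) (or (lookup A x) (lookup B x))))
           (≤-reflexive (∑-distrib-+ (𝟙 ∘ lookup A) (𝟙 ∘ lookup B))))
  where
  or : ∀ a b → 𝟙 (a ∨ b) ≤ 𝟙 a + 𝟙 b
  or true  b = s≤s z≤n
  or false b = ≤-refl

⊆∧∣≥∣⇒≡ : ∀ {n} (A B : Subset n) → (∀ x → lookup A x ≡ true → lookup B x ≡ true) → ∣ B ∣ ≤ ∣ A ∣ → A ≡ B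
⊆∧∣≥∣⇒≡ [] [] _ _ = refl
⊆∧∣≥∣⇒≡ (true ∷ A) (true ∷ B) sub le = cong (true ∷_) (⊆∧∣≥∣⇒≡ A B (λ x → sub (suc x)) (s≤s⁻¹ le))
⊆∧∣≥∣⇒≡ (false ∷ A) (false ∷ B) sub le = cong (false ∷_) (⊆∧∣≥∣⇒≡ A B (λ x → sub (suc x)) le)
⊆∧∣≥∣⇒≡ (true ∷ A) (false ∷ B) sub le = ⊥-elim (true≢false (sub zero refl) refl)
⊆∧∣≥∣⇒≡ (false ∷ A) (true ∷ B) sub le = ⊥-elim (<⇒≱ le (subst₂ _≤_ (sym (∣∣≡card A)) (sym (∣∣≡card B)) (card-mono (lookup A) (lookup B) (λ x → sub (suc x)))))

-- Edges as unions of three singletons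

remove-element : ∀ {n} (A : Subset n) k → ∣ A ∣ ≡ suc k → ∃ λ x → ∃ λ B → A ≡ ⁅ x ⁆ ∪ B × ∣ B ∣ ≡ k
remove-element (inside ∷ A) k eq = zero , outside ∷ A , cong (inside ∷_) (sym (∪-identityˡ A)) , suc-injective eq
remove-element (outside ∷ A) k eq = let x , B , e , c = remove-element A k eq in suc x , outside ∷ B , cong (outside ∷_) e , c

∣∣≡0⇒∅ : ∀ {n} (A : Subset n) → ∣ A ∣ ≡ 0 → A ≡ ∅
∣∣≡0⇒∅ []            _  = refl
∣∣≡0⇒∅ (outside ∷ A) eq = cong (outside ∷_) (∣∣≡0⇒∅ A eq)

triple : ∀ {n} → Fin n → Fin n → Fin n → Subset n
triple x y z = ⁅ x ⁆ ∪ (⁅ y ⁆ ∪ ⁅ z ⁆)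

pair-of : ∀ {n} (A : Subset n) → ∣ A ∣ ≡ 2 → ∃ λ x → ∃ λ y → A ≡ ⁅ x ⁆ ∪ ⁅ y ⁆
pair-of A eq with remove-element A 1 eq
... | x , B , refl , eq′ with remove-element B 0 eq′
...   | y , C , refl , eq″ = x , y , cong (⁅ x ⁆ ∪_) (trans (cong (⁅ y ⁆ ∪_) (∣∣≡0⇒∅ C eq″)) (∪-identityʳ ⁅ y ⁆))

triple-of : ∀ {n} (A : Subset n) → ∣ A ∣ ≡ 3 → ∃ λ x → ∃ λ y → ∃ λ z → A ≡ triple x y z
triple-of A eq with remove-element A 2 eq
... | x , B , refl , eq′ = let y , z , e = pair-of B eq′ in x , y , z , cong (⁅ x ⁆ ∪_) e

∈-tripleˣ : ∀ {n} (x y z : Fin n) → x ∈ triple x y z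
∈-tripleˣ x y z = x∈p∪q⁺ (inj₁ (x∈⁅x⁆ x))

∈-tripleʸ : ∀ {n} (x y z : Fin n) → y ∈ triple x y z
∈-tripleʸ x y z = x∈p∪q⁺ {p = ⁅ x ⁆} (inj₂ (x∈p∪q⁺ (inj₁ (x∈⁅x⁆ y))))

∈-tripleᶻ : ∀ {n} (x y z : Fin n) → z ∈ triple x y z
∈-tripleᶻ x y z = x∈p∪q⁺ {p = ⁅ x ⁆} (inj₂ (x∈p∪q⁺ {p = ⁅ y ⁆} (inj₂ (x∈⁅x⁆ z))))

triple-members : ∀ {n} {t : Fin n} x y z → t ∈ triple x y z → t ≡ x ⊎ t ≡ y ⊎ t ≡ z
triple-members x y z t∈ with x∈p∪q⁻ ⁅ x ⁆ _ t∈
... | inj₁ p = inj₁ (x∈⁅y⁆⇒x≡y x p)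
... | inj₂ q with x∈p∪q⁻ ⁅ y ⁆ ⁅ z ⁆ q
...   | inj₁ p = inj₂ (inj₁ (x∈⁅y⁆⇒x≡y y p))
...   | inj₂ p = inj₂ (inj₂ (x∈⁅y⁆⇒x≡y z p))

_==_ : ∀ {n} → Subset n → Subset n → Bool
A == B = does (≡-dec Bool._≟_ A B)

∑ˢ-== : ∀ {n} (B : Subset n) → ∑ˢ (λ A → 𝟙 (A == B)) ≡ 1
∑ˢ-== []            = refl
∑ˢ-== {suc n} (outside ∷ B) = cong₂ _+_ (∑ˢ-== B) (∑ˢ-zero {n})
∑ˢ-== {suc n} (inside ∷ B)  = cong₂ _+_ (∑ˢ-zero {n}) (∑ˢ-== B)

-- Inserts a sum over sets with a single live term, so that counting edges and counting tuples of
-- vertices can be exchanged.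
∑ˢ-at : ∀ {n} (B : Subset n) (c : Bool) → ∑ˢ (λ A → 𝟙 (A == B ∧ c)) ≡ 𝟙 c
∑ˢ-at B c = trans (∑ˢ-cong (λ A → 𝟙-∧ (A == B) c)) (trans (sym (∑ˢ-*ʳ (λ A → 𝟙 (A == B)) (𝟙 c))) (trans (cong (_* 𝟙 c) (∑ˢ-== B)) (*-identityˡ (𝟙 c))))

count-image₂ : ∀ {n i j} (p : Subset n → Bool) (φ : Fin i → Fin j → Subset n) (r : Fin i → Fin j → Bool) →
  (∀ A → p A ≡ true → ∃ λ x → ∃ λ y → A ≡ φ x y × r x y ≡ true) →
  ∑ˢ (𝟙 ∘ p) ≤ sum (λ x → sum (λ y → 𝟙 (r x y)))
count-image₂ p φ r h = begin
  ∑ˢ (𝟙 ∘ p)  ≤⟨ ∑ˢ-mono pt ⟩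
  ∑ˢ (λ A → sum (λ x → sum (λ y → 𝟙 (A == φ x y ∧ r x y))))  ≡⟨ trans (∑ˢ-sum (λ A x → sum (λ y → 𝟙 (A == φ x y ∧ r x y)))) (sum-cong-≗ (λ x → trans (∑ˢ-sum (λ A y → 𝟙 (A == φ x y ∧ r x y))) (sum-cong-≗ (λ y → ∑ˢ-at (φ x y) (r x y))))) ⟩
  sum (λ x → sum (λ y → 𝟙 (r x y)))  ∎
  where
  pt : ∀ A → 𝟙 (p A) ≤ sum (λ x → sum (λ y → 𝟙 (A == φ x y ∧ r x y)))
  pt A = 𝟙-≤ λ q → let x , y , eq , rxy = h A q in begin
    1  ≡⟨ 𝟙-true (∧-join (does-true (≡-dec Bool._≟_ A (φ x y)) eq) rxy) ⟨
    𝟙 (A == φ x y ∧ r x y)  ≤⟨ term≤sum (λ y → 𝟙 (A == φ x y ∧ r x y)) y ⟩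
    sum (λ y → 𝟙 (A == φ x y ∧ r x y))  ≤⟨ term≤sum (λ x → sum (λ y → 𝟙 (A == φ x y ∧ r x y))) x ⟩
    sum (λ x → sum (λ y → 𝟙 (A == φ x y ∧ r x y)))  ∎

count-image₃ : ∀ {n i j k} (p : Subset n → Bool) (φ : Fin i → Fin j → Fin k → Subset n) (r : Fin i → Fin j → Fin k → Bool) →
  (∀ A → p A ≡ true → ∃ λ x → ∃ λ y → ∃ λ z → A ≡ φ x y z × r x y z ≡ true) →
  ∑ˢ (𝟙 ∘ p) ≤ sum (λ x → sum (λ y → sum (λ z → 𝟙 (r x y z))))
count-image₃ p φ r h = begin
  ∑ˢ (𝟙 ∘ p)  ≤⟨ ∑ˢ-mono pt ⟩
  ∑ˢ (λ A → sum (λ x → sum (λ y → sum (λ z → 𝟙 (A == φ x y z ∧ r x y z)))))  ≡⟨ trans (∑ˢ-sum (λ A x → sum (λ y → sum (λ z → 𝟙 (A == φ x y z ∧ r x y z))))) (sum-cong-≗ (λ x → trans (∑ˢ-sum (λ A y → sum (λ z → 𝟙 (A == φ x y z ∧ r x y z)))) (sum-cong-≗ (λ y → trans (∑ˢ-sum (λ A z → 𝟙 (A == φ x y z ∧ r x y z))) (sum-cong-≗ (λ z → ∑ˢ-at (φ x y z) (r x y z))))))) ⟩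
  sum (λ x → sum (λ y → sum (λ z → 𝟙 (r x y z))))  ∎
  where
  pt : ∀ A → 𝟙 (p A) ≤ sum (λ x → sum (λ y → sum (λ z → 𝟙 (A == φ x y z ∧ r x y z))))
  pt A = 𝟙-≤ λ q → let x , y , z , eq , rxyz = h A q in begin
    1  ≡⟨ 𝟙-true (∧-join (does-true (≡-dec Bool._≟_ A (φ x y z)) eq) rxyz) ⟨
    𝟙 (A == φ x y z ∧ r x y z)  ≤⟨ term≤sum (λ z → 𝟙 (A == φ x y z ∧ r x y z)) z ⟩
    sum (λ z → 𝟙 (A == φ x y z ∧ r x y z))  ≤⟨ term≤sum (λ y → sum (λ z → 𝟙 (A == φ x y z ∧ r x y z))) y ⟩
    sum (λ y → sum (λ z → 𝟙 (A == φ x y z ∧ r x y z)))  ≤⟨ term≤sum (λ x → sum (λ y → sum (λ z → 𝟙 (A == φ x y z ∧ r x y z)))) x ⟩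
    sum (λ x → sum (λ y → sum (λ z → 𝟙 (A == φ x y z ∧ r x y z)))) ∎

-- The triple system of a hypergraph

module FromHypergraph {n : ℕ} (H : Hypergraph3 n) where
  open Hypergraph3 H

  h : Fin n → Fin n → Fin n → Bool
  h x y z = edge (triple x y z)

  h-swapˡ : ∀ x y z → h x y z ≡ h y x z
  h-swapˡ x y z = cong edge (trans (sym (∪-assoc ⁅ x ⁆ ⁅ y ⁆ ⁅ z ⁆)) (trans (cong (_∪ ⁅ z ⁆) (∪-comm ⁅ x ⁆ ⁅ y ⁆)) (∪-assoc ⁅ y ⁆ ⁅ x ⁆ ⁅ z ⁆)))

  h-swapʳ : ∀ x y z → h x y z ≡ h x z y
  h-swapʳ x y z = cong (λ t → edge (⁅ x ⁆ ∪ t)) (∪-comm ⁅ y ⁆ ⁅ z ⁆)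

  -- A degenerate triple has at most two elements, so 3-uniformity excludes it.
  h-irrefl : ∀ x z → h x x z ≡ false
  h-irrefl x z = ¬-not λ p → <⇒≱ (≤-reflexive (sym (uniform (triple x x z) p))) (begin
    ∣ triple x x z ∣  ≡⟨ cong ∣_∣ (trans (sym (∪-assoc ⁅ x ⁆ ⁅ x ⁆ ⁅ z ⁆)) (cong (_∪ ⁅ z ⁆) (∪-idem ⁅ x ⁆))) ⟩
    ∣ ⁅ x ⁆ ∪ ⁅ z ⁆ ∣  ≤⟨ ∣∪∣≤ ⁅ x ⁆ ⁅ z ⁆ ⟩
    ∣ ⁅ x ⁆ ∣ + ∣ ⁅ z ⁆ ∣  ≡⟨ cong₂ _+_ (∣⁅x⁆∣≡1 x) (∣⁅x⁆∣≡1 z) ⟩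
    2  ∎)

  third-vertex-unique : ∀ x y z z′ → h x y z ≡ true → triple x y z ≡ triple x y z′ → z ≡ z′
  third-vertex-unique x y z z′ p eq with triple-members x y z′ (subst (z ∈_) eq (∈-tripleᶻ x y z))
  ... | inj₁ refl        = ⊥-elim (true≢false p (trans (h-swapʳ z y z) (h-irrefl z y)))
  ... | inj₂ (inj₁ refl) = ⊥-elim (true≢false p (trans (h-swapˡ x z z) (trans (h-swapʳ z x z) (h-irrefl z x))))
  ... | inj₂ (inj₂ e)    = e

  -- Double counting: an edge through `x` and `y` determines its third vertex, so distinct `z` come
  -- from distinct edges.
  extensions≤codegree : ∀ x y → sum (λ z → 𝟙 (h x y z)) ≤ codegree H x y
  extensions≤codegree x y = begin
    sum (λ z → 𝟙 (h x y z))  ≡⟨ sum-cong-≗ (λ z → ∑ˢ-at (triple x y z) (h x y z)) ⟨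
    sum (λ z → ∑ˢ (λ f → 𝟙 (f == triple x y z ∧ h x y z)))  ≡⟨ ∑ˢ-sum (λ f z → 𝟙 (f == triple x y z ∧ h x y z)) ⟨
    ∑ˢ (λ f → sum (λ z → 𝟙 (f == triple x y z ∧ h x y z)))  ≤⟨ ∑ˢ-mono pt ⟩
    ∑ˢ (λ f → 𝟙 (edge f ∧ (x ∈ᵇ f) ∧ (y ∈ᵇ f)))  ≡⟨ count≡∑ˢ (λ f → edge f ∧ (x ∈ᵇ f) ∧ (y ∈ᵇ f)) ⟨
    codegree H x y  ∎
    where
    decode : ∀ f z → f == triple x y z ∧ h x y z ≡ true → f ≡ triple x y z × h x y z ≡ true
    decode f z p = let q , r = ∧-split p in does-sound (≡-dec Bool._≟_ f (triple x y z)) q , r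
    pt : ∀ f → sum (λ z → 𝟙 (f == triple x y z ∧ h x y z)) ≤ 𝟙 (edge f ∧ (x ∈ᵇ f) ∧ (y ∈ᵇ f))
    pt f with 1 ≤? sum (λ z → 𝟙 (f == triple x y z ∧ h x y z))
    ... | no ¬p = ≤-trans (≤-reflexive (n<1⇒n≡0 (≰⇒> ¬p))) z≤n
    ... | yes p with sum-pos (λ z → 𝟙 (f == triple x y z ∧ h x y z)) p
    ...   | z , q with decode f z (𝟙-pos q)
    ...     | refl , hxyz = ≤-trans
      (sum-unique _ (λ z₁ z₂ p₁ p₂ →
        let e₁ , h₁ = decode f z₁ p₁ ; e₂ , _ = decode f z₂ p₂
        in third-vertex-unique x y z₁ z₂ h₁ (trans (sym e₁) e₂)))
      (≤-reflexive (sym (𝟙-true (∧-join hxyz (∧-join (does-true (x ∈? f) (∈-tripleˣ x y z)) (does-true (y ∈? f) (∈-tripleʸ x y z)))))))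

  tripleSystem : (Δ : ℕ) → Δ₂≤ H Δ → TripleSystem n
  tripleSystem Δ codeg = record
    { h = h ; h-swapˡ = h-swapˡ ; h-swapʳ = h-swapʳ ; h-irrefl = h-irrefl ; Δ = Δ
    ; codeg≤Δ = λ x y → bound x y (x Fin.≟ y) }
    where
    bound : ∀ x y → Dec (x ≡ y) → sum (λ z → 𝟙 (h x y z)) ≤ Δ
    bound x y (no x≢y)   = ≤-trans (extensions≤codegree x y) (codeg x y x≢y)
    -- The codegree hypothesis says nothing about `x = y`, where the sum vanishes by irreflexivity.
    bound x y (yes refl) = ≤-trans (≤-reflexive (sum≡0 (λ z → cong 𝟙 (h-irrefl x z)))) z≤n

  independent-no-edge : ∀ I → isIndependent H I ≡ true → ∀ f → edge f ≡ true → f ⊆ I → ⊥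
  independent-no-edge I ind f ef f⊆I = true≢false (any-complete (λ f → edge f ∧ (f ⊆ᵇ I)) f (∧-join ef (does-true (f ⊆? I) f⊆I))) (not-true ind)
    where
    not-true : ∀ {b} → not b ≡ true → b ≡ false
    not-true {false} _ = refl

  isIndependent-mono : ∀ I J → (∀ x → lookup I x ≡ true → lookup J x ≡ true) → isIndependent H J ≡ true → isIndependent H I ≡ true
  isIndependent-mono I J I⊆J ind with any (λ f → edge f ∧ (f ⊆ᵇ I)) (allSubsets n) in eq
  ... | false = refl
  ... | true  = ⊥-elim (let f , p = any-sound (λ f → edge f ∧ (f ⊆ᵇ I)) eq
                            ef , f⊆I = ∧-split p
                        in independent-no-edge J ind f ef (λ x∈f → lookup⇒∈ (I⊆J _ (∈⇒lookup (does-sound (f ⊆? I) f⊆I x∈f)))))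

  module _ (Δ : ℕ) (codeg : Δ₂≤ H Δ) where
    open Triples (tripleSystem Δ codeg) using (Independent; link)

    isIndependent⇒Independent : ∀ I → isIndependent H I ≡ true → Independent I
    isIndependent⇒Independent I ind x y z x∈I y∈I z∈I = ¬-not λ p → independent-no-edge I ind (triple x y z) p λ t∈ →
      [ (λ { refl → lookup⇒∈ x∈I }) , [ (λ { refl → lookup⇒∈ y∈I }) , (λ { refl → lookup⇒∈ z∈I }) ]′ ]′ (triple-members x y z t∈)

    eInduced≤links : ∀ (A : VSet n) → eInduced H (tabulate A) ≤ sum (λ v → 𝟙 (A v) * link A v)
    eInduced≤links A = begin
      eInduced H (tabulate A)  ≡⟨ count≡∑ˢ (λ f → edge f ∧ (f ⊆ᵇ tabulate A)) ⟩
      ∑ˢ (λ f → 𝟙 (edge f ∧ (f ⊆ᵇ tabulate A)))  ≤⟨ count-image₃ _ triple (λ x y z → A x ∧ (A y ∧ (A z ∧ h x y z))) inside-A ⟩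
      sum (λ x → sum (λ y → sum (λ z → 𝟙 (A x ∧ (A y ∧ (A z ∧ h x y z))))))  ≡⟨ sum-cong-≗ (λ x → trans (sum-cong-≗ (λ y → trans (sum-cong-≗ (λ z → 𝟙-∧ (A x) (A y ∧ (A z ∧ h x y z)))) (sym (*-distribˡ-sum (𝟙 (A x)) (λ z → 𝟙 (A y ∧ (A z ∧ h x y z))))))) (sym (*-distribˡ-sum (𝟙 (A x)) (λ y → sum (λ z → 𝟙 (A y ∧ (A z ∧ h x y z))))))) ⟩
      sum (λ v → 𝟙 (A v) * link A v)  ∎
      where
      inside-A : ∀ f → edge f ∧ (f ⊆ᵇ tabulate A) ≡ true →
        ∃ λ x → ∃ λ y → ∃ λ z → f ≡ triple x y z × A x ∧ (A y ∧ (A z ∧ h x y z)) ≡ true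
      inside-A f p with ∧-split {edge f} p
      ... | ef , f⊆A with triple-of f (uniform f ef)
      ...   | x , y , z , refl = x , y , z , refl , ∧-join (mem x (∈-tripleˣ x y z)) (∧-join (mem y (∈-tripleʸ x y z)) (∧-join (mem z (∈-tripleᶻ x y z)) ef))
        where
        mem : ∀ t → t ∈ triple x y z → A t ≡ true
        mem t t∈ = trans (sym (lookup∘tabulate A t)) (∈⇒lookup (does-sound (triple x y z ⊆? tabulate A) f⊆A t∈))

    -- As `v ∉ B`, an edge through `v` with two vertices in `B` is `v` together with `f ∩ B`;
    -- comparing sizes shows that nothing is left over.
    degB≤link : ∀ B v → lookup B v ≡ false → degB H B v ≤ link (lookup B) v
    degB≤link B v v∉B = begin
      degB H B v  ≡⟨ count≡∑ˢ (λ f → edge f ∧ (∣ f ∩ B ∣ ≡ᵇ 2) ∧ (v ∈ᵇ f)) ⟩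
      ∑ˢ (λ f → 𝟙 (edge f ∧ (∣ f ∩ B ∣ ≡ᵇ 2) ∧ (v ∈ᵇ f)))  ≤⟨ count-image₂ _ (triple v) (λ x y → lookup B x ∧ (lookup B y ∧ h v x y)) through-v ⟩
      link (lookup B) v  ∎
      where
      through-v : ∀ f → edge f ∧ (∣ f ∩ B ∣ ≡ᵇ 2) ∧ (v ∈ᵇ f) ≡ true →
        ∃ λ x → ∃ λ y → f ≡ triple v x y × lookup B x ∧ (lookup B y ∧ h v x y) ≡ true
      through-v f p with ∧-split {edge f} p
      ... | ef , q with ∧-split {∣ f ∩ B ∣ ≡ᵇ 2} q
      ...   | two , v∈ᵇf with pair-of (f ∩ B) (does-sound (∣ f ∩ B ∣ ≟ 2) two)
      ...     | x , y , eq = x , y , sym whole , ∧-join (inB x (x∈p∪q⁺ (inj₁ (x∈⁅x⁆ x)))) (∧-join (inB y (x∈p∪q⁺ {p = ⁅ x ⁆} (inj₂ (x∈⁅x⁆ y)))) (trans (cong edge whole) ef))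
        where
        v∈f : v ∈ f
        v∈f = does-sound (v ∈? f) v∈ᵇf
        inB : ∀ t → t ∈ ⁅ x ⁆ ∪ ⁅ y ⁆ → lookup B t ≡ true
        inB t t∈ = ∈⇒lookup (proj₂ (x∈p∩q⁻ f B (subst (t ∈_) (sym eq) t∈)))
        sub : ∀ t → lookup (triple v x y) t ≡ true → lookup f t ≡ true
        sub t t∈ with x∈p∪q⁻ ⁅ v ⁆ (⁅ x ⁆ ∪ ⁅ y ⁆) (lookup⇒∈ t∈)
        ... | inj₁ t∈v  = subst (λ s → lookup f s ≡ true) (sym (x∈⁅y⁆⇒x≡y v t∈v)) (∈⇒lookup v∈f)
        ... | inj₂ t∈xy = ∈⇒lookup (proj₁ (x∈p∩q⁻ f B (subst (t ∈_) (sym eq) t∈xy)))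
        v∉fB : lookup (f ∩ B) v ≡ false
        v∉fB = trans (lookup-∩ f B v) (trans (cong (lookup f v ∧_) v∉B) (∧-zeroʳ (lookup f v)))
        size : ∣ f ∣ ≤ ∣ triple v x y ∣
        size = begin
          ∣ f ∣  ≡⟨ uniform f ef ⟩
          3  ≡⟨ cong suc (does-sound (∣ f ∩ B ∣ ≟ 2) two) ⟨
          suc ∣ f ∩ B ∣  ≡⟨ cong suc (∣∣≡card (f ∩ B)) ⟩
          suc (card (lookup (f ∩ B)))  ≡⟨ card-⊕ (lookup (f ∩ B)) v v∉fB ⟨
          card (lookup (f ∩ B) ⊕ v)  ≤⟨ card-mono (lookup (f ∩ B) ⊕ v) (lookup (triple v x y)) grow ⟩
          card (lookup (triple v x y))  ≡⟨ ∣∣≡card (triple v x y) ⟨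
          ∣ triple v x y ∣  ∎
          where
          grow : ∀ t → (lookup (f ∩ B) ⊕ v) t ≡ true → lookup (triple v x y) t ≡ true
          grow t t∈ with lookup (f ∩ B) t in e
          ... | true  = ∈⇒lookup (x∈p∪q⁺ {p = ⁅ v ⁆} (inj₂ (subst (t ∈_) eq (lookup⇒∈ e))))
          ... | false = ∈⇒lookup (x∈p∪q⁺ {p = ⁅ v ⁆} (inj₁ (subst (λ s → t ∈ ⁅ s ⁆) (≟ᵇ-sound t∈) (x∈⁅x⁆ t))))
        whole : triple v x y ≡ f
        whole = ⊆∧∣≥∣⇒≡ (triple v x y) f sub size

-- Stability with natural-number constants

toℚᵘ-/ : ∀ i d → ℚ.toℚᵘ (i ℚ./ suc d) ℚᵘ.≃ ℚᵘ.mkℚᵘ i d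
toℚᵘ-/ i d = ℚₚ.toℚᵘ-fromℚᵘ (ℚᵘ.mkℚᵘ i d)

ratio*ℕ : ∀ (β : ℚ) p d x → ℚ.toℚᵘ β ℚᵘ.≃ ℚᵘ.mkℚᵘ (ℤ.+ p) d →
  ℚ.toℚᵘ (β ℚ.* ℕ→ℚ x) ℚᵘ.≃ ℚᵘ.mkℚᵘ (ℤ.+ (p * x)) d
ratio*ℕ β p d x eq = ℚᵘₚ.≃-trans (ℚₚ.toℚᵘ-homo-* β (ℕ→ℚ x)) (ℚᵘₚ.≃-trans (ℚᵘₚ.*-cong eq (toℚᵘ-/ (ℤ.+ x) 0))
  (ℚᵘ.*≡* (cong₂ ℤ._*_ (sym (ℤₚ.pos-* p x)) (cong (λ t → ℤ.+ suc t) (sym (*-identityʳ d))))))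

ratio*ℕ≤⇒ : ∀ β p d x y → ℚ.toℚᵘ β ℚᵘ.≃ ℚᵘ.mkℚᵘ (ℤ.+ p) d → β ℚ.* ℕ→ℚ x ℚ.≤ ℕ→ℚ y → p * x ≤ y * suc d
ratio*ℕ≤⇒ β p d x y eq le = subst₂ _≤_ (*-identityʳ (p * x)) refl (ℤₚ.drop‿+≤+ (subst₂ ℤ._≤_ (sym (ℤₚ.pos-* (p * x) 1)) (sym (ℤₚ.pos-* y (suc d)))
  (ℚᵘₚ.drop-*≤* (ℚᵘₚ.≤-respʳ-≃ (toℚᵘ-/ (ℤ.+ y) 0) (ℚᵘₚ.≤-respˡ-≃ (ratio*ℕ β p d x eq) (ℚₚ.toℚᵘ-mono-≤ le))))))

≤ratio*ℕ⇒ : ∀ β p d x y → ℚ.toℚᵘ β ℚᵘ.≃ ℚᵘ.mkℚᵘ (ℤ.+ p) d → ℕ→ℚ y ℚ.≤ β ℚ.* ℕ→ℚ x → y * suc d ≤ p * x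
≤ratio*ℕ⇒ β p d x y eq le = subst₂ _≤_ refl (*-identityʳ (p * x)) (ℤₚ.drop‿+≤+ (subst₂ ℤ._≤_ (sym (ℤₚ.pos-* y (suc d))) (sym (ℤₚ.pos-* (p * x) 1))
  (ℚᵘₚ.drop-*≤* (ℚᵘₚ.≤-respˡ-≃ (toℚᵘ-/ (ℤ.+ y) 0) (ℚᵘₚ.≤-respʳ-≃ (ratio*ℕ β p d x eq) (ℚₚ.toℚᵘ-mono-≤ le))))))

≤+ratio*ℕ : ∀ β p d x y z → ℚ.toℚᵘ β ℚᵘ.≃ ℚᵘ.mkℚᵘ (ℤ.+ p) d → y * suc d ≤ z * suc d + p * x →
  ℕ→ℚ y ℚ.≤ ℕ→ℚ z ℚ.+ β ℚ.* ℕ→ℚ x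
≤+ratio*ℕ β p d x y z eq le = ℚₚ.toℚᵘ-cancel-≤ (ℚᵘₚ.≤-respˡ-≃ (ℚᵘₚ.≃-sym (toℚᵘ-/ (ℤ.+ y) 0)) (ℚᵘₚ.≤-respʳ-≃ (ℚᵘₚ.≃-sym right) (ℚᵘ.*≤* cross)))
  where
  right : ℚ.toℚᵘ (ℕ→ℚ z ℚ.+ β ℚ.* ℕ→ℚ x) ℚᵘ.≃ ℚᵘ.mkℚᵘ (ℤ.+ z) 0 ℚᵘ.+ ℚᵘ.mkℚᵘ (ℤ.+ (p * x)) d
  right = ℚᵘₚ.≃-trans (ℚₚ.toℚᵘ-homo-+ (ℕ→ℚ z) (β ℚ.* ℕ→ℚ x)) (ℚᵘₚ.+-cong (toℚᵘ-/ (ℤ.+ z) 0) (ratio*ℕ β p d x eq))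
  cross : ℤ.+ y ℤ.* ℤ.+ suc (d + 0) ℤ.≤ (ℤ.+ z ℤ.* ℤ.+ suc d ℤ.+ ℤ.+ (p * x) ℤ.* ℤ.+ 1) ℤ.* ℤ.+ 1
  cross = subst₂ ℤ._≤_ (trans (ℤₚ.pos-* y (suc d)) (cong (λ t → ℤ.+ y ℤ.* ℤ.+ suc t) (sym (+-identityʳ d))))
    (trans (trans (ℤₚ.pos-+ (z * suc d) (p * x)) (cong₂ ℤ._+_ (ℤₚ.pos-* z (suc d)) (sym (ℤₚ.*-identityʳ (ℤ.+ (p * x)))))) (sym (ℤₚ.*-identityʳ _)))
    (ℤ.+≤+ le)

subtract-slack : ∀ q β n N a → q ℚ.* n ℚ.≤ N → N ℚ.≤ a ℚ.+ β ℚ.* n → (q ℚ.- β) ℚ.* n ℚ.≤ a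
subtract-slack q β n N a qn≤N N≤ = begin′
  where
  s = β ℚ.* n
  expand : (q ℚ.- β) ℚ.* n ≡ q ℚ.* n ℚ.- s
  expand = trans (ℚₚ.*-distribʳ-+ n q (ℚ.- β)) (cong (q ℚ.* n ℚ.+_) (sym (ℚₚ.neg-distribˡ-* β n)))
  cancel : a ℚ.+ s ℚ.- s ≡ a
  cancel = trans (ℚₚ.+-assoc a s (ℚ.- s)) (trans (cong (a ℚ.+_) (ℚₚ.+-inverseʳ s)) (ℚₚ.+-identityʳ a))
  begin′ = subst₂ ℚ._≤_ (sym expand) cancel (ℚₚ.+-monoˡ-≤ (ℚ.- s) (ℚₚ.≤-trans qn≤N N≤))

module _ (α : ℝ) (H : (n : ℕ) → Hypergraph3 n) (ℬ : (n : ℕ) → Family n) (stable : Stable α H ℬ)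
  (norm : ∀ n → ∀ q → ℝ.L α q → q ℚ.* ℕ→ℚ n ℚ.≤ ℕ→ℚ (familyNorm (ℬ n))) where

  -- Stability with `γ = 1/g` and `β` weakened to `1/β̄`. The real number `α` is gone: as
  -- `‖ℬ‖ ≥ α n`, a set of size at least `‖ℬ‖ - n/β̄` meets the size condition.
  Stableℕ : ℕ → ℕ → Set
  Stableℕ g β̄ = ∀ n (A : Subset n) → β̄ * familyNorm (ℬ n) ≤ β̄ * ∣ A ∣ + n →
    e (H n) ≤ β̄ * eInduced (H n) A ⊎ ∃ λ B → ℬ n B ≡ true × g * ∣ A ∩ ∁ B ∣ ≤ n

  -- For `β = (p + 1) / (d + 1)` the reciprocal bound is `β̄ = d + 1`, because `β ≥ 1 / (d + 1)`.
  -- Each rational `q` below `α` is treated separately, through `norm`.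
  stable-at : ∀ γ g β p d → ℚ.toℚᵘ γ ℚᵘ.≃ ℚᵘ.mkℚᵘ (ℤ.+ 1) g → ℚ.toℚᵘ β ℚᵘ.≃ ℚᵘ.mkℚᵘ (ℤ.+ suc p) d →
    (∀ n (A : Subset n) → SizeAtLeast α β n ∣ A ∣ →
       (β ℚ.* ℕ→ℚ (e (H n)) ℚ.≤ ℕ→ℚ (eInduced (H n) A))
       ⊎ (∃ λ B → ℬ n B ≡ true × ℕ→ℚ ∣ A ∩ ∁ B ∣ ℚ.≤ γ ℚ.* ℕ→ℚ n)) →
    Stableℕ (suc g) (suc d)
  stable-at γ g β p d γ≃ β≃ apply n A large = [ inj₁ ∘ dense , inj₂ ∘ near ]′ (apply n A (λ q Lq →
    subtract-slack q β (ℕ→ℚ n) (ℕ→ℚ (familyNorm (ℬ n))) (ℕ→ℚ ∣ A ∣) (norm n q Lq)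
    (≤+ratio*ℕ β (suc p) d n (familyNorm (ℬ n)) ∣ A ∣ β≃ (begin
      familyNorm (ℬ n) * suc d  ≡⟨ *-comm (familyNorm (ℬ n)) (suc d) ⟩
      suc d * familyNorm (ℬ n)  ≤⟨ large ⟩
      suc d * ∣ A ∣ + n  ≤⟨ +-mono-≤ (≤-reflexive (*-comm (suc d) ∣ A ∣)) (m≤m+n n (p * n)) ⟩
      ∣ A ∣ * suc d + suc p * n  ∎))))
    where
    dense : β ℚ.* ℕ→ℚ (e (H n)) ℚ.≤ ℕ→ℚ (eInduced (H n) A) → e (H n) ≤ suc d * eInduced (H n) A
    dense le = begin
      e (H n)  ≤⟨ m≤m+n (e (H n)) (p * e (H n)) ⟩
      suc p * e (H n)  ≤⟨ ratio*ℕ≤⇒ β (suc p) d (e (H n)) (eInduced (H n) A) β≃ le ⟩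
      eInduced (H n) A * suc d  ≡⟨ *-comm (eInduced (H n) A) (suc d) ⟩
      suc d * eInduced (H n) A  ∎
    near : (∃ λ B → ℬ n B ≡ true × ℕ→ℚ ∣ A ∩ ∁ B ∣ ℚ.≤ γ ℚ.* ℕ→ℚ n) → ∃ λ B → ℬ n B ≡ true × suc g * ∣ A ∩ ∁ B ∣ ≤ n
    near (B , B∈ℬ , le) = B , B∈ℬ , subst₂ _≤_ (*-comm ∣ A ∩ ∁ B ∣ (suc g)) (*-identityˡ n)
      (≤ratio*ℕ⇒ γ 1 g n ∣ A ∩ ∁ B ∣ γ≃ le)

  stable-ℕ : ∀ g → 1 ≤ g → ∃ λ β̄ → 1 ≤ β̄ × Stableℕ g β̄
  stable-ℕ (suc g) _ = from-β (ℤ.+ 1 ℚ./ suc g) (ℚₚ.positive⁻¹ (ℤ.+ 1 ℚ./ suc g) {{ℚₚ.normalize-pos 1 (suc g)}}) (toℚᵘ-/ (ℤ.+ 1) g)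
    where
    from-β : ∀ γ → Pos γ → ℚ.toℚᵘ γ ℚᵘ.≃ ℚᵘ.mkℚᵘ (ℤ.+ 1) g → ∃ λ β̄ → 1 ≤ β̄ × Stableℕ (suc g) β̄
    from-β γ γ>0 γ≃ with stable γ γ>0
    ... | mkℚ (ℤ.+ 0) d c , ℚ.*<* (ℤ.+<+ ()) , _
    ... | mkℚ ℤ.-[1+ p ] d c , ℚ.*<* () , _
    ... | β@(mkℚ (ℤ.+ suc p) d c) , _ , apply = suc d , s≤s z≤n , stable-at γ g β p d γ≃ ℚᵘₚ.≃-refl apply

-- Choice of parameters

<2^ : ∀ x → suc x ≤ 2 ^ x
<2^ zero    = ≤-refl
<2^ (suc x) = begin
  suc (suc x)  ≤⟨ +-mono-≤ (1≤^ x (s≤s {n = 1} z≤n)) (<2^ x) ⟩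
  2 ^ x + 2 ^ x  ≡⟨ cong (2 ^ x +_) (+-identityʳ (2 ^ x)) ⟨
  2 ^ suc x  ∎

square-cancel-≤ : ∀ {u v} → u * u ≤ v * v → u ≤ v
square-cancel-≤ h = ≮⇒≥ λ v<u → <⇒≱ (*-mono-< v<u v<u) h

4^≡2^2* : ∀ k → 4 ^ k ≡ 2 ^ (2 * k)
4^≡2^2* k = ^-*-assoc 2 2 k

-- After raising to the power `q = 8y`, each of `w`, `(1 + m/(bX))^n` and `X ^ t` costs at most
-- `2 ^ m`; the choice `X = 2c̄q` settles the second. The right side gains `2 ^ (fq)`, and
-- `fq ≥ 8(m - y) ≥ 4m` as `2y ≤ m`. The lemma serves both cases, with `t` the number of picks or of
-- exceptional vertices.
container-saving : ∀ m b n c̄ y f t w → let q = 8 * y; X = 2 * c̄ * q in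
  1 ≤ b → 1 ≤ c̄ → 1 ≤ y → n ≤ c̄ * b → X * q * t ≤ m → 2 * y ≤ m → m ≤ suc f * y → w ^ q ≤ 2 ^ m →
  w * ((b * X + m) ^ n * X ^ t) ≤ (b * X) ^ n * 2 ^ f
container-saving m b n c̄ y f t w b≥1 c̄≥1 y≥1 n≤c̄b Xqt≤m 2y≤m m≤ w≤ = ^-cancel-≤ {q} q≥1 (begin
  (w * ((bX + m) ^ n * X ^ t)) ^ q  ≡⟨ trans (*-^ w _ q) (cong (w ^ q *_) (*-^ ((bX + m) ^ n) (X ^ t) q)) ⟩
  w ^ q * (((bX + m) ^ n) ^ q * (X ^ t) ^ q)  ≤⟨ *-mono-≤ w≤ (*-mono-≤ U≤ X≤) ⟩
  2 ^ m * (2 ^ m * V ^ q * 2 ^ m)  ≡⟨ id₁ (2 ^ m) (V ^ q) ⟩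
  V ^ q * (2 ^ m * (2 ^ m * 2 ^ m))  ≡⟨ cong (V ^ q *_) (trans (^-distribˡ-+-* 2 m (m + m)) (cong (2 ^ m *_) (^-distribˡ-+-* 2 m m))) ⟨
  V ^ q * 2 ^ (m + (m + m))  ≤⟨ *-monoʳ-≤ (V ^ q) (^-mono-exp {2} (s≤s z≤n) fq≥) ⟩
  V ^ q * 2 ^ (f * q)  ≡⟨ cong (V ^ q *_) (^-*-assoc 2 f q) ⟨
  V ^ q * (2 ^ f) ^ q  ≡⟨ *-^ V (2 ^ f) q ⟨
  (V * 2 ^ f) ^ q  ∎)
  where
  q = 8 * y
  X = 2 * c̄ * q
  bX = b * X
  V = bX ^ n
  q≥1 : 1 ≤ q
  q≥1 = 1≤* {8} (s≤s z≤n) y≥1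
  2c̄≥1 : 1 ≤ 2 * c̄
  2c̄≥1 = 1≤* {2} (s≤s z≤n) c̄≥1
  X≥1 : 1 ≤ X
  X≥1 = 1≤* 2c̄≥1 q≥1
  id₁ : ∀ p v → p * (p * v * p) ≡ v * (p * (p * p))
  id₁ = solve-∀
  X≤ : (X ^ t) ^ q ≤ 2 ^ m
  X≤ = begin
    (X ^ t) ^ q  ≡⟨ ^-*-assoc X t q ⟩
    X ^ (t * q)  ≤⟨ ^-monoˡ-≤ (t * q) (<⇒≤ (<2^ X)) ⟩
    (2 ^ X) ^ (t * q)  ≡⟨ ^-*-assoc 2 X (t * q) ⟩
    2 ^ (X * (t * q))  ≤⟨ ^-mono-exp {2} (s≤s z≤n) (≤-trans (≤-reflexive (id₂ X t q)) Xqt≤m) ⟩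
    2 ^ m  ∎
    where
    id₂ : ∀ x t q → x * (t * q) ≡ x * q * t
    id₂ = solve-∀
  nX≤ : n * X ≤ c̄ * bX
  nX≤ = ≤-trans (*-monoˡ-≤ X n≤c̄b) (≤-reflexive (*-assoc c̄ b X))
  U≤ : ((bX + m) ^ n) ^ q ≤ 2 ^ m * V ^ q
  U≤ = ^-cancel-≤ 2c̄≥1 (begin
    (((bX + m) ^ n) ^ q) ^ (2 * c̄)  ≡⟨ fold (bX + m) ⟩
    (bX + m) ^ (n * X)  ≤⟨ [1+m/b]^n≤4^cm bX m (n * X) c̄ (1≤* b≥1 X≥1) nX≤ ⟩
    4 ^ (c̄ * m) * bX ^ (n * X)  ≡⟨ cong₂ _*_ (trans (4^≡2^2* (c̄ * m)) (trans (cong (2 ^_) (id₃ c̄ m)) (sym (^-*-assoc 2 m (2 * c̄))))) (sym (fold bX)) ⟩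
    (2 ^ m) ^ (2 * c̄) * (V ^ q) ^ (2 * c̄)  ≡⟨ *-^ (2 ^ m) (V ^ q) (2 * c̄) ⟨
    (2 ^ m * V ^ q) ^ (2 * c̄)  ∎)
    where
    id₃ : ∀ c m → 2 * (c * m) ≡ m * (2 * c)
    id₃ = solve-∀
    fold : ∀ x → ((x ^ n) ^ q) ^ (2 * c̄) ≡ x ^ (n * X)
    fold x = trans (^-*-assoc (x ^ n) q (2 * c̄)) (trans (^-*-assoc x n (q * (2 * c̄))) (cong (λ e → x ^ (n * e)) (*-comm q (2 * c̄))))
  fq≥ : m + (m + m) ≤ f * q
  fq≥ = +-cancelʳ-≤ (8 * y) _ _ (begin
    m + (m + m) + 8 * y  ≡⟨ id₄ m y ⟩
    m + (m + m) + 4 * (2 * y)  ≤⟨ +-monoʳ-≤ (m + (m + m)) (*-monoʳ-≤ 4 2y≤m) ⟩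
    m + (m + m) + 4 * m  ≤⟨ m≤m+n _ m ⟩
    m + (m + m) + 4 * m + m  ≡⟨ id₅ m ⟩
    8 * m  ≤⟨ *-monoʳ-≤ 8 m≤ ⟩
    8 * (suc f * y)  ≡⟨ id₆ f 8 y ⟩
    f * (8 * y) + 8 * y  ∎)
    where
    id₄ : ∀ m y → m + (m + m) + 8 * y ≡ m + (m + m) + 4 * (2 * y)
    id₄ = solve-∀
    id₅ : ∀ m → m + (m + m) + 4 * m + m ≡ 8 * m
    id₅ = solve-∀
    id₆ : ∀ f e y → e * (suc f * y) ≡ f * (e * y) + e * y
    id₆ = solve-∀

-- With `g = 2c̄x` the cost `4 ^ (c̄ m x)` is `2 ^ (m g)`, and `(2 ^ f) ^ g` is no larger. The tilt
-- `x = 2 ^ (8δ̄)` gains `2 ^ (8δ̄ j g)`, where `j` is about `m / 2δ̄`, so `8δ̄j ≥ 2m` even after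
-- rounding.
tilt-saving : ∀ m c̄ δ̄ f j → f ≤ m → 4 * δ̄ ≤ m → m ≤ suc j * (2 * δ̄) → let x = 2 ^ (8 * δ̄); g = 2 * (c̄ * x) in
  (2 ^ f) ^ g * 4 ^ (c̄ * (m * x)) ≤ x ^ (j * g)
tilt-saving m c̄ δ̄ f j f≤m 4δ̄≤m m≤ = begin
  (2 ^ f) ^ g * 4 ^ (c̄ * (m * x))  ≡⟨ cong₂ _*_ (^-*-assoc 2 f g) (4^≡2^2* (c̄ * (m * x))) ⟩
  2 ^ (f * g) * 2 ^ (2 * (c̄ * (m * x)))  ≡⟨ ^-distribˡ-+-* 2 (f * g) _ ⟨
  2 ^ (f * g + 2 * (c̄ * (m * x)))  ≤⟨ ^-mono-exp {2} (s≤s z≤n) exponents ⟩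
  2 ^ (8 * δ̄ * (j * g))  ≡⟨ ^-*-assoc 2 (8 * δ̄) (j * g) ⟨
  x ^ (j * g)  ∎
  where
  x = 2 ^ (8 * δ̄)
  g = 2 * (c̄ * x)
  id₁ : ∀ m c x → 2 * (c * (m * x)) ≡ m * (2 * (c * x))
  id₁ = solve-∀
  id₂ : ∀ m g → m * g + m * g ≡ (m + m) * g
  id₂ = solve-∀
  id₃ : ∀ δ j g → 8 * δ * j * g ≡ 8 * δ * (j * g)
  id₃ = λ δ j g → *-assoc (8 * δ) j g
  2m≤ : m + m ≤ 8 * δ̄ * j
  2m≤ = +-cancelʳ-≤ (2 * m) _ _ (begin
    m + m + 2 * m  ≡⟨ id₄ m ⟩
    4 * m  ≤⟨ *-monoʳ-≤ 4 m≤ ⟩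
    4 * (suc j * (2 * δ̄))  ≡⟨ id₅ δ̄ j ⟩
    8 * δ̄ * j + 2 * (4 * δ̄)  ≤⟨ +-monoʳ-≤ (8 * δ̄ * j) (*-monoʳ-≤ 2 4δ̄≤m) ⟩
    8 * δ̄ * j + 2 * m  ∎)
    where
    id₄ : ∀ m → m + m + 2 * m ≡ 4 * m
    id₄ = solve-∀
    id₅ : ∀ δ j → 4 * (suc j * (2 * δ)) ≡ 8 * δ * j + 2 * (4 * δ)
    id₅ = solve-∀
  exponents : f * g + 2 * (c̄ * (m * x)) ≤ 8 * δ̄ * (j * g)
  exponents = begin
    f * g + 2 * (c̄ * (m * x))  ≤⟨ +-mono-≤ (*-monoˡ-≤ g f≤m) (≤-reflexive (id₁ m c̄ x)) ⟩
    m * g + m * g  ≡⟨ id₂ m g ⟩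
    (m + m) * g  ≤⟨ *-monoˡ-≤ g 2m≤ ⟩
    8 * δ̄ * j * g  ≡⟨ id₃ δ̄ j g ⟩
    8 * δ̄ * (j * g)  ∎

small-saving : ∀ m b n β̄ f → 1 ≤ b → 1 ≤ m → m + b ≤ n → f * β̄ ≤ m → (2 ^ f) ^ β̄ * b ^ n ≤ (m + b) ^ n
small-saving m b n β̄ f b≥1 m≥1 N≤n fβ̄≤m = begin
  (2 ^ f) ^ β̄ * b ^ n  ≡⟨ cong (_* b ^ n) (^-*-assoc 2 f β̄) ⟩
  2 ^ (f * β̄) * b ^ n  ≤⟨ *-monoˡ-≤ (b ^ n) (^-mono-exp {2} (s≤s z≤n) fβ̄≤m) ⟩
  2 ^ m * b ^ n  ≤⟨ 2^m≤[1+m/b]^n b m n b≥1 m≥1 (≤-trans (≤-reflexive (+-comm b m)) N≤n) ⟩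
  (b + m) ^ n  ≡⟨ cong (_^ n) (+-comm b m) ⟩
  (m + b) ^ n  ∎

-- `t` is the number of picks that can be afforded and `D` is about `2n / t`, so that picks pruning
-- `D` vertices use at most half of the budget. The ledger needs `σ D`, at most the other half once
-- `t² ≥ 8σn` and `t ≥ 4σ`.
pick-budget : ∀ m n τ σ → 1 ≤ τ → τ ≤ m → 2 * τ * (4 * σ) ≤ m → 2 * τ * (2 * τ) * (8 * σ) * n ≤ m * m →
  ∃ λ t → ∃ λ D → t * τ ≤ m × 1 ≤ D × n + D * (σ * D) ≤ D * t
pick-budget m n τ σ τ≥1 τ≤m σ≤ n≤ with quotient m τ≥1
... | t , tτ≤m , m< with quotient (2 * n) (quotient≥1 t τ≤m m<)
...   | d , dt≤2n , 2n< = t , suc d , tτ≤m , s≤s z≤n , budget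
  where
  t≥1 = quotient≥1 t τ≤m m<
  D = suc d
  m≤2τt : m ≤ 2 * τ * t
  m≤2τt = begin
    m  ≤⟨ <⇒≤ m< ⟩
    τ + t * τ  ≤⟨ +-monoˡ-≤ (t * τ) (≤-trans (≤-reflexive (sym (*-identityˡ τ))) (*-monoˡ-≤ τ t≥1)) ⟩
    t * τ + t * τ  ≡⟨ id₁ t τ ⟩
    2 * τ * t  ∎
    where
    id₁ : ∀ t τ → t * τ + t * τ ≡ 2 * τ * t
    id₁ = solve-∀
  2τ≥1 : 1 ≤ 2 * τ
  2τ≥1 = 1≤* {2} (s≤s z≤n) τ≥1
  4σ≤t : 4 * σ ≤ t
  4σ≤t = cancelˡ 2τ≥1 (≤-trans σ≤ m≤2τt)
  8σn≤tt : 8 * σ * n ≤ t * t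
  8σn≤tt = cancelˡ (1≤* 2τ≥1 2τ≥1) (begin
    2 * τ * (2 * τ) * (8 * σ * n)  ≡⟨ *-assoc (2 * τ * (2 * τ)) (8 * σ) n ⟨
    2 * τ * (2 * τ) * (8 * σ) * n  ≤⟨ n≤ ⟩
    m * m  ≤⟨ *-mono-≤ m≤2τt m≤2τt ⟩
    2 * τ * t * (2 * τ * t)  ≡⟨ id₂ (2 * τ) t ⟩
    2 * τ * (2 * τ) * (t * t)  ∎)
    where
    id₂ : ∀ u t → u * t * (u * t) ≡ u * u * (t * t)
    id₂ = solve-∀
  2σD≤t : 2 * σ * D ≤ t
  2σD≤t = cancelʳ t≥1 (cancelˡ {2} (s≤s z≤n) (begin
    2 * (2 * σ * D * t)  ≡⟨ id₃ σ d t ⟩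
    4 * σ * (d * t) + 4 * σ * t  ≤⟨ +-mono-≤ (*-monoʳ-≤ (4 * σ) dt≤2n) (*-monoˡ-≤ t 4σ≤t) ⟩
    4 * σ * (2 * n) + t * t  ≡⟨ cong (_+ t * t) (id₄ σ n) ⟩
    8 * σ * n + t * t  ≤⟨ +-monoˡ-≤ (t * t) 8σn≤tt ⟩
    t * t + t * t  ≡⟨ cong (t * t +_) (+-identityʳ (t * t)) ⟨
    2 * (t * t)  ∎))
    where
    id₃ : ∀ σ d t → 2 * (2 * σ * suc d * t) ≡ 4 * σ * (d * t) + 4 * σ * t
    id₃ = solve-∀
    id₄ : ∀ σ n → 4 * σ * (2 * n) ≡ 8 * σ * n
    id₄ = solve-∀
  budget : n + D * (σ * D) ≤ D * t
  budget = cancelˡ {2} (s≤s z≤n) (begin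
    2 * (n + D * (σ * D))  ≡⟨ id₅ n D σ ⟩
    2 * n + D * (2 * σ * D)  ≤⟨ +-mono-≤ (<⇒≤ 2n<) (*-monoʳ-≤ D 2σD≤t) ⟩
    D * t + D * t  ≡⟨ cong (D * t +_) (+-identityʳ (D * t)) ⟨
    2 * (D * t)  ∎)
    where
    id₅ : ∀ n D σ → 2 * (n + D * (σ * D)) ≡ 2 * n + D * (2 * σ * D)
    id₅ = solve-∀

-- For `I = ⌊j / 4⌋ + 1` one has `I⁴ ≤ 2^j`: two factors `I` bound the square up to 16, and one more
-- beats `16κ`.
square≤2^ : ∀ κ j → 64 * κ ≤ j → κ * (suc j * suc j) ≤ 2 ^ j
square≤2^ κ j j-large with quotient j {4} (s≤s z≤n)
... | i , 4i≤j , j< = begin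
  κ * (suc j * suc j)  ≤⟨ *-monoʳ-≤ κ (*-mono-≤ j< j<) ⟩
  κ * (I * 4 * (I * 4))  ≡⟨ id₁ κ I ⟩
  16 * κ * (I * I)  ≤⟨ *-monoˡ-≤ (I * I) (≤-trans 16κ≤I (m≤m*n I I)) ⟩
  I * I * (I * I)  ≡⟨ id₂ I ⟩
  I ^ 4  ≤⟨ ^-monoˡ-≤ 4 (<2^ i) ⟩
  (2 ^ i) ^ 4  ≡⟨ ^-*-assoc 2 i 4 ⟩
  2 ^ (i * 4)  ≤⟨ ^-mono-exp {2} (s≤s z≤n) 4i≤j ⟩
  2 ^ j  ∎
  where
  I = suc i
  id₁ : ∀ κ I → κ * (I * 4 * (I * 4)) ≡ 16 * κ * (I * I)
  id₁ = solve-∀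
  id₂ : ∀ I → I * I * (I * I) ≡ I * (I * (I * (I * 1)))
  id₂ = solve-∀
  id₃ : ∀ κ → 4 * (16 * κ) ≡ 64 * κ
  id₃ κ = sym (*-assoc 4 16 κ)
  16κ≤I : 16 * κ ≤ I
  16κ≤I = cancelˡ {4} (s≤s z≤n) (begin
    4 * (16 * κ)  ≡⟨ id₃ κ ⟩
    64 * κ  ≤⟨ j-large ⟩
    j  ≤⟨ <⇒≤ j< ⟩
    I * 4  ≡⟨ *-comm I 4 ⟩
    4 * I  ∎)

dyadic : ∀ n → 1 ≤ n → ∃ λ j → 2 ^ j ≤ n × n < 2 ^ suc j
dyadic (suc zero)        _ = 0 , ≤-refl , ≤-refl
dyadic (suc n@(suc _)) _ with dyadic n (s≤s z≤n)
... | j , low , high with suc n <? 2 ^ suc j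
...   | yes small = j , m≤n⇒m≤1+n low , small
...   | no ¬small = suc j , ≮⇒≥ ¬small , +-mono-≤ (1≤^ {2} (suc j) (s≤s z≤n)) (≤-trans high (≤-reflexive (sym (+-identityʳ (2 ^ suc j)))))

≤2^log : ∀ n → n < 2 ^ suc ⌊log₂ n ⌋
≤2^log n = ≰⇒> λ h → <⇒≱ {⌊log₂ n ⌋} ≤-refl (≤-trans (≤-reflexive (sym (⌊log₂[2^n]⌋≡n (suc ⌊log₂ n ⌋)))) (⌊log₂⌋-mono-≤ h))

≤log : ∀ ρ n → 2 ^ ρ ≤ n → ρ ≤ ⌊log₂ n ⌋
≤log ρ n h = ≤-trans (≤-reflexive (sym (⌊log₂[2^n]⌋≡n ρ))) (⌊log₂⌋-mono-≤ h)

module _ (ρ c K q : ℕ) where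
  private
    base = q * (c + K)
    κ = base * base
    j₀ = 64 * κ

  -- The part `suc ρ` of the exponent forces `log n > ρ`, whence `ρ n ≤ n log n ≤ m²`. The part
  -- `suc j₀` lets `2^m` beat the polynomial factor, using only `m² ≥ n`.
  threshold : ℕ
  threshold = 2 ^ (suc ρ + suc j₀)

  threshold-large : ∀ n m → threshold ≤ n → n * ⌊log₂ n ⌋ ≤ m * m →
    ρ ≤ n × 1 ≤ ⌊log₂ n ⌋ × n ≤ 2 ^ (2 * ⌊log₂ n ⌋) × ρ ≤ m × ρ * n ≤ m * m × (c * n ^ K) ^ q ≤ 2 ^ m
  threshold-large n m n≥ nℓ≤ = ρ≤n , ℓ≥1 , n≤ , ρ≤m , ρn≤ , poly
    where
    ℓ = ⌊log₂ n ⌋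
    2^ρ≤n : 2 ^ suc ρ ≤ n
    2^ρ≤n = ≤-trans (^-mono-exp {2} (s≤s z≤n) (m≤m+n (suc ρ) (suc j₀))) n≥
    ρ≤n : ρ ≤ n
    ρ≤n = ≤-trans (<⇒≤ (<2^ ρ)) (≤-trans (^-mono-exp {2} (s≤s z≤n) (n≤1+n ρ)) 2^ρ≤n)
    ρ<ℓ : suc ρ ≤ ℓ
    ρ<ℓ = ≤log (suc ρ) n 2^ρ≤n
    ℓ≥1 : 1 ≤ ℓ
    ℓ≥1 = ≤-trans (s≤s z≤n) ρ<ℓ
    n≤ : n ≤ 2 ^ (2 * ℓ)
    n≤ = ≤-trans (<⇒≤ (≤2^log n)) (^-mono-exp {2} (s≤s z≤n) (≤-trans (+-monoˡ-≤ ℓ ℓ≥1) (≤-reflexive (cong (ℓ +_) (sym (+-identityʳ ℓ))))))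
    ρn≤ : ρ * n ≤ m * m
    ρn≤ = ≤-trans (≤-trans (≤-reflexive (*-comm ρ n)) (*-monoʳ-≤ n (<⇒≤ ρ<ℓ))) nℓ≤
    ρ≤m : ρ ≤ m
    ρ≤m = square-cancel-≤ (≤-trans (*-monoʳ-≤ ρ ρ≤n) ρn≤)
    n≤mm : n ≤ m * m
    n≤mm = ≤-trans (≤-trans (≤-reflexive (sym (*-identityʳ n))) (*-monoʳ-≤ n ℓ≥1)) nℓ≤
    n≥1 : 1 ≤ n
    n≥1 = ≤-trans (1≤^ {2} (suc ρ) (s≤s z≤n)) 2^ρ≤n
    poly : (c * n ^ K) ^ q ≤ 2 ^ m
    poly with dyadic n n≥1
    ... | j , low , high = begin
      (c * n ^ K) ^ q  ≤⟨ ^-monoˡ-≤ q (*-mono-≤ (<⇒≤ (<2^ c)) (^-monoˡ-≤ K (<⇒≤ high))) ⟩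
      (2 ^ c * (2 ^ suc j) ^ K) ^ q  ≡⟨ cong (λ t → (2 ^ c * t) ^ q) (^-*-assoc 2 (suc j) K) ⟩
      (2 ^ c * 2 ^ (suc j * K)) ^ q  ≡⟨ cong (_^ q) (^-distribˡ-+-* 2 c (suc j * K)) ⟨
      (2 ^ (c + suc j * K)) ^ q  ≡⟨ ^-*-assoc 2 (c + suc j * K) q ⟩
      2 ^ ((c + suc j * K) * q)  ≤⟨ ^-mono-exp {2} (s≤s z≤n) (≤-trans linear (square-cancel-≤ {base * suc j} {m} quadratic)) ⟩
      2 ^ m  ∎
      where
      linear : (c + suc j * K) * q ≤ base * suc j
      linear = begin
        (c + suc j * K) * q  ≤⟨ *-monoˡ-≤ q (+-monoˡ-≤ (suc j * K) (m≤m*n c (suc j))) ⟩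
        (c * suc j + suc j * K) * q  ≡⟨ id₁ c (suc j) K q ⟩
        base * suc j  ∎
        where
        id₁ : ∀ c j K q → (c * j + j * K) * q ≡ q * (c + K) * j
        id₁ = solve-∀
      j₀≤j : j₀ ≤ j
      j₀≤j = ≮⇒≥ λ h → <⇒≱ high (≤-trans (^-mono-exp {2} (s≤s z≤n) (≤-trans h (≤-trans (n≤1+n j₀) (m≤n+m (suc j₀) (suc ρ))))) n≥)
      quadratic : base * suc j * (base * suc j) ≤ m * m
      quadratic = begin
        base * suc j * (base * suc j)  ≡⟨ id₂ base (suc j) ⟩
        κ * (suc j * suc j)  ≤⟨ square≤2^ κ j j₀≤j ⟩
        2 ^ j  ≤⟨ low ⟩
        n  ≤⟨ n≤mm ⟩
        m * m  ∎
        where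
        id₂ : ∀ u v → u * v * (u * v) ≡ u * u * (v * v)
        id₂ = solve-∀

-- Bad sets at a fixed n

∑ˢ-pos : ∀ {n} (f : Subset n → ℕ) → 1 ≤ ∑ˢ f → ∃ λ S → 1 ≤ f S
∑ˢ-pos {zero}  f h = [] , h
∑ˢ-pos {suc n} f h with 1 ≤? ∑ˢ (f ∘ (outside ∷_))
... | yes p = let S , q = ∑ˢ-pos (f ∘ (outside ∷_)) p in outside ∷ S , q
... | no ¬p = let S , q = ∑ˢ-pos (f ∘ (inside ∷_)) (subst (λ t → 1 ≤ t + ∑ˢ (f ∘ (inside ∷_))) (n<1⇒n≡0 (≰⇒> ¬p)) h) in inside ∷ S , q

∣∩∁∣≡card : ∀ {n} (A B : Subset n) → ∣ A ∩ ∁ B ∣ ≡ card (lookup A ∖ lookup B)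
∣∩∁∣≡card A B = trans (∣∣≡card (A ∩ ∁ B)) (card-cong (λ x → trans (lookup-∩ A (∁ B) x) (cong (lookup A x ∧_) (lookup-map x not B))))

module Finite {n : ℕ} (H : Hypergraph3 n) (ℬ : Family n) (Δ : ℕ) (codeg : Δ₂≤ H Δ) (m : ℕ) where
  open FromHypergraph H
  private 𝓗 = tripleSystem Δ codeg
  open Triples 𝓗 using (Independent; link; link-loss)

  bad : Subset n → Bool
  bad I = isIndependent H I ∧ (∣ I ∣ ≡ᵇ m) ∧ not (any (λ B → ℬ B ∧ (I ⊆ᵇ B)) (allSubsets n))

  Bad : Subset n → Set
  Bad I = bad I ≡ true

  bad? : ∀ I → Dec (Bad I)
  bad? I = bad I Bool.≟ true

  Bad⇒Independent : ∀ I → Bad I → Independent I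
  Bad⇒Independent I p = isIndependent⇒Independent Δ codeg I (proj₁ (∧-split p))

  Bad⇒size : ∀ I → Bad I → card (lookup I) ≡ m
  Bad⇒size I p = trans (sym (∣∣≡card I)) (does-sound (∣ I ∣ ≟ m) (proj₁ (∧-split (proj₂ (∧-split {isIndependent H I} p)))))

  Bad⇒outside : ∀ I → Bad I → ∀ B → ℬ B ≡ true → 1 ≤ card (lookup I ∖ lookup B)
  Bad⇒outside I p B B∈ℬ = ≮⇒≥ λ none → true≢false
    (any-complete (λ B → ℬ B ∧ (I ⊆ᵇ B)) B (∧-join B∈ℬ (does-true (I ⊆? B) (λ {x} x∈I → lookup⇒∈ (member x (∈⇒lookup x∈I) (n<1⇒n≡0 none))))))
    (not-true (proj₂ (∧-split (proj₂ (∧-split {isIndependent H I} p)))))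
    where
    not-true : ∀ {b} → not b ≡ true → b ≡ false
    not-true {false} _ = refl
    member : ∀ x → lookup I x ≡ true → card (lookup I ∖ lookup B) ≡ 0 → lookup B x ≡ true
    member x x∈I empty = ¬-not λ x∉B → <⇒≱ {0} {1} ≤-refl (begin
      1  ≡⟨ 𝟙-true (∧-join x∈I (cong not x∉B)) ⟨
      𝟙 ((lookup I ∖ lookup B) x)  ≤⟨ term≤sum (𝟙 ∘ (lookup I ∖ lookup B)) x ⟩
      card (lookup I ∖ lookup B)  ≡⟨ empty ⟩
      0  ∎)

  -- `A` spans at least `n² / (K β̄)` edges, and the links of its vertices, counted inside `A`, sum
  -- to at least that; average over `n` vertices.
  dense-vertex : ∀ K β̄ (A : VSet n) → 1 ≤ n → n * n ≤ K * e H → e H ≤ β̄ * eInduced H (tabulate A) →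
    ∃ λ v → A v ≡ true × n ≤ K * β̄ * link A v
  dense-vertex K β̄ A n≥1 nn≤ dense = extract (pigeonhole (λ v → K * β̄ * (𝟙 (A v) * link A v)) n n≥1 (begin
    n * n  ≤⟨ nn≤ ⟩
    K * e H  ≤⟨ *-monoʳ-≤ K dense ⟩
    K * (β̄ * eInduced H (tabulate A))  ≡⟨ *-assoc K β̄ _ ⟨
    K * β̄ * eInduced H (tabulate A)  ≤⟨ *-monoʳ-≤ (K * β̄) (eInduced≤links Δ codeg A) ⟩
    K * β̄ * sum (λ v → 𝟙 (A v) * link A v)  ≡⟨ *-distribˡ-sum (K * β̄) (λ v → 𝟙 (A v) * link A v) ⟩
    sum (λ v → K * β̄ * (𝟙 (A v) * link A v))  ∎))
    where
    vanish : ∀ c l → n ≤ c * (0 * l) → ⊥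
    vanish c l h = <⇒≱ n≥1 (≤-trans h (≤-reflexive (*-zeroʳ c)))
    extract : (∃ λ v → n ≤ K * β̄ * (𝟙 (A v) * link A v)) → ∃ λ v → A v ≡ true × n ≤ K * β̄ * link A v
    extract (v , h) = [ (λ v∈A → v , v∈A , ≤-trans h (≤-reflexive (cong (K * β̄ *_) (trans (cong (λ i → 𝟙 i * link A v) v∈A) (*-identityˡ (link A v))))))
                      , (λ v∉A → ⊥-elim (vanish (K * β̄) (link A v) (subst (λ i → n ≤ K * β̄ * (𝟙 i * link A v)) v∉A h))) ]′ (dichotomy (A v))

  Independent⇒link≡0 : ∀ I v → Independent I → lookup I v ≡ true → link (lookup I) v ≡ 0
  Independent⇒link≡0 I v ind v∈I = sum≡0 λ x → sum≡0 λ y → cong 𝟙 (¬-not λ p →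
    let x∈I , q = ∧-split p ; y∈I , r = ∧-split q in true≢false r (ind v x y v∈I x∈I y∈I))

  -- An independent set meeting the outside of B misses a positive proportion of B.
  Bad⇒gap : ∀ k g K β̄ N → 1 ≤ n → 1 ≤ k → 1 ≤ Δ → 1 ≤ β̄ → 4 * (k * Δ) ≡ g →
    n * n ≤ K * e H → (∀ B → ℬ B ≡ true → card (lookup B) ≤ N) →
    (∀ B → ℬ B ≡ true → ∀ v → lookup B v ≡ false → n ≤ k * link (lookup B) v) →
    (∀ A → β̄ * N ≤ β̄ * card A + n → e H ≤ β̄ * eInduced H (tabulate A) ⊎ ∃ λ B → ℬ B ≡ true × g * card (A ∖ lookup B) ≤ n) →
    ∀ I → Bad I → ∃ λ b → N ≡ m + b × n ≤ (g + β̄) * b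
  Bad⇒gap k g K β̄ N n≥1 k≥1 Δ≥1 β̄≥1 g≡ nn≤ Bound links stable I p = decide (β̄ * N ≤? β̄ * m + n)
    where
    g≥1 : 1 ≤ g
    g≥1 = ≤-trans (1≤* {4} (s≤s z≤n) (1≤* k≥1 Δ≥1)) (≤-reflexive g≡)
    cI = Bad⇒size I p
    separate : ∀ κ → 1 ≤ κ → κ ≤ g + β̄ → κ * m + n ≤ κ * N → ∃ λ b → N ≡ m + b × n ≤ (g + β̄) * b
    separate κ κ≥1 κ≤ h =
      let b , eq = ≤⇒+ {m} {N} (cancelˡ κ≥1 (≤-trans (m≤m+n (κ * m) n) h))
      in b , eq , ≤-trans (+-cancelˡ-≤ (κ * m) _ _ (≤-trans h (≤-reflexive (trans (cong (κ *_) eq) (*-distribˡ-+ κ m b))))) (*-monoˡ-≤ b κ≤)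
    close : (∃ λ B → ℬ B ≡ true × g * card (lookup I ∖ lookup B) ≤ n) → g * m + n ≤ g * N
    -- `g = 4kΔ` absorbs two copies of `missing`: `g r ≥ 2n` while `g s ≤ n`, and the surplus `n` is
    -- the gap.
    close (B , B∈ℬ , near) = +-cancelʳ-≤ n _ _ (begin
      g * m + n + n  ≤⟨ ≤-reflexive (+-assoc (g * m) n n) ⟩
      g * m + (n + n)  ≤⟨ +-monoʳ-≤ (g * m) (+-mono-≤ missing missing) ⟩
      g * m + (k * (2 * (Δ * r)) + k * (2 * (Δ * r)))  ≡⟨ cong (g * m +_) (trans (id₁ k Δ r) (cong (_* r) g≡)) ⟩
      g * m + g * r  ≡⟨ *-distribˡ-+ g m r ⟨
      g * (m + r)  ≤⟨ *-monoʳ-≤ g exchange ⟩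
      g * (N + s)  ≡⟨ *-distribˡ-+ g N s ⟩
      g * N + g * s  ≤⟨ +-monoʳ-≤ (g * N) near ⟩
      g * N + n  ∎)
      where
      r = card (lookup B ∖ lookup I)
      s = card (lookup I ∖ lookup B)
      id₁ : ∀ k Δ r → k * (2 * (Δ * r)) + k * (2 * (Δ * r)) ≡ 4 * (k * Δ) * r
      id₁ = solve-∀
      witness = sum-pos (𝟙 ∘ (lookup I ∖ lookup B)) (Bad⇒outside I p B B∈ℬ)
      v = proj₁ witness
      v∈ = ∧-split {lookup I v} (𝟙-pos (proj₂ witness))
      v∉B : lookup B v ≡ false
      v∉B = ¬-not λ v∈B → true≢false (proj₂ v∈) (cong not v∈B)
      missing : n ≤ k * (2 * (Δ * r))
      missing = ≤-trans (links B B∈ℬ v v∉B) (*-monoʳ-≤ k (≤-trans (link-loss (lookup I) (lookup B) v)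
        (≤-reflexive (cong (_+ 2 * (Δ * r)) (Independent⇒link≡0 I v (Bad⇒Independent I p) (proj₁ v∈))))))
      exchange : m + r ≤ N + s
      exchange = begin
        m + r  ≡⟨ cong (_+ r) (trans (sym cI) (card-split (lookup I) (lookup B))) ⟩
        card (λ x → lookup I x ∧ lookup B x) + s + r  ≡⟨ cong (λ t → t + s + r) (card-cong (λ x → ∧-comm (lookup I x) (lookup B x))) ⟩
        card (λ x → lookup B x ∧ lookup I x) + s + r  ≡⟨ id₂ _ s r ⟩
        card (λ x → lookup B x ∧ lookup I x) + r + s  ≡⟨ cong (_+ s) (card-split (lookup B) (lookup I)) ⟨
        card (lookup B) + s  ≤⟨ +-monoˡ-≤ s (Bound B B∈ℬ) ⟩
        N + s  ∎
        where
        id₂ : ∀ p q r → p + q + r ≡ p + r + q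
        id₂ = solve-∀
    no-dense : e H ≤ β̄ * eInduced H (tabulate (lookup I)) → ⊥
    no-dense dense =
      let v , v∈I , n≤ = dense-vertex K β̄ (lookup I) n≥1 nn≤ dense
      in <⇒≱ n≥1 (≤-trans n≤ (≤-reflexive (trans (cong (K * β̄ *_) (Independent⇒link≡0 I v (Bad⇒Independent I p) v∈I)) (*-zeroʳ (K * β̄)))))
    decide : Dec (β̄ * N ≤ β̄ * m + n) → ∃ λ b → N ≡ m + b × n ≤ (g + β̄) * b
    decide (no small)  = separate β̄ β̄≥1 (m≤n+m β̄ g) (<⇒≤ (≰⇒> small))
    decide (yes large) = separate g g≥1 (m≤m+n g β̄)
      (close ([ (λ dense → ⊥-elim (no-dense dense)) , (λ near → near) ]′
        (stable (lookup I) (subst (λ t → β̄ * N ≤ β̄ * t + n) (sym cI) large))))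

  many-independent : ∀ N J → isIndependent H J ≡ true → N ≤ ∣ J ∣ → N choose m ≤ numIndep H m
  many-independent N J ind N≤ = begin
    N choose m  ≤⟨ C-mono m (≤-trans N≤ (≤-reflexive (∣∣≡card J))) ⟩
    card (lookup J) choose m  ≡⟨ count-subsets J m ⟨
    ∑ˢ (λ I → 𝟙 (contained I J ∧ does (card (lookup I) ≟ m)))  ≤⟨ ∑ˢ-mono (λ I → 𝟙-mono (λ p →
      let sub , size = ∧-split p
      in ∧-join (isIndependent-mono I J (contained-sound I J sub) ind)
                (does-true (∣ I ∣ ≟ m) (trans (∣∣≡card I) (does-sound (card (lookup I) ≟ m) size))))) ⟩
    ∑ˢ (λ I → 𝟙 (isIndependent H I ∧ (∣ I ∣ ≡ᵇ m)))  ≡⟨ count≡∑ˢ (λ I → isIndependent H I ∧ (∣ I ∣ ≡ᵇ m)) ⟨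
    numIndep H m  ∎

  module _ (b : ℕ) (m≥1 : 1 ≤ m) (b≥1 : 1 ≤ b) (N≤n : m + b ≤ n) where
    open Weighted {n} m b
    private N = m + b

    mass-bad : mass bad? * b ^ m ≡ numIndepBad H ℬ m * (m ^ m * b ^ n)
    mass-bad = begin-equality
      mass bad? * b ^ m  ≡⟨ ∑ˢ-*ʳ (λ I → 𝟙 (does (bad? I)) * weight I) (b ^ m) ⟩
      ∑ˢ (λ I → 𝟙 (does (bad? I)) * weight I * b ^ m)  ≡⟨ ∑ˢ-cong pt ⟩
      ∑ˢ (λ I → 𝟙 (bad I) * (m ^ m * b ^ n))  ≡⟨ ∑ˢ-*ʳ (𝟙 ∘ bad) (m ^ m * b ^ n) ⟨
      ∑ˢ (𝟙 ∘ bad) * (m ^ m * b ^ n)  ≡⟨ cong (_* (m ^ m * b ^ n)) (count≡∑ˢ bad) ⟨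
      numIndepBad H ℬ m * (m ^ m * b ^ n)  ∎
      where
      pt′ : ∀ i ω M → (i ≡ true → ω * b ^ m ≡ M) → 𝟙 (does (i Bool.≟ true)) * ω * b ^ m ≡ 𝟙 i * M
      pt′ false ω M _ = refl
      pt′ true  ω M h = trans (cong (_* b ^ m) (+-identityʳ ω)) (trans (h refl) (sym (+-identityʳ M)))
      pt : ∀ I → 𝟙 (does (bad? I)) * weight I * b ^ m ≡ 𝟙 (bad I) * (m ^ m * b ^ n)
      pt I = pt′ (bad I) (weight I) (m ^ m * b ^ n) λ p →
        subst (λ s → weight I * b ^ s ≡ m ^ s * b ^ n) (Bad⇒size I p) (weight-card I)

    -- All sets of size `m` have the same weight, so by `mass-bad` the mass is a multiple of the
    -- count. The factor `suc n` pays for the `N + 1` layers in `modal-term`.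
    bad-vs-binomial : ∀ k → k * suc n * (b ^ N * mass bad?) ≤ N ^ N * b ^ n → k * numIndepBad H ℬ m ≤ N choose m
    bad-vs-binomial k h = cancelˡ {suc n * (m ^ m * b ^ b)} (1≤* {suc n} (s≤s z≤n) (1≤* (1≤^ m m≥1) (1≤^ b b≥1)))
      (cancelʳ (1≤* (1≤^ m b≥1) (1≤^ n b≥1)) (begin
        suc n * (m ^ m * b ^ b) * (k * R) * (b ^ m * b ^ n)  ≡⟨ id₁ (suc n) (m ^ m) (b ^ b) k R (b ^ m) (b ^ n) ⟩
        k * suc n * (b ^ m * b ^ b * (R * (m ^ m * b ^ n)))  ≡⟨ cong₂ (λ s t → k * suc n * (s * t)) (^-distribˡ-+-* b m b) mass-bad ⟨
        k * suc n * (b ^ N * (mass bad? * b ^ m))  ≡⟨ id₂ (k * suc n) (b ^ N) (mass bad?) (b ^ m) ⟩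
        k * suc n * (b ^ N * mass bad?) * b ^ m  ≤⟨ *-monoˡ-≤ (b ^ m) h ⟩
        N ^ N * b ^ n * b ^ m  ≤⟨ *-monoˡ-≤ (b ^ m) (*-monoˡ-≤ (b ^ n) (≤-trans (modal-term m b) (*-monoˡ-≤ (N choose m * (m ^ m * b ^ b)) (s≤s N≤n)))) ⟩
        suc n * (N choose m * (m ^ m * b ^ b)) * b ^ n * b ^ m  ≡⟨ id₃ (suc n) (N choose m) (m ^ m * b ^ b) (b ^ n) (b ^ m) ⟩
        suc n * (m ^ m * b ^ b) * N choose m * (b ^ m * b ^ n)  ∎))
      where
      R = numIndepBad H ℬ m
      id₁ : ∀ s p q k R u v → s * (p * q) * (k * R) * (u * v) ≡ k * s * (u * q * (R * (p * v)))
      id₁ = solve-∀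
      id₂ : ∀ k B M u → k * (B * (M * u)) ≡ k * (B * M) * u
      id₂ = solve-∀
      id₃ : ∀ s c p v u → s * (c * p) * v * u ≡ s * p * c * (u * v)
      id₃ = solve-∀

    module Split (δ̄ : ℕ) where
      Near : Subset n → Set
      Near I = ∃ λ B → ℬ B ≡ true × δ̄ * card (lookup I ∖ lookup B) ≤ m

      near? : ∀ I → Dec (Near I)
      near? I = anySubset? (λ B → (ℬ B Bool.≟ true) ×-dec (δ̄ * card (lookup I ∖ lookup B) ≤? m))

      BadNear BadFar : Subset n → Set
      BadNear I = Bad I × Near I
      BadFar I = Bad I × ¬ Near I

      badNear? : ∀ I → Dec (BadNear I)
      badNear? I = bad? I ×-dec near? I

      badFar? : ∀ I → Dec (BadFar I)
      badFar? I = bad? I ×-dec ¬? (near? I)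

      combine : ∀ k → let v = 2 * (k * suc n) in
        v * (b ^ N * mass badFar?) ≤ N ^ N * b ^ n → v * (b ^ N * mass badNear?) ≤ N ^ N * b ^ n →
        k * numIndepBad H ℬ m ≤ N choose m
      combine k far near = bad-vs-binomial k (cancelˡ {2} (s≤s z≤n) (begin
        2 * (k * suc n * (b ^ N * mass bad?))  ≡⟨ *-assoc 2 (k * suc n) _ ⟨
        2 * (k * suc n) * (b ^ N * mass bad?)  ≤⟨ *-monoʳ-≤ (2 * (k * suc n)) (*-monoʳ-≤ (b ^ N) (mass-split bad? badFar? badNear? cases)) ⟩
        2 * (k * suc n) * (b ^ N * (mass badFar? + mass badNear?))  ≡⟨ id₁ (2 * (k * suc n)) (b ^ N) (mass badFar?) (mass badNear?) ⟩
        2 * (k * suc n) * (b ^ N * mass badFar?) + 2 * (k * suc n) * (b ^ N * mass badNear?)  ≤⟨ +-mono-≤ far near ⟩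
        N ^ N * b ^ n + N ^ N * b ^ n  ≡⟨ cong (N ^ N * b ^ n +_) (+-identityʳ (N ^ N * b ^ n)) ⟨
        2 * (N ^ N * b ^ n)  ∎))
        where
        id₁ : ∀ w c p q → w * (c * (p + q)) ≡ w * (c * p) + w * (c * q)
        id₁ = solve-∀
        by : ∀ I → Bad I → Dec (Near I) → BadFar I ⊎ BadNear I
        by I p (yes q) = inj₂ (p , q)
        by I p (no ¬q) = inj₁ (p , ¬q)
        cases : ∀ I → Bad I → BadFar I ⊎ BadNear I
        cases I p = by I p (near? I)

-- The far and the near estimate with their parameters

module Estimates {n : ℕ} (H : Hypergraph3 n) (ℬ : Family n) (Δ : ℕ) (codeg : Δ₂≤ H Δ) (m b : ℕ)
  (m≥1 : 1 ≤ m) (b≥1 : 1 ≤ b) (N≤n : m + b ≤ n) (Δ≥1 : 1 ≤ Δ) (c̄ : ℕ) (c̄≥1 : 1 ≤ c̄) (n≤c̄b : n ≤ c̄ * b)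
  (Bound : ∀ B → ℬ B ≡ true → card (lookup B) ≤ m + b) where
  open FromHypergraph H
  open Finite H ℬ Δ codeg m
  open Weighted {n} m b using (mass)
  private
    𝓗 = tripleSystem Δ codeg
    N = m + b
    n≥1 : 1 ≤ n
    n≥1 = ≤-trans (≤-trans m≥1 (m≤m+n m b)) N≤n
  open Triples 𝓗 using (link)

  -- `τ` is the product of two requirements on the number `t` of picks: `X · 8β̄ · t ≤ m` for
  -- `container-saving`, and `2δ̄ t ≤ m` so that the picks cannot use up more than half of `I ∖ B`.
  -- `σ` is the ledger constant `6kΔ` with `k = K β̄` supplied by `dense-vertex`.
  far-part : ∀ K β̄ δ̄ v → let X = 2 * c̄ * (8 * β̄); τ = X * (8 * β̄) * (2 * δ̄); σ = 6 * (K * β̄ * Δ); g = 2 * (c̄ * 2 ^ (8 * δ̄)) in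
    1 ≤ β̄ → 1 ≤ δ̄ → n * n ≤ K * e H →
    (∀ A → β̄ * N ≤ β̄ * card A + n → e H ≤ β̄ * eInduced H (tabulate A) ⊎ ∃ λ B → ℬ B ≡ true × g * card (A ∖ lookup B) ≤ n) →
    τ ≤ m → 2 * τ * (4 * σ) ≤ m → 2 * τ * (2 * τ) * (8 * σ) * n ≤ m * m → 2 * β̄ ≤ m → 4 * δ̄ ≤ m → v ^ (8 * β̄) ≤ 2 ^ m →
    v * (b ^ N * mass (Split.badFar? b m≥1 b≥1 N≤n δ̄)) ≤ N ^ N * b ^ n
  far-part K β̄ δ̄ v β̄≥1 δ̄≥1 nn≤ stable τ≤m σ≤m σn≤mm 2β̄≤m 4δ̄≤m v≤ =
    let t , D , tτ≤m , D≥1 , budget = pick-budget m n τ σ τ≥1 τ≤m σ≤m σn≤mm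
        f , fβ̄≤m , m<f = quotient m β̄≥1
        j , jδ≤m , m<j = quotient m {2 * δ̄} 2δ̄≥1
    in far-mass b≥1 Bound (K * β̄) D X t β̄ (2 ^ f) (2 ^ (8 * δ̄)) j g c̄ v Δ≥1 n≥1 D≥1 X≥1
         (≤-trans (≤-reflexive (cong (λ s → n + D * s) (id₁ (K * β̄) Δ D))) budget)
         β̄≥1 (small-saving m b n β̄ f b≥1 m≥1 N≤n fβ̄≤m)
         (1≤^ {2} (8 * δ̄) (s≤s z≤n)) g≥1 n≤c̄b
         (tilt-saving m c̄ δ̄ f j (≤-trans (m≤m*n f β̄ {{>-nonZero β̄≥1}}) fβ̄≤m) 4δ̄≤m (<⇒≤ m<j))
         δ̄≥1 (≤-trans (≤-reflexive (*-comm (2 * δ̄) j)) jδ≤m)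
         (≤-trans (*-monoˡ-≤ t (m≤n*m (2 * δ̄) (X * (8 * β̄)) {{>-nonZero Xq≥1}})) (≤-trans (≤-reflexive (*-comm τ t)) tτ≤m))
         (1≤^ {2} f (s≤s z≤n))
         (λ A large → [ (λ dense → inj₁ (dense-vertex K β̄ A n≥1 nn≤ dense)) , inj₂ ]′ (stable A large))
         (container-saving m b n c̄ β̄ f t v b≥1 c̄≥1 β̄≥1 n≤c̄b
           (≤-trans (*-monoˡ-≤ t (m≤m*n (X * (8 * β̄)) (2 * δ̄) {{>-nonZero 2δ̄≥1}})) (≤-trans (≤-reflexive (*-comm τ t)) tτ≤m))
           2β̄≤m (<⇒≤ m<f) v≤)
    where
    X = 2 * c̄ * (8 * β̄)
    τ = X * (8 * β̄) * (2 * δ̄)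
    σ = 6 * (K * β̄ * Δ)
    g = 2 * (c̄ * 2 ^ (8 * δ̄))
    8β̄≥1 : 1 ≤ 8 * β̄
    8β̄≥1 = 1≤* {8} (s≤s z≤n) β̄≥1
    X≥1 : 1 ≤ X
    X≥1 = 1≤* (1≤* {2} (s≤s z≤n) c̄≥1) 8β̄≥1
    Xq≥1 : 1 ≤ X * (8 * β̄)
    Xq≥1 = 1≤* X≥1 8β̄≥1
    2δ̄≥1 : 1 ≤ 2 * δ̄
    2δ̄≥1 = 1≤* {2} (s≤s z≤n) δ̄≥1
    τ≥1 : 1 ≤ τ
    τ≥1 = 1≤* Xq≥1 2δ̄≥1
    g≥1 : 1 ≤ g
    g≥1 = 1≤* {2} (s≤s z≤n) (1≤* c̄≥1 (1≤^ {2} (8 * δ̄) (s≤s z≤n)))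
    id₁ : ∀ k Δ D → 6 * (k * (Δ * D)) ≡ 6 * (k * Δ) * D
    id₁ = solve-∀
    open FarMass 𝓗 ℬ m b (Split.BadFar b m≥1 b≥1 N≤n δ̄) (Split.badFar? b m≥1 b≥1 N≤n δ̄)
      (λ I p → Bad⇒Independent I (proj₁ p)) δ̄
      (λ I p B B∈ℬ → <⇒≤ (≰⇒> λ near → proj₂ p (B , B∈ℬ , near)))

  -- `δ̄ = X · 8y` is what `container-saving` demands of `j = ⌊m / δ̄⌋` exceptional vertices. In
  -- `w`, the 2 is for the capped and uncapped sets `S` and `F` for the choice of `B`.
  near-part : ∀ k c ε ℓ F v → let d = 2 * (k * Δ); y = 4 * ε; X = 2 * c̄ * (8 * y); δ̄ = X * (8 * y); w = 2 * F * v in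
    1 ≤ k → 4 * d * 5 ≤ ε → 4 * d ≤ n → 4 * ε ≤ m → 2 * y ≤ m → 1 ≤ ℓ → n ≤ 2 ^ (2 * ℓ) →
    d * ε * suc (2 * (2 + c)) * n * ℓ ≤ m * m →
    (∀ B → ℬ B ≡ true → ∀ u → lookup B u ≡ false → n ≤ k * link (lookup B) u) →
    1 ≤ F → familySize ℬ ≤ F → w ^ (8 * y) ≤ 2 ^ m → w * 4 ≤ n ^ c →
    v * (b ^ N * mass (Split.badNear? b m≥1 b≥1 N≤n δ̄)) ≤ N ^ N * b ^ n
  near-part k c ε ℓ F v k≥1 ε≥ 4d≤n 4ε≤m 2y≤m ℓ≥1 n≤ C-large links F≥1 size w≤ poly =
    let f , fy≤m , m<f = quotient m y≥1
        j , jδ̄≤m , m<j = quotient m δ̄≥1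
    in near-mass k c ε ℓ X j f w m≥1 b≥1 X≥1 N≤n d≥1 ε≥ 4d≤n 4ε≤m ℓ≥1 n≤ C-large Bound links
         (≤-trans (≤-reflexive (*-comm y f)) fy≤m)
         (λ s small → s≤s⁻¹ (*-cancelʳ-<′ δ̄ (≤-<-trans (≤-trans (≤-reflexive (*-comm s δ̄)) small) m<j)))
         (container-saving m b n c̄ y f j w b≥1 c̄≥1 y≥1 n≤c̄b (≤-trans (≤-reflexive (*-comm δ̄ j)) jδ̄≤m) 2y≤m (<⇒≤ m<f) w≤)
         poly F v F≥1 (≤-trans (≤-reflexive (sym (count≡∑ˢ ℬ))) size) refl
    where
    d = 2 * (k * Δ)
    y = 4 * ε
    X = 2 * c̄ * (8 * y)
    δ̄ = X * (8 * y)
    w = 2 * F * v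
    d≥1 : 1 ≤ d
    d≥1 = 1≤* {2} (s≤s z≤n) (1≤* k≥1 Δ≥1)
    y≥1 : 1 ≤ y
    y≥1 = 1≤* {4} (s≤s z≤n) (≤-trans (1≤* (1≤* {4} (s≤s z≤n) d≥1) (s≤s z≤n)) ε≥)
    8y≥1 : 1 ≤ 8 * y
    8y≥1 = 1≤* {8} (s≤s z≤n) y≥1
    X≥1 : 1 ≤ X
    X≥1 = 1≤* (1≤* {2} (s≤s z≤n) c̄≥1) 8y≥1
    δ̄≥1 : 1 ≤ δ̄
    δ̄≥1 = 1≤* X≥1 8y≥1
    near-witness : ∀ I → Split.BadNear b m≥1 b≥1 N≤n δ̄ I →
      ∃ λ B → ℬ B ≡ true × 1 ≤ card (lookup I ∖ lookup B) × δ̄ * card (lookup I ∖ lookup B) ≤ m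
    near-witness I (p , B , B∈ℬ , near) = B , B∈ℬ , Bad⇒outside I p B B∈ℬ , near
    open NearMass 𝓗 ℬ m b (Split.BadNear b m≥1 b≥1 N≤n δ̄) (Split.badNear? b m≥1 b≥1 N≤n δ̄)
      (λ I p → Bad⇒Independent I (proj₁ p)) δ̄
      near-witness

-- Assembly of the constants

module Assembly (H : (n : ℕ) → Hypergraph3 n) (ℬ : (n : ℕ) → Family n) (K K₃ Δ k : ℕ) (Δ≥1 : 1 ≤ Δ) (k≥1 : 1 ≤ k)
  (norm≤ : ∀ n → familyNorm (ℬ n) ≤ independenceNumber (H n)) where

  StableAt : ℕ → ℕ → Set
  StableAt g β̄ = ∀ n (A : Subset n) → β̄ * familyNorm (ℬ n) ≤ β̄ * ∣ A ∣ + n →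
    e (H n) ≤ β̄ * eInduced (H n) A ⊎ ∃ λ B → ℬ n B ≡ true × g * ∣ A ∩ ∁ B ∣ ≤ n

  stable-VSet : ∀ g β̄ → StableAt g β̄ → ∀ n (A : VSet n) → β̄ * familyNorm (ℬ n) ≤ β̄ * card A + n →
    e (H n) ≤ β̄ * eInduced (H n) (tabulate A) ⊎ ∃ λ B → ℬ n B ≡ true × g * card (A ∖ lookup B) ≤ n
  stable-VSet g β̄ stable n A large =
    [ inj₁ , (λ { (B , B∈ℬ , near) → inj₂ (B , B∈ℬ , subst (λ t → g * t ≤ n) (size∖ B) near) }) ]′
      (stable n (tabulate A) (subst (λ t → β̄ * familyNorm (ℬ n) ≤ β̄ * t + n) (sym size) large))
    where
    size : ∣ tabulate A ∣ ≡ card A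
    size = trans (∣∣≡card (tabulate A)) (card-cong (lookup∘tabulate A))
    size∖ : ∀ B → ∣ tabulate A ∩ ∁ B ∣ ≡ card (A ∖ lookup B)
    size∖ B = trans (∣∩∁∣≡card (tabulate A) B) (card-cong (λ x → cong (_∧ not (lookup B x)) (lookup∘tabulate A x)))

  -- `ε` comes from `near-parameters`, `g₀` from `Bad⇒gap`, and `C₀` is the requirement of
  -- `uncapped-rate` when `n ^ (2 + c)` must be saved per exceptional vertex. The exponent
  -- `c = 2 + K₃` covers the family size, the factor `n + 1` and constants.
  d ε g₀ c C₀ : ℕ
  d = 2 * (k * Δ)
  ε = 4 * d * 5
  g₀ = 4 * (k * Δ)
  c = 2 + K₃
  C₀ = d * ε * suc (2 * (2 + c))

  d≥1 : 1 ≤ d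
  d≥1 = 1≤* {2} (s≤s z≤n) (1≤* k≥1 Δ≥1)

  ε≥1 : 1 ≤ ε
  ε≥1 = 1≤* (1≤* {4} (s≤s z≤n) d≥1) (s≤s z≤n)

  C₀≥1 : 1 ≤ C₀
  C₀≥1 = 1≤* (1≤* d≥1 ε≥1) (s≤s z≤n)

  module Stage₁ (β₀ : ℕ) (β₀≥1 : 1 ≤ β₀) (stable₀ : StableAt g₀ β₀) where

    c̄ y X δ̄ g : ℕ
    c̄ = g₀ + β₀
    y = 4 * ε
    X = 2 * c̄ * (8 * y)
    δ̄ = X * (8 * y)
    g = 2 * (c̄ * 2 ^ (8 * δ̄))

    c̄≥1 : 1 ≤ c̄
    c̄≥1 = ≤-trans β₀≥1 (m≤n+m β₀ g₀)

    y≥1 : 1 ≤ y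
    y≥1 = 1≤* {4} (s≤s z≤n) ε≥1

    δ̄≥1 : 1 ≤ δ̄
    δ̄≥1 = 1≤* (1≤* (1≤* {2} (s≤s z≤n) c̄≥1) (1≤* {8} (s≤s z≤n) y≥1)) (1≤* {8} (s≤s z≤n) y≥1)

    g≥1 : 1 ≤ g
    g≥1 = 1≤* {2} (s≤s z≤n) (1≤* c̄≥1 (1≤^ {2} (8 * δ̄) (s≤s z≤n)))

    module Stage₂ (β̄ : ℕ) (β̄≥1 : 1 ≤ β̄) (stable : StableAt g β̄) (κ : ℕ) (κ≥1 : 1 ≤ κ) where

      -- `ρ` adds up all lower bounds that the estimates impose on `n`, on `m` and on `m² / n`, so
      -- that one threshold serves them all.
      τ σ ρ : ℕ
      τ = 2 * c̄ * (8 * β̄) * (8 * β̄) * (2 * δ̄)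
      σ = 6 * (K * β̄ * Δ)
      ρ = 1 + (4 * d + (4 * ε + (2 * y + (τ + (2 * τ * (4 * σ) + (2 * τ * (2 * τ) * (8 * σ) + (2 * β̄ + (4 * δ̄ + 32 * κ))))))))

      T₁ T₂ : ℕ
      T₁ = threshold ρ (8 * κ) (suc K₃) (8 * y)
      T₂ = threshold ρ (8 * κ) (suc K₃) (8 * β̄)

      module _ (n : ℕ) (n≥T₁ : T₁ ≤ n) (n≥T₂ : T₂ ≤ n) (nn≤ : n * n ≤ K * e (H n)) (codeg : Δ₂≤ (H n) Δ)
        (size : familySize (ℬ n) ≤ n ^ K₃)
        (degrees : ∀ B → ℬ n B ≡ true → ∀ v → v ∉ B → n ≤ k * degB (H n) B v)
        (m : ℕ) (m-large : C₀ * C₀ * n * ⌊log₂ n ⌋ ≤ m * m) where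
        open FromHypergraph (H n)
        open Finite (H n) (ℬ n) Δ codeg m
        open Triples (tripleSystem Δ codeg) using (link)
        private
          ℓ = ⌊log₂ n ⌋
          N = familyNorm (ℬ n)

        C-large : C₀ * n * ℓ ≤ m * m
        C-large = ≤-trans (*-monoˡ-≤ ℓ (*-monoˡ-≤ n (≤-trans (≤-reflexive (sym (*-identityʳ C₀))) (*-monoʳ-≤ C₀ C₀≥1)))) m-large

        nℓ≤mm : n * ℓ ≤ m * m
        nℓ≤mm = ≤-trans (*-monoˡ-≤ ℓ (≤-trans (≤-reflexive (sym (*-identityˡ n))) (*-monoˡ-≤ n C₀≥1))) C-large

        large₁ = threshold-large ρ (8 * κ) (suc K₃) (8 * y) n m n≥T₁ nℓ≤mm
        large₂ = threshold-large ρ (8 * κ) (suc K₃) (8 * β̄) n m n≥T₂ nℓ≤mm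

        ρ≤n : ρ ≤ n
        ρ≤n = proj₁ large₁

        ρ≤m : ρ ≤ m
        ρ≤m = proj₁ (proj₂ (proj₂ (proj₂ large₁)))

        ρn≤mm : ρ * n ≤ m * m
        ρn≤mm = proj₁ (proj₂ (proj₂ (proj₂ (proj₂ large₁))))

        n≥1 : 1 ≤ n
        n≥1 = ≤-trans (m≤m+n 1 _) ρ≤n

        m≥1 : 1 ≤ m
        m≥1 = ≤-trans (m≤m+n 1 _) ρ≤m

        4d≤ρ : 4 * d ≤ ρ
        4d≤ρ = m≤n⇒m≤1+n (m≤m+n (4 * d) _)
        4ε≤ρ : 4 * ε ≤ ρ
        4ε≤ρ = m≤n⇒m≤o+n (1 + 4 * d) (m≤m+n (4 * ε) _)
        2y≤ρ : 2 * y ≤ ρ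
        2y≤ρ = m≤n⇒m≤o+n (1 + 4 * d) (m≤n⇒m≤o+n (4 * ε) (m≤m+n (2 * y) _))
        τ≤ρ : τ ≤ ρ
        τ≤ρ = m≤n⇒m≤o+n (1 + 4 * d) (m≤n⇒m≤o+n (4 * ε) (m≤n⇒m≤o+n (2 * y) (m≤m+n τ _)))
        tail≤ρ : 2 * τ * (4 * σ) + (2 * τ * (2 * τ) * (8 * σ) + (2 * β̄ + (4 * δ̄ + 32 * κ))) ≤ ρ
        tail≤ρ = m≤n⇒m≤o+n (1 + 4 * d) (m≤n⇒m≤o+n (4 * ε) (m≤n⇒m≤o+n (2 * y) (m≤n+m _ τ)))
        σ≤ρ : 2 * τ * (4 * σ) ≤ ρ
        σ≤ρ = ≤-trans (m≤m+n (2 * τ * (4 * σ)) _) tail≤ρ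
        ττσ≤ρ : 2 * τ * (2 * τ) * (8 * σ) ≤ ρ
        ττσ≤ρ = ≤-trans (m≤n⇒m≤o+n (2 * τ * (4 * σ)) (m≤m+n (2 * τ * (2 * τ) * (8 * σ)) _)) tail≤ρ
        end≤ρ : 2 * β̄ + (4 * δ̄ + 32 * κ) ≤ ρ
        end≤ρ = ≤-trans (m≤n⇒m≤o+n (2 * τ * (4 * σ)) (m≤n+m _ (2 * τ * (2 * τ) * (8 * σ)))) tail≤ρ

        Bound : ∀ B → ℬ n B ≡ true → card (lookup B) ≤ N
        Bound B B∈ℬ = ≤-trans (≤-reflexive (sym (∣∣≡card B))) (maxOver-bound (ℬ n) ∣_∣ B B∈ℬ)

        links : ∀ B → ℬ n B ≡ true → ∀ v → lookup B v ≡ false → n ≤ k * link (lookup B) v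
        links B B∈ℬ v v∉B = ≤-trans (degrees B B∈ℬ v (λ v∈B → true≢false (∈⇒lookup v∈B) v∉B))
          (*-monoʳ-≤ k (degB≤link Δ codeg B v v∉B))

        F v w : ℕ
        F = n ^ K₃
        v = 2 * (κ * suc n)
        w = 2 * F * v

        F≥1 : 1 ≤ F
        F≥1 = 1≤^ K₃ n≥1

        w≤ : w ≤ 8 * κ * n ^ suc K₃
        w≤ = begin
          2 * F * (2 * (κ * (1 + n)))  ≤⟨ *-monoʳ-≤ (2 * F) (*-monoʳ-≤ 2 (*-monoʳ-≤ κ (+-monoˡ-≤ n n≥1))) ⟩
          2 * F * (2 * (κ * (n + n)))  ≡⟨ id₁ F κ n ⟩
          8 * κ * (n * F)  ∎
          where
          id₁ : ∀ F κ n → 2 * F * (2 * (κ * (n + n))) ≡ 8 * κ * (n * F)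
          id₁ = solve-∀

        v≤w : v ≤ w
        v≤w = m≤n*m v (2 * F) {{>-nonZero (1≤* {2} (s≤s z≤n) F≥1)}}

        w-poly : w * 4 ≤ n ^ c
        w-poly = begin
          w * 4  ≤⟨ *-monoˡ-≤ 4 w≤ ⟩
          8 * κ * (n * F) * 4  ≡⟨ id₁ (8 * κ) (n * F) 4 ⟩
          4 * (8 * κ) * (n * F)  ≡⟨ cong (_* (n * F)) (*-assoc 4 8 κ) ⟨
          32 * κ * (n * F)  ≤⟨ *-monoˡ-≤ (n * F) (≤-trans (≤-trans (m≤n⇒m≤o+n (2 * β̄) (m≤n+m (32 * κ) (4 * δ̄))) end≤ρ) ρ≤n) ⟩
          n * (n * F)  ∎
          where
          id₁ : ∀ a b f → a * b * f ≡ f * a * b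
          id₁ = solve-∀

        gap⇒bound : ∀ b → N ≡ m + b → n ≤ c̄ * b → κ * numIndepBad (H n) (ℬ n) m ≤ numIndep (H n) m
        gap⇒bound b N≡ n≤c̄b = begin
          κ * numIndepBad (H n) (ℬ n) m  ≤⟨ combine κ far near ⟩
          (m + b) choose m  ≤⟨ many-independent (m + b) J (proj₁ (proj₂ maximal)) (≤-trans (≤-reflexive (sym N≡)) (≤-trans (norm≤ n) (proj₂ (proj₂ maximal)))) ⟩
          numIndep (H n) m  ∎
          where
          b≥1 : 1 ≤ b
          b≥1 = n≢0⇒n>0 λ b≡0 → <⇒≱ n≥1 (≤-trans n≤c̄b (≤-reflexive (trans (cong (c̄ *_) b≡0) (*-zeroʳ c̄))))
          -- `maxOver` has default value 0, so a maximiser exists only for a positive maximum.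
          N≥1 : 1 ≤ N
          N≥1 = ≤-trans (≤-trans m≥1 (m≤m+n m b)) (≤-reflexive (sym N≡))
          largest = maxOver-attained (ℬ n) ∣_∣ N≥1
          N≤n : m + b ≤ n
          N≤n = ≤-trans (≤-reflexive (sym N≡)) (≤-trans (proj₂ (proj₂ largest)) (∣p∣≤n (proj₁ largest)))
          maximal = maxOver-attained (isIndependent (H n)) ∣_∣ (≤-trans N≥1 (norm≤ n))
          J = proj₁ maximal
          open Estimates (H n) (ℬ n) Δ codeg m b m≥1 b≥1 N≤n Δ≥1 c̄ c̄≥1 n≤c̄b
            (λ B B∈ℬ → ≤-trans (Bound B B∈ℬ) (≤-reflexive N≡))
          open Split b m≥1 b≥1 N≤n δ̄ using (combine)
          far = far-part K β̄ δ̄ v β̄≥1 δ̄≥1 nn≤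
            (λ A h → stable-VSet g β̄ stable n A (subst (λ t → β̄ * t ≤ β̄ * card A + n) (sym N≡) h))
            (≤-trans τ≤ρ ρ≤m) (≤-trans σ≤ρ ρ≤m) (≤-trans (*-monoˡ-≤ n ττσ≤ρ) ρn≤mm)
            (≤-trans (≤-trans (m≤m+n (2 * β̄) _) end≤ρ) ρ≤m)
            (≤-trans (≤-trans (m≤n⇒m≤o+n (2 * β̄) (m≤m+n (4 * δ̄) _)) end≤ρ) ρ≤m)
            (≤-trans (^-monoˡ-≤ (8 * β̄) (≤-trans v≤w w≤)) (proj₂ (proj₂ (proj₂ (proj₂ (proj₂ large₂))))))
          near = near-part k c ε ℓ F v k≥1 ≤-refl (≤-trans 4d≤ρ ρ≤n) (≤-trans 4ε≤ρ ρ≤m) (≤-trans 2y≤ρ ρ≤m)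
            (proj₁ (proj₂ large₁)) (proj₁ (proj₂ (proj₂ large₁))) C-large links F≥1 size
            (≤-trans (^-monoˡ-≤ (8 * y) w≤) (proj₂ (proj₂ (proj₂ (proj₂ (proj₂ large₁)))))) w-poly

        conclusion : κ * numIndepBad (H n) (ℬ n) m ≤ numIndep (H n) m
        conclusion = decide (1 ≤? numIndepBad (H n) (ℬ n) m)
          where
          decide : Dec (1 ≤ numIndepBad (H n) (ℬ n) m) → κ * numIndepBad (H n) (ℬ n) m ≤ numIndep (H n) m
          decide (no none) = ≤-trans (≤-reflexive (trans (cong (κ *_) (n<1⇒n≡0 (≰⇒> none))) (*-zeroʳ κ))) z≤n
          -- A single bad set already forces `m` to stay away from `‖ℬ‖`, which supplies the `b` on
          -- which the weights are based.
          decide (yes some) =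
            let I , p = ∑ˢ-pos (𝟙 ∘ bad) (≤-trans some (≤-reflexive (count≡∑ˢ bad)))
                b , N≡ , n≤c̄b = Bad⇒gap k g₀ K β₀ N n≥1 k≥1 Δ≥1 β₀≥1 refl nn≤ Bound links (stable-VSet g₀ β₀ stable₀ n) I (𝟙-pos p)
            in gap⇒bound b N≡ n≤c̄b

theorem2p2 : (α : ℝ) → InUnitInterval α →
    (H : (n : ℕ) → Hypergraph3 n) → (ℬ : (n : ℕ) → Family n) →
    Stable α H ℬ →
    (∃ λ K → Eventually λ n → n * n ≤ K * e (H n) × e (H n) ≤ K * (n * n)) →
    (∃ λ K → Eventually λ n → Δ₂≤ (H n) K) →
    (∃ λ K → Eventually λ n → familySize (ℬ n) ≤ n ^ K) →
    (∀ n → familyNorm (ℬ n) ≤ independenceNumber (H n)) →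
    (∀ n → ∀ q → ℝ.L α q → q ℚ.* ℕ→ℚ n ℚ.≤ ℕ→ℚ (familyNorm (ℬ n))) →
    (∃ λ K → Eventually λ n → Kδ≥ (H n) (ℬ n) K n) →
    ∃ λ (C : ℕ) → 1 ≤ C ×
    (∀ (k : ℕ) → 1 ≤ k → Eventually λ n → ∀ (m : ℕ) →
    C * C * n * ⌊log₂ n ⌋ ≤ m * m →
    k * numIndepBad (H n) (ℬ n) m ≤ numIndep (H n) m)
theorem2p2 α _ H ℬ stable (K , N₁ , edges) (K₂ , N₂ , codegrees) (K₃ , N₃ , sizes) norm≤ norm≥ (K₄ , N₄ , degrees) =
  C₀ , C₀≥1 , λ κ κ≥1 →
  N₁ + (N₂ + (N₃ + (N₄ + (At.T₁ κ κ≥1 + At.T₂ κ κ≥1)))) , λ n n≥ m m-large →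
    At.conclusion κ κ≥1 n
      (≤-trans (m≤n⇒m≤o+n N₁ (m≤n⇒m≤o+n N₂ (m≤n⇒m≤o+n N₃ (m≤n⇒m≤o+n N₄ (m≤m+n (At.T₁ κ κ≥1) (At.T₂ κ κ≥1)))))) n≥)
      (≤-trans (m≤n⇒m≤o+n N₁ (m≤n⇒m≤o+n N₂ (m≤n⇒m≤o+n N₃ (m≤n⇒m≤o+n N₄ (m≤n+m (At.T₂ κ κ≥1) (At.T₁ κ κ≥1)))))) n≥)
      (proj₁ (edges n (≤-trans (m≤m+n N₁ _) n≥)))
      (λ x y x≢y → m≤n⇒m≤1+n (codegrees n (≤-trans (m≤n⇒m≤o+n N₁ (m≤m+n N₂ _)) n≥) x y x≢y))
      (sizes n (≤-trans (m≤n⇒m≤o+n N₁ (m≤n⇒m≤o+n N₂ (m≤m+n N₃ _))) n≥))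
      (λ B B∈ℬ v v∉B → ≤-trans (degrees n (≤-trans (m≤n⇒m≤o+n N₁ (m≤n⇒m≤o+n N₂ (m≤n⇒m≤o+n N₃ (m≤m+n N₄ _)))) n≥) B B∈ℬ v v∉B) (m≤n+m _ _))
      m m-large
  where
  -- Passing to successors makes `Δ` and `k` positive without weakening what is known about them.
  open Assembly H ℬ K K₃ (suc K₂) (suc K₄) (s≤s z≤n) (s≤s z≤n) norm≤
  stable₀ = stable-ℕ α H ℬ stable norm≥ g₀ (1≤* {4} (s≤s z≤n) (1≤* {suc K₄} (s≤s z≤n) (s≤s z≤n)))
  open Stage₁ (proj₁ stable₀) (proj₁ (proj₂ stable₀)) (proj₂ (proj₂ stable₀))
  stable₁ = stable-ℕ α H ℬ stable norm≥ g g≥1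
  module At (κ : ℕ) (κ≥1 : 1 ≤ κ) = Stage₂ (proj₁ stable₁) (proj₁ (proj₂ stable₁)) (proj₂ (proj₂ stable₁)) κ κ≥1
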